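{- Let $n,m,t \geq 1$ and let $s\ge1$ be an integer with $s \leq m/2$. Then $w(\mathbb{Z}_m^n,t,s) = w(n,t,s/m)$. Furthermore, if $s < m/2$ and $\mathcal{F}\subseteq\mathbb{Z}_m^n$ is $t$-agreeing up to $s$ and has measure $w(n,t,s/m)$, then $\mathcal{F}$ is equivalent to a $t$-intersecting family on $n$ points of $\mu_{s/m}$-measure $w(n,t,s/m)$. The same holds if $m=2$, $s=1$ and $t > 1$.
   Context: A family on $\mathbb{Z}_m^n$ is a subset of $\mathbb{Z}_m^n$, measured by the uniform probability measure $\mu_m^n$. For $s\le m/2$, $\mathcal{F}\subseteq\mathbb{Z}_m^n$ is $t$-agreeing up to $s$ if every $x,y\in\mathcal{F}$ have $t$ distinct coordinates $i_1,\dots,i_t$ with $x_{i_j}-y_{i_j}\in\{ -(s-1),\dots,s-1\}$ (subtraction in $\mathbb{Z}_m$). $w(\mathbb{Z}_m^n,t,s)$ is the maximum measure of such a family. For a family on $n$ points (a set of subsets of $[n]$), $t$-intersecting means any two members share at least $t$ elements; $\mu_p(A)=p^{|A|}(1-p)^{n-|A|}$; and $w(n,t,p)$ is the maximum $\mu_p$-measure of a $t$-intersecting family on $n$ points (equal to $0$, attained only by the empty family, if $n<t$). For $y\in\mathbb{Z}_m^n$ let $\sigma_y\colon\mathbb{Z}_m^n\to 2^{[n]}$, $\sigma_y(x)=\{i\in[n] : x_i-y_i\in\{1,\dots,s\}\}$. A family $\mathcal{F}\subseteq\mathbb{Z}_m^n$ is equivalent to a family $\mathcal{G}$ on $n$ points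 if $\mathcal{F}=\sigma_y^{ -1}(\mathcal{G})$ for some $y\in\mathbb{Z}_m^n$. -}

module Defs where

open import Data.Bool using (Bool; true; false)
open import Data.Nat using (ℕ; zero; suc; _+_; _*_; _∸_; _^_; _<_; _≤_; NonZero)
open import Data.Nat.Properties using (m^n≢0)
open import Data.Integer using (+_)
open import Data.Rational using (ℚ; 0ℚ; 1ℚ; _/_) renaming (_≤_ to _≤ℚ_; _+_ to _+ℚ_; _*_ to _*ℚ_; _-_ to _-ℚ_)
open import Data.Fin using (Fin; toℕ)
open import Data.Fin.Subset using (Subset; _∩_; ∣_∣)
open import Data.Vec using (Vec; []; _∷_; lookup; tabulate)
open import Data.List using (List; []; _∷_; map; concatMap; filter; length; foldr; allFin)
open import Data.Product using (Σ; ∃; _×_; _,_)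
open import Data.Sum using (_⊎_)
open import Function.Definitions using (Injective)
open import Relation.Binary.PropositionalEquality using (_≡_)
open import Relation.Nullary using (Dec; does)
open import Data.Bool using (T; _∧_; if_then_else_)
open import Data.Nat using (_≤ᵇ_)

allVecs : {A : Set} → List A → (n : ℕ) → List (Vec A n)
allVecs xs zero    = [] ∷ []
allVecs xs (suc n) = concatMap (λ x → map (x ∷_) (allVecs xs n)) xs

allPoints : (m n : ℕ) → List (Vec (Fin m) n)
allPoints m n = allVecs (allFin m) n

allSubsets : (n : ℕ) → List (Subset n)
allSubsets n = allVecs (false ∷ true ∷ []) n

FamilyZ : (m n : ℕ) → Set
FamilyZ m n = Vec (Fin m) n → Bool

FamilyP : (n : ℕ) → Set
FamilyP n = Subset n → Bool

count : {A : Set} → (A → Bool) → List A → ℕ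
count f xs = length (filter (λ x → T? (f x)) xs)
  where
  open import Data.Bool.Properties using (T?)

μZ : (m n : ℕ) .{{_ : NonZero m}} → FamilyZ m n → ℚ
μZ m n F = _/_ (+ count F (allPoints m n)) (m ^ n) {{m^n≢0 m n}}

_^ℚ_ : ℚ → ℕ → ℚ
p ^ℚ zero  = 1ℚ
p ^ℚ suc k = p *ℚ (p ^ℚ k)

μpSet : (n : ℕ) → ℚ → Subset n → ℚ
μpSet n p A = (p ^ℚ ∣ A ∣) *ℚ ((1ℚ -ℚ p) ^ℚ (n ∸ ∣ A ∣))

μp : (n : ℕ) → ℚ → FamilyP n → ℚ
μp n p G = foldr (λ A acc → (if G A then μpSet n p A else 0ℚ) +ℚ acc) 0ℚ (allSubsets n)

-- a - b ∈ {-(s-1), …, s-1} in ℤ_m   (a , b < m, so a - b ≡ ±k mod m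
-- with 0 ≤ k < s means one of the four listed equations)
CloseUpTo : {m : ℕ} → ℕ → Fin m → Fin m → Set
CloseUpTo {m} s a b = ∃ λ k → k < s ×
  ( (toℕ a ≡ toℕ b + k) ⊎ (toℕ a + m ≡ toℕ b + k)
  ⊎ (toℕ b ≡ toℕ a + k) ⊎ (toℕ b + m ≡ toℕ a + k))

AgreeUpTo : {m n : ℕ} → ℕ → ℕ → Vec (Fin m) n → Vec (Fin m) n → Set
AgreeUpTo {m} {n} t s x y =
  Σ (Fin t → Fin n) λ f → Injective _≡_ _≡_ f ×
    ((j : Fin t) → CloseUpTo s (lookup x (f j)) (lookup y (f j)))

IsAgreeing : {m n : ℕ} → ℕ → ℕ → FamilyZ m n → Set
IsAgreeing {m} {n} t s F =
  (x y : Vec (Fin m) n) → F x ≡ true → F y ≡ true → AgreeUpTo t s x y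

IsIntersecting : {n : ℕ} → ℕ → FamilyP n → Set
IsIntersecting {n} t G =
  (A B : Subset n) → G A ≡ true → G B ≡ true → t ≤ ∣ A ∩ B ∣

IsMaxAgreeing : (m n t s : ℕ) .{{_ : NonZero m}} → ℚ → Set
IsMaxAgreeing m n t s v =
  (Σ (FamilyZ m n) λ F → IsAgreeing t s F × μZ m n F ≡ v)
  × ((F : FamilyZ m n) → IsAgreeing t s F → μZ m n F ≤ℚ v)

IsMaxIntersecting : (n t : ℕ) → ℚ → ℚ → Set
IsMaxIntersecting n t p v =
  (Σ (FamilyP n) λ G → IsIntersecting t G × μp n p G ≡ v)
  × ((G : FamilyP n) → IsIntersecting t G → μp n p G ≤ℚ v)

diffMod : {m : ℕ} → Fin m → Fin m → ℕ
diffMod {m} a b = if toℕ b ≤ᵇ toℕ a then toℕ a ∸ toℕ b else (toℕ a + m) ∸ toℕ b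

σ : {m n : ℕ} → ℕ → Vec (Fin m) n → Vec (Fin m) n → Subset n
σ s y x = tabulate λ i → (1 ≤ᵇ diffMod (lookup x i) (lookup y i)) ∧ (diffMod (lookup x i) (lookup y i) ≤ᵇ s)

IsPreimage : {m n : ℕ} → ℕ → Vec (Fin m) n → FamilyZ m n → FamilyP n → Set
IsPreimage {m} {n} s y F G = (x : Vec (Fin m) n) → F x ≡ G (σ s y x)

{-# OPTIONS --safe #-}
-- Replacing each line of F in a direction ℤₘ by a subset of {0, 1}, according to whether its size k satisfies r ≤ k or
-- 2s + 1 ≤ k + r, keeps the family agreeing, because two cross-close subsets of ℤₘ have at most 2s elements together.
-- Averaging over 1 ≤ r ≤ s does not decrease the measure, so coordinate by coordinate F becomes a t-intersecting family.
--
-- In case of equality every line is empty, full or of size s, and the lines of size s of two points agreeing in only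
-- t - 1 other coordinates are the same window. So it must be seen that the points with such a line are connected by
-- these pairs. This follows once the optimal t-intersecting families are known to be the families of all A with
-- |A ∩ R| ≥ t + r, |R| = t + 2r, for which the graph is a Kneser-like graph. That is the uniqueness part of the weighted
-- complete intersection theorem. It is proved by the pushing and pulling exchanges of Ahlswede and Khachatrian for
-- shifted families, and it survives undoing a shift by the same connectivity argument.
module Submission where

open import Defs
open import Data.Bool using (Bool; true; false; _∧_; _∨_; not; T; if_then_else_)
open import Data.Empty using (⊥; ⊥-elim)
open import Data.Fin using (Fin; zero; suc; toℕ; inject≤)
open import Data.Fin.Properties using (toℕ-fromℕ<; toℕ-injective; toℕ<n; inject≤-injective; injective⇒≤) renaming (suc-injective to suc-injectiveᶠ; _≟_ to _≟ᶠ_)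
open import Data.Fin.Subset using (∣_∣; _∩_)
open import Data.List using (List; []; _∷_; _++_; map; concatMap; allFin; foldr)
open import Data.List.Membership.Propositional using (_∈_)
open import Data.List.Membership.Propositional.Properties using (∈-map⁺; ∈-concatMap⁺; ∈-allFin)
open import Data.List.Relation.Unary.Any using (Any; here; there)
open import Data.Nat hiding (_/_; equal; compare)
open import Data.Nat.DivMod using (_%_; _mod_; m%n<n; m<n⇒m%n≡m; [m+n]%n≡m%n; %-distribˡ-+; m≤n⇒[n∸m]%m≡n%m; m≡m%n+[m/n]*n)
open import Data.Nat.Properties
open import Data.Nat.Tactic.RingSolver using (solve-∀)
open import Data.Product using (Σ; ∃; _×_; _,_; proj₁; proj₂)
open import Data.Rational using (ℚ; 0ℚ; 1ℚ; _/_) renaming (_≤_ to _≤ℚ_; _+_ to _+ℚ_; _*_ to _*ℚ_; _-_ to _-ℚ_; -_ to -ℚ_)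
open import Data.Rational.Unnormalised using (mkℚᵘ; *≡*; *≤*)
open import Data.Sum using (_⊎_; inj₁; inj₂)
open import Data.Unit using (⊤; tt)
open import Data.Vec using (Vec; []; _∷_; lookup; splitAt) renaming (_++_ to _⧺_)
open import Function using (_∘_)
open import Function.Definitions using (Injective)
open import Relation.Binary.Definitions using (tri<; tri≈; tri>)
open import Relation.Binary.PropositionalEquality using (_≡_; _≢_; refl; sym; trans; cong; cong₂; subst; subst₂)
open import Relation.Nullary using (Dec; yes; no)
import Data.Bool.Properties as Bool
import Data.Integer as ℤ
import Data.Integer.Properties as ℤ
import Data.List.Properties as List
import Data.Nat.DivMod as DivMod
import Data.Rational.Properties as ℚ
import Data.Rational.Unnormalised.Properties as ℚᵘ
import Data.Vec as Vec

-- Finite sums and exchanges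

-- Measures are kept as integers: a one weighs s and a zero m - s, so a family on n points weighs
-- m^n times its measure, and fractions enter only at the end. The sum over r is tuned so that a
-- line of k points is worth exactly s k for k ≤ s and for k = m, and strictly more for s < k < m if
-- 2s < m. Equality thus excludes s < k < m; comparing r = 1 with r = s then excludes 0 < k < s.
-- Connectivity is proved once for an abstract alphabet with windows. It is used with the letters 0,
-- 1 to see that a shifted element comes from the same place for all middle sets, and with ℤₘ for
-- the windows. The delicate case is m = 2. Both weights are then 1, so the exchanges that wipe out
-- off-centre pivots for unequal weights only show that two groups of pivots weigh the same. It is
-- settled by exchanging in both directions: the two results would be one and the same threshold
-- family. Moreover, two distinct letters have no common far letter, which obstructs moving in
-- ignored coordinates; but for t > 1 an optimal family with equal weights ignores at most one
-- coordinate.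

lin : ∀ {A B x y} k → A ≤ B → y + A ≡ x + B + k → x ≤ y
lin {A} {B} {x} {y} k h e = +-cancelʳ-≤ B x y (begin
  x + B      ≤⟨ m≤m+n (x + B) k ⟩
  x + B + k  ≡⟨ sym e ⟩
  y + A      ≤⟨ +-monoʳ-≤ y h ⟩
  y + B      ∎)
  where open ≤-Reasoning

-- Linear arithmetic is done with `lin` and this lemma: hypotheses are added up with multipliers to
-- one inequality `A ≤ B`, and the ring solver checks that the goal differs from it by the slack
-- `k`.
lin-absurd : ∀ {A B} k → A ≤ B → A ≡ suc (B + k) → ⊥
lin-absurd {A} {B} k h e = 1+n≰n (≤-trans (s≤s (m≤m+n B k)) (≤-trans (≤-reflexive (sym e)) h))

true≢false : ∀ {b} → b ≡ true → b ≡ false → ⊥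
true≢false refl ()

∧-true : ∀ {a b} → a ∧ b ≡ true → a ≡ true × b ≡ true
∧-true {true} {true} _ = refl , refl

true-∧ : ∀ {a b} → a ≡ true → b ≡ true → a ∧ b ≡ true
true-∧ refl refl = refl

not-true : ∀ {a} → not a ≡ true → a ≡ false
not-true {false} _ = refl

not-false : ∀ {a} → not a ≡ false → a ≡ true
not-false {true} _ = refl

≤ᵇ-true : ∀ {m n} → (m ≤ᵇ n) ≡ true → m ≤ n
≤ᵇ-true {m} {n} e = ≤ᵇ⇒≤ m n (subst T (sym e) tt)

true-≤ᵇ : ∀ {m n} → m ≤ n → (m ≤ᵇ n) ≡ true
true-≤ᵇ {m} {n} h with m ≤ᵇ n in e
... | true  = refl
... | false = ⊥-elim (subst T e (≤⇒≤ᵇ h))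

≤ᵇ-false : ∀ {m n} → (m ≤ᵇ n) ≡ false → n < m
≤ᵇ-false e = ≰⇒> (λ h → true≢false (true-≤ᵇ h) e)

false-≤ᵇ : ∀ {m n} → n < m → (m ≤ᵇ n) ≡ false
false-≤ᵇ {m} {n} h with m ≤ᵇ n in e
... | false = refl
... | true  = ⊥-elim (<⇒≱ h (≤ᵇ-true e))

true-or-false : ∀ b → b ≡ true ⊎ b ≡ false
true-or-false true  = inj₁ refl
true-or-false false = inj₂ refl

≤ᵇ-suc : ∀ c s → (c ≤ᵇ s) ≡ (c <ᵇ suc s)
≤ᵇ-suc zero    s = refl
≤ᵇ-suc (suc c) s = refl

≡ᵇ-true : ∀ {m n} → (m ≡ᵇ n) ≡ true → m ≡ n
≡ᵇ-true {m} {n} e = ≡ᵇ⇒≡ m n (subst T (sym e) tt)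

true-≡ᵇ : ∀ n → (n ≡ᵇ n) ≡ true
true-≡ᵇ zero    = refl
true-≡ᵇ (suc n) = true-≡ᵇ n

bool-ext : ∀ {a b} → (a ≡ true → b ≡ true) → (b ≡ true → a ≡ true) → a ≡ b
bool-ext {true}  {true}  f g = refl
bool-ext {false} {false} f g = refl
bool-ext {true}  {false} f g = sym (f refl)
bool-ext {false} {true}  f g = g refl

ι : Bool → ℕ
ι true  = 1
ι false = 0

ι≤1 : ∀ b → ι b ≤ 1
ι≤1 true  = ≤-refl
ι≤1 false = z≤n

ι-mono : ∀ {a b} → (a ≡ true → b ≡ true) → ι a ≤ ι b
ι-mono {false}        h = z≤n
ι-mono {true} {true}  h = ≤-refl
ι-mono {true} {false} h = ⊥-elim (true≢false refl (sym (h refl)))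

ι-∧ : ∀ a b → ι (a ∧ b) ≡ ι a * ι b
ι-∧ true  true  = refl
ι-∧ true  false = refl
ι-∧ false b     = refl

∑ : {A : Set} → List A → (A → ℕ) → ℕ
∑ []       f = 0
∑ (x ∷ xs) f = f x + ∑ xs f

module _ {A : Set} where

  ∑-cong : (xs : List A) {f g : A → ℕ} → (∀ x → f x ≡ g x) → ∑ xs f ≡ ∑ xs g
  ∑-cong []       h = refl
  ∑-cong (x ∷ xs) h = cong₂ _+_ (h x) (∑-cong xs h)

  ∑-mono : (xs : List A) {f g : A → ℕ} → (∀ x → f x ≤ g x) → ∑ xs f ≤ ∑ xs g
  ∑-mono []       h = z≤n
  ∑-mono (x ∷ xs) h = +-mono-≤ (h x) (∑-mono xs h)

  ∑-zero : (xs : List A) → ∑ xs (λ _ → 0) ≡ 0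
  ∑-zero []       = refl
  ∑-zero (x ∷ xs) = ∑-zero xs

  ∑-+ : (xs : List A) (f g : A → ℕ) → ∑ xs (λ x → f x + g x) ≡ ∑ xs f + ∑ xs g
  ∑-+ []       f g = refl
  ∑-+ (x ∷ xs) f g rewrite ∑-+ xs f g = lemma (f x) (g x) (∑ xs f) (∑ xs g)
    where
    lemma : ∀ a b c d → a + b + (c + d) ≡ a + c + (b + d)
    lemma = solve-∀

  ∑-*ˡ : (xs : List A) (c : ℕ) (f : A → ℕ) → ∑ xs (λ x → c * f x) ≡ c * ∑ xs f
  ∑-*ˡ []       c f = sym (*-zeroʳ c)
  ∑-*ˡ (x ∷ xs) c f rewrite ∑-*ˡ xs c f = sym (*-distribˡ-+ c (f x) (∑ xs f))

  ∑-++ : (xs ys : List A) (f : A → ℕ) → ∑ (xs ++ ys) f ≡ ∑ xs f + ∑ ys f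
  ∑-++ []       ys f = refl
  ∑-++ (x ∷ xs) ys f rewrite ∑-++ xs ys f = sym (+-assoc (f x) _ _)

  ∑-term : {xs : List A} (f : A → ℕ) {x : A} → x ∈ xs → f x ≤ ∑ xs f
  ∑-term {y ∷ ys} f (here refl) = m≤m+n _ _
  ∑-term {y ∷ ys} f (there i)   = ≤-trans (∑-term f i) (m≤n+m _ (f y))

  -- Termwise inequalities whose sums agree are equalities; the pointwise equality cases of the
  -- averaging arguments are read off from this.
  ∑-squeeze : {xs : List A} {f g : A → ℕ} → (∀ x → f x ≤ g x) → ∑ xs g ≤ ∑ xs f →
    ∀ {x} → x ∈ xs → f x ≡ g x
  ∑-squeeze {y ∷ ys} {f} {g} h e (here refl) = ≤-antisym (h y)
    (+-cancelʳ-≤ (∑ ys f) (g y) (f y) (≤-trans (+-monoʳ-≤ (g y) (∑-mono ys h)) e))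
  ∑-squeeze {y ∷ ys} {f} {g} h e (there i) = ∑-squeeze h
    (+-cancelˡ-≤ (g y) (∑ ys g) (∑ ys f) (≤-trans e (+-monoˡ-≤ (∑ ys f) (h y)))) i

∑-*ʳ : {A : Set} (xs : List A) (f : A → ℕ) (c : ℕ) → ∑ xs (λ x → f x * c) ≡ ∑ xs f * c
∑-*ʳ xs f c = trans (∑-cong xs (λ x → *-comm (f x) c)) (trans (∑-*ˡ xs c f) (*-comm c _))

∑-swap : {A B : Set} (xs : List A) (ys : List B) (f : A → B → ℕ) →
  ∑ xs (λ x → ∑ ys (f x)) ≡ ∑ ys (λ y → ∑ xs (λ x → f x y))
∑-swap []       ys f = sym (∑-zero ys)
∑-swap (x ∷ xs) ys f = trans (cong (∑ ys (f x) +_) (∑-swap xs ys f))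
  (sym (∑-+ ys (f x) (λ y → ∑ xs (λ x → f x y))))

∑-map : {A B : Set} (h : A → B) (xs : List A) (f : B → ℕ) → ∑ (map h xs) f ≡ ∑ xs (f ∘ h)
∑-map h []       f = refl
∑-map h (x ∷ xs) f = cong (f (h x) +_) (∑-map h xs f)

∑-concatMap : {A B : Set} (h : A → List B) (xs : List A) (f : B → ℕ) →
  ∑ (concatMap h xs) f ≡ ∑ xs (λ x → ∑ (h x) f)
∑-concatMap h []       f = refl
∑-concatMap h (x ∷ xs) f =
  trans (∑-++ (h x) (concatMap h xs) f) (cong (∑ (h x) f +_) (∑-concatMap h xs f))

∑-allVecs : {A : Set} (xs : List A) (n : ℕ) (f : Vec A (suc n) → ℕ) →
  ∑ (allVecs xs (suc n)) f ≡ ∑ xs (λ x → ∑ (allVecs xs n) (λ v → f (x ∷ v)))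
∑-allVecs xs n f = trans (∑-concatMap (λ x → map (x ∷_) (allVecs xs n)) xs f)
  (∑-cong xs (λ x → ∑-map (x ∷_) (allVecs xs n) f))

∑-allFin : ∀ n (f : Fin (suc n) → ℕ) → ∑ (allFin (suc n)) f ≡ f zero + ∑ (allFin n) (f ∘ suc)
∑-allFin n f = cong (f zero +_)
  (trans (cong (λ l → ∑ l f) (sym (List.map-tabulate (λ i → i) suc))) (∑-map suc (allFin n) f))

∈-allVecs : {A : Set} {xs : List A} → (∀ x → x ∈ xs) → ∀ {n} (v : Vec A n) → v ∈ allVecs xs n
∈-allVecs c []       = here refl
∈-allVecs {xs = xs} c {suc n} (x ∷ v) =
  ∈-concatMap⁺ (λ x → map (x ∷_) (allVecs xs n)) (member (c x))
  where
  member : ∀ {ys} → x ∈ ys → Any (λ y → x ∷ v ∈ map (y ∷_) (allVecs xs n)) ys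
  member (here refl) = here (∈-map⁺ (x ∷_) (∈-allVecs c v))
  member (there i)   = there (member i)

search : {A : Set} (xs : List A) (P : A → Bool) →
  (∃ λ x → P x ≡ true) ⊎ (∀ {x} → x ∈ xs → P x ≡ false)
search []       P = inj₂ (λ ())
search (x ∷ xs) P with P x in e
... | true  = inj₁ (x , e)
... | false with search xs P
...   | inj₁ r = inj₁ r
...   | inj₂ h = inj₂ (λ { (here refl) → e ; (there i) → h i })

module Exchange {A : Set} (xs : List A) (w : A → ℕ) where

  μ : (A → Bool) → ℕ
  μ G = ∑ xs (λ x → ι (G x) * w x)

  μ-cong : ∀ {G H} → (∀ x → G x ≡ H x) → μ G ≡ μ H
  μ-cong h = ∑-cong xs (λ x → cong (λ b → ι b * w x) (h x))

  μ-mono : ∀ {G H} → (∀ x → G x ≡ true → H x ≡ true) → μ G ≤ μ H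
  μ-mono h = ∑-mono xs (λ x → *-monoˡ-≤ (w x) (ι-mono (h x)))

  swap : (G Rem Add : A → Bool) → A → Bool
  swap G Rem Add x = (G x ∧ not (Rem x)) ∨ Add x

  -- Subtraction-free form of μ(G) - μ(Rem) + μ(Add). `Rem` lies inside `G` and `Add` outside, so no
  -- point is counted twice.
  μ-swap : (G Rem Add : A → Bool) →
    (∀ x → Rem x ≡ true → G x ≡ true) → (∀ x → Add x ≡ true → G x ≡ false) →
    μ (swap G Rem Add) + μ Rem ≡ μ G + μ Add
  μ-swap G Rem Add hr ha = trans (sym (∑-+ xs _ _)) (trans (∑-cong xs pointwise) (∑-+ xs _ _))
    where
    cases : ∀ g r a k → (r ≡ true → g ≡ true) → (a ≡ true → g ≡ false) →
      ι ((g ∧ not r) ∨ a) * k + ι r * k ≡ ι g * k + ι a * k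
    cases true  true  true  k hr ha = ⊥-elim (true≢false refl (ha refl))
    cases true  true  false k hr ha = +-comm 0 (k + 0)
    cases true  false true  k hr ha = ⊥-elim (true≢false refl (ha refl))
    cases true  false false k hr ha = refl
    cases false true  a     k hr ha = ⊥-elim (true≢false (hr refl) refl)
    cases false false a     k hr ha = +-comm (ι a * k) 0
    pointwise : ∀ x → _
    pointwise x = cases (G x) (Rem x) (Add x) (w x) (hr x) (ha x)

  μ-zero : ∀ {G} → (∀ x → G x ≡ false) → μ G ≡ 0
  μ-zero h = trans (μ-cong h) (∑-zero xs)

  module Complete (mem : ∀ x → x ∈ xs) (w>0 : ∀ x → 1 ≤ w x) where

    μ-pos : ∀ {G x} → G x ≡ true → 1 ≤ μ G
    μ-pos {G} {x} e = ≤-trans (w>0 x) (≤-trans (≤-reflexive (sym (trans (cong (λ b → ι b * w x) e) (+-identityʳ (w x)))))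
      (∑-term (λ x → ι (G x) * w x) (mem x)))

    μ≡0 : ∀ {G} → μ G ≡ 0 → ∀ x → G x ≡ false
    μ≡0 {G} h x with G x in e
    ... | false = refl
    ... | true  = ⊥-elim (<⇒≢ (μ-pos {G} e) (sym h))

-- Families of subsets

V : ℕ → Set
V n = Vec Bool n

B : (n : ℕ) → List (V n)
B = allSubsets

∈-B : ∀ {n} (v : V n) → v ∈ B n
∈-B = ∈-allVecs (λ { false → here refl ; true → there (here refl) })

∑-B : ∀ n (f : V (suc n) → ℕ) →
  ∑ (B (suc n)) f ≡ ∑ (B n) (λ v → f (false ∷ v)) + ∑ (B n) (λ v → f (true ∷ v))
∑-B n f = trans (∑-allVecs (false ∷ true ∷ []) n f) (cong (∑ (B n) (λ v → f (false ∷ v)) +_) (+-identityʳ _))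

size : ∀ {n} → V n → ℕ
size []      = 0
size (a ∷ v) = ι a + size v

int : ∀ {n} → V n → V n → ℕ
int []      []      = 0
int (a ∷ v) (b ∷ u) = ι (a ∧ b) + int v u

int-comm : ∀ {n} (v u : V n) → int v u ≡ int u v
int-comm []      []      = refl
int-comm (a ∷ v) (b ∷ u) = cong₂ (λ x y → ι x + y) (Bool.∧-comm a b) (int-comm v u)

int-self : ∀ {n} (v : V n) → int v v ≡ size v
int-self []          = refl
int-self (true ∷ v)  = cong suc (int-self v)
int-self (false ∷ v) = int-self v

int≤size : ∀ {n} (v u : V n) → int v u ≤ size v
int≤size []          []          = z≤n
int≤size (false ∷ v) (b ∷ u)     = int≤size v u
int≤size (true ∷ v)  (true ∷ u)  = s≤s (int≤size v u)
int≤size (true ∷ v)  (false ∷ u) = m≤n⇒m≤1+n (int≤size v u)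

size≤ : ∀ {n} (v : V n) → size v ≤ n
size≤ []          = z≤n
size≤ (true ∷ v)  = s≤s (size≤ v)
size≤ (false ∷ v) = m≤n⇒m≤1+n (size≤ v)

size+size≤ : ∀ {n} (v u : V n) → size v + size u ≤ n + int v u
size+size≤ []          []          = z≤n
size+size≤ {suc n} (false ∷ v) (false ∷ u) = m≤n⇒m≤1+n (size+size≤ v u)
size+size≤ {suc n} (false ∷ v) (true ∷ u)  rewrite +-suc (size v) (size u) = s≤s (size+size≤ v u)
size+size≤ {suc n} (true ∷ v)  (false ∷ u) = s≤s (size+size≤ v u)
size+size≤ {suc n} (true ∷ v)  (true ∷ u)
  rewrite +-suc (size v) (size u) | +-suc n (int v u) = s≤s (s≤s (size+size≤ v u))

-- Inclusion and exclusion inside r. This is what makes threshold families t-intersecting.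
int-relative : ∀ {n} (v u r : V n) → int v r + int u r ≤ size r + int v u
int-relative []      []      []          = z≤n
int-relative (a ∷ v) (b ∷ u) (false ∷ r) rewrite Bool.∧-zeroʳ a | Bool.∧-zeroʳ b =
  ≤-trans (int-relative v u r) (+-monoʳ-≤ (size r) (m≤n+m (int v u) (ι (a ∧ b))))
int-relative (a ∷ v) (b ∷ u) (true ∷ r) rewrite Bool.∧-identityʳ a | Bool.∧-identityʳ b =
  lin 0 (+-mono-≤ (cases a b) (int-relative v u r)) (shuffle (ι a) (ι b) (ι (a ∧ b)) (int v r) (int u r) (size r) (int v u))
  where
  cases : ∀ a b → ι a + ι b ≤ 1 + ι (a ∧ b)
  cases true  true  = ≤-refl
  cases true  false = ≤-refl
  cases false true  = ≤-refl
  cases false false = z≤n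
  shuffle : ∀ x y z i j s k → 1 + s + (z + k) + (x + y + (i + j)) ≡ x + i + (y + j) + (1 + z + (s + k)) + 0
  shuffle = solve-∀

∣∣≡size : ∀ {n} (v : V n) → ∣ v ∣ ≡ size v
∣∣≡size []          = refl
∣∣≡size (true ∷ v)  = cong suc (∣∣≡size v)
∣∣≡size (false ∷ v) = ∣∣≡size v

∣∩∣≡int : ∀ {n} (v u : V n) → ∣ v ∩ u ∣ ≡ int v u
∣∩∣≡int []          []          = refl
∣∩∣≡int (true ∷ v)  (true ∷ u)  = cong suc (∣∩∣≡int v u)
∣∩∣≡int (true ∷ v)  (false ∷ u) = ∣∩∣≡int v u
∣∩∣≡int (false ∷ v) (b ∷ u)     = ∣∩∣≡int v u

cover : ∀ {n} → V n → V n → Bool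
cover []      []      = true
cover (a ∷ v) (b ∷ u) = (a ∨ b) ∧ cover v u

cover-size : ∀ {n} (v u : V n) → cover v u ≡ true → size v + size u ≡ n + int v u
cover-size []          []          e = refl
cover-size (false ∷ v) (true ∷ u)  e = trans (+-suc (size v) (size u)) (cong suc (cover-size v u e))
cover-size (true ∷ v)  (false ∷ u) e = cong suc (cover-size v u e)
cover-size {suc n} (true ∷ v) (true ∷ u) e = cong suc
  (trans (+-suc (size v) (size u)) (trans (cong suc (cover-size v u e)) (sym (+-suc n (int v u)))))

Family : ℕ → Set
Family n = V n → Bool

HeadShifted : ∀ {n} → Family (suc n) → Set
HeadShifted {zero}  G = ⊤
HeadShifted {suc n} G = ∀ v → G (true ∷ false ∷ v) ≡ true → G (false ∷ true ∷ v) ≡ true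

-- Ones move towards the end of the vector, so the head is the last coordinate of the shifting order.
Shifted : ∀ {n} → Family n → Set
Shifted {zero}  G = ⊤
Shifted {suc n} G = HeadShifted G × Shifted (G ∘ (true ∷_)) × Shifted (G ∘ (false ∷_))

-- A point in neither v nor u can receive the one at the head; as u misses it, the overlap with u is
-- unchanged. The one travels by adjacent shifts, passing over other ones by exchanging roles with
-- them.
shift-into-gap : ∀ {n} (G : Family (suc n)) → Shifted G → (v u : V n) → cover v u ≡ false →
  G (true ∷ v) ≡ true → ∃ λ v′ → G (false ∷ v′) ≡ true × int v′ u ≡ int v u
shift-into-gap G sh []          []      () g
shift-into-gap G (h , st , sf) (true ∷ w) (b ∷ u) e g with shift-into-gap (G ∘ (true ∷_)) st w u e g
... | w′ , g′ , i = true ∷ w′ , h w′ g′ , cong (ι b +_) i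
shift-into-gap G (h , st , sf) (false ∷ w) (true ∷ u) e g
  with shift-into-gap (G ∘ (false ∷_)) sf w u e (h w g)
... | w′ , g′ , i = false ∷ w′ , g′ , i
shift-into-gap G (h , st , sf) (false ∷ w) (false ∷ u) e g = true ∷ w , h w g , refl

Int : ∀ {n} → ℕ → Family n → Set
Int t G = ∀ v u → G v ≡ true → G u ≡ true → t ≤ int v u

cover-gap : ∀ {n} (v u : V n) k → lookup v k ≡ false → lookup u k ≡ false → cover v u ≡ false
cover-gap (false ∷ v) (false ∷ u) zero    e f = refl
cover-gap (a ∷ v)     (b ∷ u)     (suc k) e f rewrite cover-gap v u k e f = Bool.∧-zeroʳ (a ∨ b)

∑-lookup : ∀ {n} (v : V n) → ∑ (allFin n) (λ k → ι (lookup v k)) ≡ size v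
∑-lookup []              = refl
∑-lookup {suc n} (a ∷ v) = trans (∑-allFin n _) (cong (ι a +_) (∑-lookup v))

∑-not-lookup : ∀ {n} (v : V n) → ∑ (allFin n) (λ k → ι (not (lookup v k))) + size v ≡ n
∑-not-lookup [] = refl
∑-not-lookup {suc n} (a ∷ v) rewrite ∑-allFin n (λ k → ι (not (lookup (a ∷ v) k))) =
  trans (regroup (ι (not a)) _ (ι a) (size v)) (cong₂ _+_ (bit a) (∑-not-lookup v))
  where
  regroup : ∀ x y z w → x + y + (z + w) ≡ x + z + (y + w)
  regroup = solve-∀
  bit : ∀ a → ι (not a) + ι a ≡ 1
  bit true  = refl
  bit false = refl

pivot : ∀ {n} → Family (suc n) → Family n
pivot G v = G (true ∷ v) ∧ not (G (false ∷ v))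

withFalse withTrue : ∀ {n} → Family n → Family (suc n)
withFalse I (true ∷ v)  = false
withFalse I (false ∷ v) = I v
withTrue J (true ∷ v)  = J v
withTrue J (false ∷ v) = false

-- Canonical sets of given size, and longer shifts

ones : ∀ κ → ℕ → V κ
ones zero    j       = []
ones (suc κ) zero    = false ∷ ones κ zero
ones (suc κ) (suc j) = true ∷ ones κ j

size-ones : ∀ {κ j} → j ≤ κ → size (ones κ j) ≡ j
size-ones {zero}  z≤n     = refl
size-ones {suc κ} z≤n     = size-ones {κ} z≤n
size-ones         (s≤s h) = cong suc (size-ones h)

int-ones₀ : ∀ {κ} (v : V κ) → int (ones κ 0) v ≡ 0
int-ones₀ []      = refl
int-ones₀ (b ∷ v) = int-ones₀ v

-- Two sets overlap least when they fill up all κ points before sharing any. When membership depends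
-- only on sizes, testing it on such a pair gives the intersection condition its full strength.
least-int : ∀ κ j k → j ≤ κ → k ≤ κ →
  ∃ λ (v : V κ) → ∃ λ u → size v ≡ j × size u ≡ k × int v u ≡ (j + k) ∸ κ
least-int zero    zero    zero    _ _ = [] , [] , refl , refl , refl
least-int (suc κ) zero    k       _ k≤ = ones (suc κ) 0 , ones (suc κ) k , size-ones {suc κ} z≤n , size-ones k≤ ,
  trans (int-ones₀ (ones (suc κ) k)) (sym (m≤n⇒m∸n≡0 k≤))
least-int (suc κ) (suc j) k (s≤s j≤) k≤ with m≤n⇒m<n∨m≡n k≤
... | inj₁ (s≤s k≤κ) with least-int κ j k j≤ k≤κ
...   | v , u , sv , su , i = true ∷ v , false ∷ u , cong suc sv , su , i
least-int (suc κ) (suc j) k (s≤s j≤) k≤ | inj₂ refl with least-int κ j κ j≤ ≤-refl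
...   | v , u , sv , su , i = true ∷ v , true ∷ u , cong suc sv , cong suc su ,
  trans (cong suc (trans i (m+n∸n≡m j κ))) (sym (m+n∸n≡m (suc j) (suc κ)))

int-⧺ : ∀ {c k} (C C′ : V c) (v v′ : V k) → int (C ⧺ v) (C′ ⧺ v′) ≡ int C C′ + int v v′
int-⧺ []      []       v v′ = refl
int-⧺ (a ∷ C) (b ∷ C′) v v′ = trans (cong (ι (a ∧ b) +_) (int-⧺ C C′ v v′)) (sym (+-assoc (ι (a ∧ b)) _ _))

size-⧺ : ∀ {c k} (C : V c) (v : V k) → size (C ⧺ v) ≡ size C + size v
size-⧺ []      v = refl
size-⧺ (a ∷ C) v = trans (cong (ι a +_) (size-⧺ C v)) (sym (+-assoc (ι a) _ _))

shift-head-past : ∀ {c κ} (G : Family (suc (c + suc κ))) → Shifted G → (C : V c) (v : V κ) →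
  G (true ∷ (C ⧺ false ∷ v)) ≡ true → G (false ∷ (C ⧺ true ∷ v)) ≡ true
shift-head-past G (h , _ , _)  []          v g = h v g
shift-head-past G (h , st , _) (true ∷ C)  v g = h (C ⧺ true ∷ v) (shift-head-past (G ∘ (true ∷_)) st C v g)
shift-head-past G (h , _ , sf) (false ∷ C) v g = shift-head-past (G ∘ (false ∷_)) sf C v (h (C ⧺ false ∷ v) g)

-- Against a partner with a zero behind its context `D`, the new set has one common point less, so
-- the intersection condition for it is stronger by one.
shift-common-past : ∀ {c κ} (G : Family (c + suc κ)) → Shifted G → (C D : V c) (v : V κ) → 1 ≤ int C D →
  G (C ⧺ false ∷ v) ≡ true → ∃ λ C′ → suc (int C′ D) ≡ int C D × G (C′ ⧺ true ∷ v) ≡ true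
shift-common-past G sh [] [] v () g
shift-common-past G sh (true ∷ C) (true ∷ D) v i g = false ∷ C , refl , shift-head-past G sh C v g
shift-common-past G (_ , st , _) (true ∷ C) (false ∷ D) v i g with shift-common-past (G ∘ (true ∷_)) st C D v i g
... | C′ , e , g′ = true ∷ C′ , e , g′
shift-common-past G (_ , _ , sf) (false ∷ C) (b ∷ D) v i g with shift-common-past (G ∘ (false ∷_)) sf C D v i g
... | C′ , e , g′ = false ∷ C′ , e , g′

lift : ∀ c {k} → (V c → Family k) → Family (c + k)
lift zero    P v       = P [] v
lift (suc c) P (a ∷ v) = lift c (λ C → P (a ∷ C)) v

lift-⧺ : ∀ {c k} (P : V c → Family k) (C : V c) v → lift c P (C ⧺ v) ≡ P C v
lift-⧺ P []      v = refl
lift-⧺ P (a ∷ C) v = lift-⧺ (λ C → P (a ∷ C)) C v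

HeadPivot : ∀ {n} → Family n → ℕ → Set
HeadPivot {zero}  G a = ⊥
HeadPivot {suc n} G a = ∃ λ v → pivot G v ≡ true × size v ≡ a

-- The two exchange inequalities and the density bound force all obstructed contexts to be obstructed for both
-- values of their first coordinate, with equality in the density bound.
balance : ∀ {p q} d e h M β γ → 1 ≤ p → p ≤ q → 1 ≤ M + (β + γ) →
  (d + suc e) * (q * β + p * M) ≤ d * (q * M + p * γ) → (d + suc e) * (p * (M + γ)) ≤ d * (q * (M + β)) →
  q * (d + h) ≤ p * (d + suc e + h) → 1 ≤ M × h ≡ 0
balance {p} {q} d e h M β γ 1≤p p≤q pos h₁ h₂ dens = M>0 , h≡0 h dens
  where
  1≤q : 1 ≤ q
  1≤q = ≤-trans 1≤p p≤q
  -- The terms with `h` may be dropped from the density bound because p h ≤ q h.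
  threshold : d * q ≤ (d + suc e) * p
  threshold = lin 0 (+-mono-≤ dens (*-monoˡ-≤ h p≤q)) (ring p q d e h)
    where
    ring : ∀ p q d e h → (d + suc e) * p + (q * (d + h) + p * h) ≡ d * q + (p * (d + suc e + h) + q * h) + 0
    ring = solve-∀
  -- Both exchange inequalities together with 2M times `threshold`: all terms in M cancel, and only
  -- β and γ remain.
  small : suc e * (q * β + p * γ) ≤ 0
  small = lin 0 (+-mono-≤ (+-mono-≤ h₁ h₂) (*-monoʳ-≤ (2 * M) threshold)) (ring p q d e M β γ)
    where
    ring : ∀ p q d e M β γ → 0 + ((d + suc e) * (q * β + p * M) + (d + suc e) * (p * (M + γ)) + 2 * M * (d * q))
      ≡ suc e * (q * β + p * γ) + (d * (q * M + p * γ) + d * (q * (M + β)) + 2 * M * ((d + suc e) * p)) + 0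
    ring = solve-∀
  vanish : ∀ x y → 1 ≤ x → x * y ≤ 0 → y ≡ 0
  vanish (suc x) zero    _ _ = refl
  β+γ : q * β + p * γ ≡ 0
  β+γ = vanish (suc e) _ (s≤s z≤n) small
  β≡0 : β ≡ 0
  β≡0 = vanish q β 1≤q (≤-trans (m≤m+n _ (p * γ)) (≤-reflexive β+γ))
  γ≡0 : γ ≡ 0
  γ≡0 = vanish p γ 1≤p (≤-trans (m≤n+m _ (q * β)) (≤-reflexive β+γ))
  M>0 : 1 ≤ M
  M>0 = subst (1 ≤_) (trans (cong₂ (λ x y → M + (x + y)) β≡0 γ≡0) (+-identityʳ M)) pos
  tight : (d + suc e) * p ≤ d * q
  tight = *-cancelʳ-≤ _ _ M {{>-nonZero M>0}} (lin (((d + suc e) * (q * β)) + 0) (subst (λ z → (d + suc e) * (q * β + p * M) ≤ d * (q * M + p * z)) γ≡0 h₁) (ring p q d e M β))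
    where
    ring : ∀ p q d e M β → d * q * M + (d + suc e) * (q * β + p * M) ≡ (d + suc e) * p * M + d * (q * M + p * 0) + ((d + suc e) * (q * β) + 0)
    ring = solve-∀
  -- For positive `h` the density bound and `tight` give q ≤ p, and then `tight` itself fails.
  h≡0 : ∀ h → q * (d + h) ≤ p * (d + suc e + h) → h ≡ 0
  h≡0 zero    _ = refl
  h≡0 (suc h) dens = ⊥-elim (<⇒≱ strict (≤-trans tight (*-monoʳ-≤ d q≤p)))
    where
    q≤p : q ≤ p
    q≤p = *-cancelʳ-≤ q p (suc h) (lin 0 (+-mono-≤ dens tight) (ring p q d e (suc h)))
      where
      ring : ∀ p q d e h → p * h + (q * (d + h) + (d + suc e) * p) ≡ q * h + (p * (d + suc e + h) + d * q) + 0
      ring = solve-∀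
    strict : d * p < (d + suc e) * p
    strict = *-monoˡ-< p {{>-nonZero 1≤p}} (m<m+n d (s≤s z≤n))

-- Equality up to a permutation of the last κ coordinates. Invariance of a family under it is
-- extended one coordinate at a time until κ is the whole length.
data Tail (κ : ℕ) : ∀ {n} → V n → V n → Set where
  stop : {v v′ : V κ} → size v ≡ size v′ → Tail κ v v′
  keep : ∀ {n} {v v′ : V n} a → Tail κ v v′ → Tail κ (a ∷ v) (a ∷ v′)

data TailView (κ : ℕ) : ∀ {n} → V n → V n → Set where
  view : ∀ {c} (C : V c) k w k′ w′ → size (k ∷ w) ≡ size (k′ ∷ w′) → TailView κ {c + suc κ} (C ⧺ k ∷ w) (C ⧺ k′ ∷ w′)

tail-view : ∀ {κ n} {v v′ : V n} → Tail (suc κ) v v′ → TailView κ v v′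
tail-view (stop {k ∷ w} {k′ ∷ w′} e) = view [] k w k′ w′ e
tail-view (keep a s) with tail-view s
... | view C k w k′ w′ e = view (a ∷ C) k w k′ w′ e

tail-⧺ : ∀ {c κ} (C : V c) k {w w′ : V κ} → size w ≡ size w′ → Tail κ (C ⧺ k ∷ w) (C ⧺ k ∷ w′)
tail-⧺ []      k e = keep k (stop e)
tail-⧺ (a ∷ C) k e = keep a (tail-⧺ C k e)

tail₀ : ∀ {n} {v v′ : V n} → Tail 0 v v′ → v ≡ v′
tail₀ (stop {[]} {[]} e) = refl
tail₀ (keep a s)         = cong (a ∷_) (tail₀ s)

shifted-section : ∀ {c k} (G : Family (c + k)) (C : V c) → Shifted G → Shifted (λ v → G (C ⧺ v))
shifted-section G []          sh            = sh
shifted-section G (true ∷ C)  (_ , st , _)  = shifted-section (G ∘ (true ∷_)) C st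
shifted-section G (false ∷ C) (_ , _ , sf)  = shifted-section (G ∘ (false ∷_)) C sf

shift-head : ∀ {κ} (G : Family (suc κ)) → Shifted G → (w : V κ) → size w < κ → G (true ∷ w) ≡ true →
  ∃ λ w′ → size w′ ≡ suc (size w) × G (false ∷ w′) ≡ true
shift-head G sh [] () g
shift-head G (h , st , sf) (true ∷ w) (s≤s lt) g with shift-head (G ∘ (true ∷_)) st w lt g
... | w′ , e , g′ = true ∷ w′ , cong suc e , h w′ g′
shift-head G (h , st , sf) (false ∷ w) lt g = true ∷ w , refl , h w g

ones-grow : ∀ κ j (w : V κ) → int (ones κ j) w ≤ int (ones κ (suc j)) w
ones-grow zero    j       []      = z≤n
ones-grow (suc κ) zero    (b ∷ w) = m≤n+m _ (ι b)
ones-grow (suc κ) (suc j) (b ∷ w) = +-monoʳ-≤ (ι b) (ones-grow κ j w)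

-- Connectivity of the middle level

-- Letters `C`, closeness `cl` and windows `In y`, reduced to the two properties behind the
-- Kneser-like graph: a window can be left from inside, and entered from outside, by a letter that
-- is not close.
module Connectivity {C Y : Set} (cl : C → C → Bool) (In : Y → C → Bool)
  (far-out : ∀ y v → In y v ≡ true → ∃ λ u → In y u ≡ false × cl v u ≡ false)
  (far-in : ∀ y v → In y v ≡ false → ∃ λ u → In y u ≡ true × cl v u ≡ false) where

  pattern-of : ∀ {n} → Vec Y n → Vec C n → V n
  pattern-of []       []      = []
  pattern-of (y ∷ ys) (v ∷ z) = In y v ∷ pattern-of ys z

  agr : ∀ {n} → Vec C n → Vec C n → ℕ
  agr []      []        = 0
  agr (v ∷ z) (v′ ∷ z′) = ι (cl v v′) + agr z z′

  ins outs : ∀ {n} → V n → Vec Y n → Vec C n → ℕ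
  ins ρ ys z = int (pattern-of ys z) ρ
  outs []      []       []      = 0
  outs (r ∷ ρ) (y ∷ ys) (v ∷ z) = ι (not (In y v) ∧ r) + outs ρ ys z

  ins+outs : ∀ {n} (ρ : V n) ys z → ins ρ ys z + outs ρ ys z ≡ size ρ
  ins+outs []          []       []      = refl
  ins+outs (r ∷ ρ) (y ∷ ys) (v ∷ z) with In y v | r
  ... | true  | true  = cong suc (ins+outs ρ ys z)
  ... | true  | false = ins+outs ρ ys z
  ... | false | true  = trans (+-suc _ _) (cong suc (ins+outs ρ ys z))
  ... | false | false = ins+outs ρ ys z

  outs≤size : ∀ {n} (ρ : V n) ys z → outs ρ ys z ≤ size ρ
  outs≤size ρ ys z = ≤-trans (m≤n+m _ (ins ρ ys z)) (≤-reflexive (ins+outs ρ ys z))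

  far : ∀ y v → ∃ λ u → cl v u ≡ false
  far y v with In y v in e
  ... | true  = proj₁ (far-out y v e) , proj₂ (proj₂ (far-out y v e))
  ... | false = proj₁ (far-in y v e) , proj₂ (proj₂ (far-in y v e))

  -- Remembers that all free coordinates went to far letters; with only two letters this means that
  -- they were flipped.
  data FarOff : ∀ {n} → V n → Vec C n → Vec C n → Set where
    []  : FarOff [] [] []
    on  : ∀ {n} {ρ : V n} {v u z z′} → FarOff ρ z z′ → FarOff (true ∷ ρ) (v ∷ z) (u ∷ z′)
    off : ∀ {n} {ρ : V n} {v u z z′} → cl v u ≡ false → FarOff ρ z z′ → FarOff (false ∷ ρ) (v ∷ z) (u ∷ z′)

  data Irr : ∀ {n} → V n → Vec C n → Vec C n → Set where
    here : ∀ {n} {ρ : V n} {v v′ u z} → cl v u ≡ false → cl v′ u ≡ false → Irr (false ∷ ρ) (v ∷ z) (v′ ∷ z)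
    keep : ∀ {n} {ρ : V n} {r v z z′} → Irr ρ z z′ → Irr (r ∷ ρ) (v ∷ z) (v ∷ z′)

  data Raise : ∀ {n} → V n → Vec Y n → Vec C n → Vec C n → Set where
    here : ∀ {n} {ρ : V n} {y ys v v′ z} → In y v ≡ false → In y v′ ≡ true → Raise (true ∷ ρ) (y ∷ ys) (v ∷ z) (v′ ∷ z)
    keep : ∀ {n} {ρ : V n} {r y ys v z z′} → Raise ρ ys z z′ → Raise (r ∷ ρ) (y ∷ ys) (v ∷ z) (v ∷ z′)

  -- Moves that keep `ins`. In a `trade` the coordinate leaving the window precedes the one entering
  -- it, which is why `Linked` also allows steps to be read backwards.
  data Step : ∀ {n} → V n → Vec Y n → Vec C n → Vec C n → Set where
    inside : ∀ {n} {ρ : V n} {y ys v v′ z} → In y v ≡ true → In y v′ ≡ true → Step (true ∷ ρ) (y ∷ ys) (v ∷ z) (v′ ∷ z)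
    trade  : ∀ {n} {ρ : V n} {y ys v v′ z z′} → In y v ≡ true → In y v′ ≡ false → Raise ρ ys z z′ →
             Step (true ∷ ρ) (y ∷ ys) (v ∷ z) (v′ ∷ z′)
    keep   : ∀ {n} {ρ : V n} {r y ys v z z′} → Step ρ ys z z′ → Step (r ∷ ρ) (y ∷ ys) (v ∷ z) (v ∷ z′)

  data Outside : ∀ {n} → V n → Vec Y n → Vec C n → Vec C n → Set where
    here : ∀ {n} {ρ : V n} {y ys v v′ z} → In y v ≡ false → In y v′ ≡ false → Outside (true ∷ ρ) (y ∷ ys) (v ∷ z) (v′ ∷ z)
    keep : ∀ {n} {ρ : V n} {r y ys v z z′} → Outside ρ ys z z′ → Outside (r ∷ ρ) (y ∷ ys) (v ∷ z) (v ∷ z′)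

  raise-ins : ∀ {n} {ρ : V n} {ys z z′} → Raise ρ ys z z′ → ins ρ ys z′ ≡ suc (ins ρ ys z)
  raise-ins (here e e′) rewrite e | e′ = refl
  raise-ins (keep {r = r} {y} {v = v} s) = trans (cong (ι (In y v ∧ r) +_) (raise-ins s)) (+-suc _ _)

  step-ins : ∀ {n} {ρ : V n} {ys z z′} → Step ρ ys z z′ → ins ρ ys z′ ≡ ins ρ ys z
  step-ins (inside e e′) rewrite e | e′ = refl
  step-ins (trade e e′ s) rewrite e | e′ = raise-ins s
  step-ins (keep {r = r} {y} {v = v} s) = cong (ι (In y v ∧ r) +_) (step-ins s)

  -- Sending every coordinate to a far letter exchanges inside and outside: `outs` window
  -- coordinates end up inside and nothing agrees. The remaining `j - outs` are obtained by keeping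
  -- inside letters unchanged, each at the price of at most one agreement.
  neighbour : ∀ {n} (ρ : V n) ys z j → outs ρ ys z ≤ j → j ≤ size ρ →
    ∃ λ z′ → ins ρ ys z′ ≡ j × agr z z′ + outs ρ ys z ≤ j × FarOff ρ z z′
  neighbour []          []       []      zero lo hi = [] , refl , z≤n , []
  neighbour (false ∷ ρ) (y ∷ ys) (v ∷ z) j    lo hi rewrite Bool.∧-zeroʳ (not (In y v))
    with far y v | neighbour ρ ys z j lo hi
  ... | u , cu | z′ , i , a , f = u ∷ z′ , trans (cong (λ b → ι b + ins ρ ys z′) (Bool.∧-zeroʳ (In y u))) i ,
          subst (λ b → ι b + agr z z′ + outs ρ ys z ≤ j) (sym cu) a , off cu f
  neighbour (true ∷ ρ) (y ∷ ys) (v ∷ z) j lo hi with In y v in e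
  neighbour (true ∷ ρ) (y ∷ ys) (v ∷ z) (suc j) (s≤s lo) (s≤s hi) | false with far-in y v e | neighbour ρ ys z j lo hi
  ... | u , iu , cu | z′ , i , a , f = u ∷ z′ , trans (cong (λ b → ι (b ∧ true) + ins ρ ys z′) iu) (cong suc i) ,
    subst (λ b → ι b + agr z z′ + suc (outs ρ ys z) ≤ suc j) (sym cu) (≤-trans (≤-reflexive (+-suc _ _)) (s≤s a)) , on f
  -- The letter is kept only if the later window coordinates cannot supply all j.
  neighbour (true ∷ ρ) (y ∷ ys) (v ∷ z) j lo hi | true with j ≤? size ρ
  ... | yes j≤ with far-out y v e | neighbour ρ ys z j lo j≤
  ...   | u , iu , cu | z′ , i , a , f = u ∷ z′ , trans (cong (λ b → ι (b ∧ true) + ins ρ ys z′) iu) i ,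
    subst (λ b → ι b + agr z z′ + outs ρ ys z ≤ j) (sym cu) a , on f
  neighbour (true ∷ ρ) (y ∷ ys) (v ∷ z) zero    lo hi | true | no ¬j = ⊥-elim (¬j z≤n)
  neighbour (true ∷ ρ) (y ∷ ys) (v ∷ z) (suc j) lo (s≤s hi) | true | no ¬j
    with neighbour ρ ys z j (≤-trans (outs≤size ρ ys z) (s≤s⁻¹ (≰⇒> ¬j))) hi
  ... | z′ , i , a , f = v ∷ z′ , trans (cong (λ b → ι (b ∧ true) + ins ρ ys z′) e) (cong suc i) ,
    ≤-trans (+-monoˡ-≤ (outs ρ ys z) (+-monoˡ-≤ (agr z z′) (ι≤1 (cl v v)))) (s≤s a) , on f

  -- Common neighbours of z and z′: δ is the number of spare window coordinates they need, and x the number of extra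
  -- agreements with z′ that is tolerated.
  Meet : ∀ {n} → V n → Vec Y n → (z z′ : Vec C n) (δ x : ℕ) → Set
  Meet ρ ys z z′ δ x = outs ρ ys z + δ ≤ size ρ × (∀ j → outs ρ ys z + δ ≤ j → j ≤ size ρ →
    ∃ λ z″ → ins ρ ys z″ ≡ j × agr z z″ + outs ρ ys z ≤ j × agr z′ z″ + outs ρ ys z ≤ j + x)

  meet-keep : ∀ {n} {ρ : V n} {ys z z′ δ x} r y v → Meet ρ ys z z′ δ x → Meet (r ∷ ρ) (y ∷ ys) (v ∷ z) (v ∷ z′) δ x
  meet-keep {ρ = ρ} {ys} {z} {z′} {δ} {x} false y v (room , m) rewrite Bool.∧-zeroʳ (not (In y v)) = room , found
    where
    found : ∀ j → outs ρ ys z + δ ≤ j → j ≤ size ρ → ∃ λ z″ → ins (false ∷ ρ) (y ∷ ys) z″ ≡ j ×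
      agr (v ∷ z) z″ + outs ρ ys z ≤ j × agr (v ∷ z′) z″ + outs ρ ys z ≤ j + x
    found j lo hi with far y v | m j lo hi
    ... | u , cu | z″ , i , a , a′ = u ∷ z″ , trans (cong (λ b → ι b + ins ρ ys z″) (Bool.∧-zeroʳ (In y u))) i ,
      subst (λ b → ι b + agr z z″ + outs ρ ys z ≤ j) (sym cu) a ,
      subst (λ b → ι b + agr z′ z″ + outs ρ ys z ≤ j + x) (sym cu) a′
  meet-keep {ρ = ρ} {ys} {z} {z′} {δ} {x} true y v (room , m) with In y v in e
  ... | false = s≤s room , found
    where
    found : ∀ j → suc (outs ρ ys z + δ) ≤ j → j ≤ suc (size ρ) → ∃ λ z″ → ins (true ∷ ρ) (y ∷ ys) z″ ≡ j ×
      agr (v ∷ z) z″ + suc (outs ρ ys z) ≤ j × agr (v ∷ z′) z″ + suc (outs ρ ys z) ≤ j + x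
    found (suc j) (s≤s lo) (s≤s hi) with far-in y v e | m j lo hi
    ... | u , iu , cu | z″ , i , a , a′ = u ∷ z″ , trans (cong (λ b → ι (b ∧ true) + ins ρ ys z″) iu) (cong suc i) ,
      subst (λ b → ι b + agr z z″ + suc (outs ρ ys z) ≤ suc j) (sym cu) (≤-trans (≤-reflexive (+-suc _ _)) (s≤s a)) ,
      subst (λ b → ι b + agr z′ z″ + suc (outs ρ ys z) ≤ suc j + x) (sym cu) (≤-trans (≤-reflexive (+-suc _ _)) (s≤s a′))
  ... | true  = m≤n⇒m≤1+n room , found
    where
    found : ∀ j → outs ρ ys z + δ ≤ j → j ≤ suc (size ρ) → ∃ λ z″ → ins (true ∷ ρ) (y ∷ ys) z″ ≡ j ×
      agr (v ∷ z) z″ + outs ρ ys z ≤ j × agr (v ∷ z′) z″ + outs ρ ys z ≤ j + x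
    found j lo hi with j ≤? size ρ
    found j lo hi | yes j≤ with far-out y v e | m j lo j≤
    ... | u , iu , cu | z″ , i , a , a′ = u ∷ z″ , trans (cong (λ b → ι (b ∧ true) + ins ρ ys z″) iu) i ,
      subst (λ b → ι b + agr z z″ + outs ρ ys z ≤ j) (sym cu) a ,
      subst (λ b → ι b + agr z′ z″ + outs ρ ys z ≤ j + x) (sym cu) a′
    found zero    lo hi | no ¬j = ⊥-elim (¬j z≤n)
    found (suc j) lo (s≤s hi) | no ¬j with m j (≤-trans room (s≤s⁻¹ (≰⇒> ¬j))) hi
    ... | z″ , i , a , a′ = v ∷ z″ , trans (cong (λ b → ι (b ∧ true) + ins ρ ys z″) e) (cong suc i) ,
      ≤-trans (+-monoˡ-≤ (outs ρ ys z) (+-monoˡ-≤ (agr z z″) (ι≤1 (cl v v)))) (s≤s a) ,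
      ≤-trans (+-monoˡ-≤ (outs ρ ys z) (+-monoˡ-≤ (agr z′ z″) (ι≤1 (cl v v)))) (s≤s a′)

  -- At the raised coordinate the new letter is far from the old one, and its possible closeness to
  -- the raised letter is the one tolerated extra agreement.
  meet-raise : ∀ {n} {ρ : V n} {ys z z′} → Raise ρ ys z z′ → Meet ρ ys z z′ 0 1
  meet-raise (keep {r = r} {y} {v = v} s) = meet-keep r y v (meet-raise s)
  meet-raise (here {ρ = ρ} {y} {ys} {v} {v′} {z} e e′) rewrite e =
    s≤s (≤-trans (≤-reflexive (+-identityʳ _)) (outs≤size ρ ys z)) , found
    where
    found : ∀ j → suc (outs ρ ys z + 0) ≤ j → j ≤ suc (size ρ) → ∃ λ z″ → ins (true ∷ ρ) (y ∷ ys) z″ ≡ j ×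
      agr (v ∷ z) z″ + suc (outs ρ ys z) ≤ j × agr (v′ ∷ z) z″ + suc (outs ρ ys z) ≤ j + 1
    found (suc j) (s≤s lo) (s≤s hi) with far-in y v e | neighbour ρ ys z j (≤-trans (≤-reflexive (sym (+-identityʳ _))) lo) hi
    ... | u , iu , cu | z″ , i , a , _ = u ∷ z″ , trans (cong (λ b → ι (b ∧ true) + ins ρ ys z″) iu) (cong suc i) ,
      subst (λ b → ι b + agr z z″ + suc (outs ρ ys z) ≤ suc j) (sym cu) (≤-trans (≤-reflexive (+-suc _ _)) (s≤s a)) ,
      ≤-trans (+-monoˡ-≤ (suc (outs ρ ys z)) (+-monoˡ-≤ (agr z z″) (ι≤1 (cl v′ u))))
        (s≤s (≤-trans (≤-reflexive (+-suc _ _)) (≤-trans (s≤s a) (≤-reflexive (+-comm 1 j)))))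

  meet-irr : ∀ {n} {ρ : V n} {z z′} ys → Irr ρ z z′ → Meet ρ ys z z′ 0 0
  meet-irr (y ∷ ys) (keep {r = r} {v} s) = meet-keep r y v (meet-irr ys s)
  meet-irr (y ∷ ys) (here {ρ = ρ} {v} {v′} {u} {z} e e′) rewrite Bool.∧-zeroʳ (not (In y v)) =
    ≤-trans (≤-reflexive (+-identityʳ _)) (outs≤size ρ ys z) , found
    where
    found : ∀ j → outs ρ ys z + 0 ≤ j → j ≤ size ρ → ∃ λ z″ → ins (false ∷ ρ) (y ∷ ys) z″ ≡ j ×
      agr (v ∷ z) z″ + outs ρ ys z ≤ j × agr (v′ ∷ z) z″ + outs ρ ys z ≤ j + 0
    found j lo hi with neighbour ρ ys z j (≤-trans (≤-reflexive (sym (+-identityʳ _))) lo) hi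
    ... | z″ , i , a , _ = u ∷ z″ , trans (cong (λ b → ι b + ins ρ ys z″) (Bool.∧-zeroʳ (In y u))) i ,
      subst (λ b → ι b + agr z z″ + outs ρ ys z ≤ j) (sym e) a ,
      subst (λ b → ι b + agr z z″ + outs ρ ys z ≤ j + 0) (sym e′) (≤-trans a (≤-reflexive (sym (+-identityʳ j))))

  -- The changed coordinate is given a letter inside the window, which uses up one of the j, hence δ
  -- = 1. In a `trade` this letter is far from v′, and that pays for the extra agreement left by
  -- `meet-raise`.
  meet-step : ∀ {n} {ρ : V n} {ys z z′} → Step ρ ys z z′ → Meet ρ ys z z′ 1 0
  meet-step (keep {r = r} {y} {v = v} s) = meet-keep r y v (meet-step s)
  meet-step (inside {ρ = ρ} {y} {ys} {v} {v′} {z} e e′) rewrite e =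
    ≤-trans (≤-reflexive (+-comm _ 1)) (s≤s (outs≤size ρ ys z)) , found
    where
    found : ∀ j → outs ρ ys z + 1 ≤ j → j ≤ suc (size ρ) → ∃ λ z″ → ins (true ∷ ρ) (y ∷ ys) z″ ≡ j ×
      agr (v ∷ z) z″ + outs ρ ys z ≤ j × agr (v′ ∷ z) z″ + outs ρ ys z ≤ j + 0
    found zero lo hi = ⊥-elim (1+n≰n (≤-trans (m≤n+m 1 (outs ρ ys z)) lo))
    found (suc j) lo (s≤s hi) with neighbour ρ ys z j (s≤s⁻¹ (≤-trans (≤-reflexive (+-comm 1 _)) lo)) hi
    ... | z″ , i , a , _ = v ∷ z″ , trans (cong (λ b → ι (b ∧ true) + ins ρ ys z″) e) (cong suc i) ,
      ≤-trans (+-monoˡ-≤ (outs ρ ys z) (+-monoˡ-≤ (agr z z″) (ι≤1 (cl v v)))) (s≤s a) ,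
      ≤-trans (+-monoˡ-≤ (outs ρ ys z) (+-monoˡ-≤ (agr z z″) (ι≤1 (cl v′ v)))) (s≤s (≤-trans a (≤-reflexive (sym (+-identityʳ j)))))
  meet-step (trade {ρ = ρ} {y} {ys} {v} {v′} {z} {z′} e e′ s) rewrite e =
    ≤-trans (≤-reflexive (+-comm _ 1)) (s≤s (outs≤size ρ ys z)) , found
    where
    found : ∀ j → outs ρ ys z + 1 ≤ j → j ≤ suc (size ρ) → ∃ λ z″ → ins (true ∷ ρ) (y ∷ ys) z″ ≡ j ×
      agr (v ∷ z) z″ + outs ρ ys z ≤ j × agr (v′ ∷ z′) z″ + outs ρ ys z ≤ j + 0
    found zero lo hi = ⊥-elim (1+n≰n (≤-trans (m≤n+m 1 (outs ρ ys z)) lo))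
    found (suc j) lo (s≤s hi) with far-in y v′ e′ | proj₂ (meet-raise s) j (s≤s⁻¹ (≤-trans (≤-reflexive (trans (cong suc (+-identityʳ _)) (+-comm 1 _))) lo)) hi
    ... | u , iu , cu | z″ , i , a , a′ = u ∷ z″ , trans (cong (λ b → ι (b ∧ true) + ins ρ ys z″) iu) (cong suc i) ,
      ≤-trans (+-monoˡ-≤ (outs ρ ys z) (+-monoˡ-≤ (agr z z″) (ι≤1 (cl v u)))) (s≤s a) ,
      subst (λ b → ι b + agr z′ z″ + outs ρ ys z ≤ suc j + 0) (sym cu) (≤-trans a′ (≤-reflexive (trans (+-comm j 1) (cong suc (sym (+-identityʳ j))))))

  -- Joining two points of one level by moves

  data Chain : C → C → Set where
    nil  : ∀ {v} → Chain v v
    link : ∀ {v v′ w} u → cl v u ≡ false → cl v′ u ≡ false → Chain v′ w → Chain v w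

  data IrrChain : ∀ {n} → V n → Vec C n → Vec C n → Set where
    []  : IrrChain [] [] []
    on  : ∀ {n} {ρ : V n} {v u z z′} → IrrChain ρ z z′ → IrrChain (true ∷ ρ) (v ∷ z) (u ∷ z′)
    off : ∀ {n} {ρ : V n} {v u z z′} → Chain v u → IrrChain ρ z z′ → IrrChain (false ∷ ρ) (v ∷ z) (u ∷ z′)

  data Linked {n} (ρ : V n) (ys : Vec Y n) : Vec C n → Vec C n → Set where
    nil     : ∀ {z} → Linked ρ ys z z
    step    : ∀ {z z′ z″} → Step ρ ys z z′ → Linked ρ ys z′ z″ → Linked ρ ys z z″
    back    : ∀ {z z′ z″} → Step ρ ys z′ z → Linked ρ ys z′ z″ → Linked ρ ys z z″
    irr     : ∀ {z z′ z″} → Irr ρ z z′ → Linked ρ ys z′ z″ → Linked ρ ys z z″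
    outside : ∀ {z z′ z″} → Outside ρ ys z z′ → Linked ρ ys z′ z″ → Linked ρ ys z z″

  linked-trans : ∀ {n} {ρ : V n} {ys z z′ z″} → Linked ρ ys z z′ → Linked ρ ys z′ z″ → Linked ρ ys z z″
  linked-trans nil           k = k
  linked-trans (step s l)    k = step s (linked-trans l k)
  linked-trans (back s l)    k = back s (linked-trans l k)
  linked-trans (irr s l)     k = irr s (linked-trans l k)
  linked-trans (outside s l) k = outside s (linked-trans l k)

  linked-keep : ∀ {n} {ρ : V n} {r y ys v z z′} → Linked ρ ys z z′ → Linked (r ∷ ρ) (y ∷ ys) (v ∷ z) (v ∷ z′)
  linked-keep nil           = nil
  linked-keep (step s l)    = step (keep s) (linked-keep l)
  linked-keep (back s l)    = back (keep s) (linked-keep l)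
  linked-keep (irr s l)     = irr (keep s) (linked-keep l)
  linked-keep (outside s l) = outside (keep s) (linked-keep l)

  chain-linked : ∀ {n} {ρ : V n} {y ys v u z} → Chain v u → Linked (false ∷ ρ) (y ∷ ys) (v ∷ z) (u ∷ z)
  chain-linked nil            = nil
  chain-linked (link u e e′ c) = irr (here e e′) (chain-linked c)

  can-raise : ∀ {n} (ρ : V n) ys z z̃ → ins ρ ys z < size ρ → IrrChain ρ z z̃ → ∃ λ z′ → Raise ρ ys z z′ × IrrChain ρ z′ z̃
  can-raise []          []       []      []      () []
  can-raise (false ∷ ρ) (y ∷ ys) (v ∷ z) (u ∷ z̃) lt (off c i) rewrite Bool.∧-zeroʳ (In y v) with can-raise ρ ys z z̃ lt i
  ... | z′ , s , i′ = v ∷ z′ , keep s , off c i′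
  can-raise (true ∷ ρ)  (y ∷ ys) (v ∷ z) (u ∷ z̃) lt (on i) with In y v in e
  ... | false = proj₁ (far-in y v e) ∷ z , here e (proj₁ (proj₂ (far-in y v e))) , on i
  ... | true with can-raise ρ ys z z̃ (s≤s⁻¹ lt) i
  ...   | z′ , s , i′ = v ∷ z′ , keep s , on i′

  can-raise′ : ∀ {n} (ρ : V n) ys z z̃ → ins ρ ys z̃ < size ρ → IrrChain ρ z z̃ → ∃ λ z′ → Raise ρ ys z̃ z′ × IrrChain ρ z z′
  can-raise′ []          []       []      []      () []
  can-raise′ (false ∷ ρ) (y ∷ ys) (v ∷ z) (u ∷ z̃) lt (off c i) rewrite Bool.∧-zeroʳ (In y u) with can-raise′ ρ ys z z̃ lt i
  ... | z′ , s , i′ = u ∷ z′ , keep s , off c i′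
  can-raise′ (true ∷ ρ)  (y ∷ ys) (v ∷ z) (u ∷ z̃) lt (on i) with In y u in e
  ... | false = proj₁ (far-in y u e) ∷ z̃ , here e (proj₁ (proj₂ (far-in y u e))) , on i
  ... | true with can-raise′ ρ ys z z̃ (s≤s⁻¹ lt) i
  ...   | z′ , s , i′ = u ∷ z′ , keep s , on i′

  can-lower : ∀ {n} (ρ : V n) ys z → 1 ≤ ins ρ ys z → ∃ λ z′ → Raise ρ ys z′ z
  can-lower []          []       []      ()
  can-lower (false ∷ ρ) (y ∷ ys) (v ∷ z) h rewrite Bool.∧-zeroʳ (In y v) with can-lower ρ ys z h
  ... | z′ , s = v ∷ z′ , keep s
  can-lower (true ∷ ρ)  (y ∷ ys) (v ∷ z) h with In y v in e
  ... | true  = proj₁ (far-out y v e) ∷ z , here (proj₁ (proj₂ (far-out y v e))) e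
  ... | false with can-lower ρ ys z h
  ...   | z′ , s = v ∷ z′ , keep s

  -- Coordinates are corrected from the front. If one has to leave the window, equality of the
  -- counts provides a later coordinate that can enter it in exchange; in the opposite case the same
  -- is done from the target.
  walk : ∀ {n} (ρ : V n) ys z z̃ → ins ρ ys z ≡ ins ρ ys z̃ → IrrChain ρ z z̃ → Linked ρ ys z z̃
  walk []          []       []      []      e []        = nil
  walk (false ∷ ρ) (y ∷ ys) (v ∷ z) (u ∷ z̃) e (off c i) rewrite Bool.∧-zeroʳ (In y v) | Bool.∧-zeroʳ (In y u) =
    linked-trans (chain-linked c) (linked-keep (walk ρ ys z z̃ e i))
  walk (true ∷ ρ)  (y ∷ ys) (v ∷ z) (u ∷ z̃) e (on i) with In y v in ev | In y u in eu
  ... | true  | true  = step (inside ev eu) (linked-keep (walk ρ ys z z̃ (suc-injective e) i))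
  ... | false | false = outside (here ev eu) (linked-keep (walk ρ ys z z̃ e i))
  ... | true  | false with can-raise ρ ys z z̃ (≤-trans (≤-reflexive e) (≤-trans (m≤m+n _ (outs ρ ys z̃)) (≤-reflexive (ins+outs ρ ys z̃)))) i
  ...   | z′ , s , i′ = step (trade ev eu s) (linked-keep (walk ρ ys z′ z̃ (trans (raise-ins s) e) i′))
  walk (true ∷ ρ)  (y ∷ ys) (v ∷ z) (u ∷ z̃) e (on i) | false | true
    with can-raise′ ρ ys z z̃ (≤-trans (≤-reflexive (sym e)) (≤-trans (m≤m+n _ (outs ρ ys z)) (≤-reflexive (ins+outs ρ ys z)))) i
  ...   | z′ , s , i′ = linked-trans (linked-keep (walk ρ ys z z′ (trans e (sym (raise-ins s))) i′)) (back (trade eu ev s) nil)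

  outside-raise : ∀ {n} {ρ : V n} {ys z z′} → Outside ρ ys z z′ → ∃ λ z″ → Raise ρ ys z z″ × Raise ρ ys z′ z″
  outside-raise (here {y = y} {v = v} {z = z} e e′) = _ , here e (proj₁ (proj₂ (far-in y v e))) , here e′ (proj₁ (proj₂ (far-in y v e)))
  outside-raise (keep s) with outside-raise s
  ... | z″ , a , b = _ , keep a , keep b

  outside-ins : ∀ {n} {ρ : V n} {ys z z′} → Outside ρ ys z z′ → ins ρ ys z′ ≡ ins ρ ys z
  outside-ins s with outside-raise s
  ... | z″ , a , b = suc-injective (trans (sym (raise-ins b)) (raise-ins a))

  -- A change between two outside letters is not a `Step`, but it becomes two of them through a
  -- point with this coordinate inside and some inside coordinate moved out. Which of the two
  -- coordinates comes first decides the direction of the steps.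
  outside-steps : ∀ {n} {ρ : V n} {ys z z′} → Outside ρ ys z z′ → 1 ≤ ins ρ ys z →
    ∃ λ z₀ → (Step ρ ys z₀ z × Step ρ ys z₀ z′) ⊎ (Step ρ ys z z₀ × Step ρ ys z′ z₀)
  outside-steps (here {ρ = ρ} {y} {ys} {v} {v′} {z} e e′) h rewrite e with can-lower ρ ys z h | far-in y v e
  ... | z₀ , s | w , iw , _ = w ∷ z₀ , inj₁ (trade iw e s , trade iw e′ s)
  outside-steps (keep {r = false} {y} {v = v} s) h rewrite Bool.∧-zeroʳ (In y v) with outside-steps s h
  ... | z₀ , inj₁ (a , b) = v ∷ z₀ , inj₁ (keep a , keep b)
  ... | z₀ , inj₂ (a , b) = v ∷ z₀ , inj₂ (keep a , keep b)
  outside-steps (keep {r = true} {y} {v = v} s) h with In y v in e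
  ... | true with outside-raise s | far-out y v e
  ...   | z₀ , a , b | u , iu , _ = u ∷ z₀ , inj₂ (trade e iu a , trade e iu b)
  outside-steps (keep {r = true} {y} {v = v} s) h | false with outside-steps s h
  ...   | z₀ , inj₁ (a , b) = v ∷ z₀ , inj₁ (keep a , keep b)
  ...   | z₀ , inj₂ (a , b) = v ∷ z₀ , inj₂ (keep a , keep b)

  irr-ins : ∀ {n} {ρ : V n} {z z′} ys → Irr ρ z z′ → ins ρ ys z′ ≡ ins ρ ys z
  irr-ins (y ∷ ys) (here {v = v} {v′} e e′) rewrite Bool.∧-zeroʳ (In y v) | Bool.∧-zeroʳ (In y v′) = refl
  irr-ins (y ∷ ys) (keep {r = r} {v} s) = cong (ι (In y v ∧ r) +_) (irr-ins ys s)

  -- A labelling of the vectors with exactly k window coordinates (where |ρ| = k + r and k + 1 = t + r)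
  -- that agrees on vectors close in fewer than t coordinates.
  module Constant {n : ℕ} (ρ : V n) (ys : Vec Y n) (t k r : ℕ) (k≡ : suc k ≡ t + r) (ρ≡ : size ρ ≡ k + r)
    (enough : suc r ≤ k ⊎ size ρ ≡ 0) (lab : Vec C n → Bool)
    (edge : ∀ z z′ → ins ρ ys z ≡ k → ins ρ ys z′ ≡ k → agr z z′ < t → lab z ≡ lab z′) where

    outs≡ : ∀ {z} → ins ρ ys z ≡ k → outs ρ ys z ≡ r
    outs≡ {z} e = +-cancelˡ-≡ k _ r (trans (cong (_+ outs ρ ys z) (sym e)) (trans (ins+outs ρ ys z) ρ≡))

    r≤k : r ≤ k
    r≤k = decide enough
      where
      decide : suc r ≤ k ⊎ size ρ ≡ 0 → r ≤ k
      decide (inj₁ h) = ≤-trans (n≤1+n r) h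
      decide (inj₂ e) = ≤-trans (≤-trans (m≤n+m r k) (≤-reflexive (trans (sym ρ≡) e))) z≤n

    k≤ρ : k ≤ size ρ
    k≤ρ = ≤-trans (m≤m+n k r) (≤-reflexive (sym ρ≡))

    -- On level k exactly r window coordinates are outside, so the bound in `neighbour` says that
    -- fewer than t coordinates agree.
    few : ∀ {x} → x + r ≤ k → x < t
    few {x} h = +-cancelʳ-≤ r (suc x) t (≤-trans (s≤s h) (≤-reflexive k≡))

    lab-meet : ∀ {z z′ δ} → Meet ρ ys z z′ δ 0 → ins ρ ys z ≡ k → ins ρ ys z′ ≡ k → r + δ ≤ k → lab z ≡ lab z′
    lab-meet {z} {z′} {δ} (_ , m) e e′ h with m k (subst (λ x → x + δ ≤ k) (sym (outs≡ e)) h) k≤ρ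
    ... | z″ , i , a , a′ = trans (edge z z″ e i (few (subst (λ x → agr z z″ + x ≤ k) (outs≡ e) a)))
      (sym (edge z′ z″ e′ i (few (subst (λ x → agr z′ z″ + x ≤ k) (outs≡ e) (≤-trans a′ (≤-reflexive (+-identityʳ k)))))))

    lab-step : ∀ {z z′} → Step ρ ys z z′ → ins ρ ys z ≡ k → lab z ≡ lab z′
    lab-step {z} {z′} s e = decide enough
      where
      decide : suc r ≤ k ⊎ size ρ ≡ 0 → lab z ≡ lab z′
      decide (inj₁ h) = lab-meet (meet-step s) e (trans (step-ins s) e) (≤-trans (≤-reflexive (+-comm r 1)) h)
      -- A step changes a window coordinate, and there is none.
      decide (inj₂ ρ0) = ⊥-elim (1+n≰n (≤-trans (m≤n+m 1 (outs ρ ys z)) (≤-trans (proj₁ (meet-step s)) (≤-reflexive ρ0))))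

    lab-irr : ∀ {z z′} → Irr ρ z z′ → ins ρ ys z ≡ k → lab z ≡ lab z′
    lab-irr s e = lab-meet (meet-irr ys s) e (trans (irr-ins ys s) e) (≤-trans (≤-reflexive (+-identityʳ r)) r≤k)

    lab-outside : ∀ {z z′} → Outside ρ ys z z′ → ins ρ ys z ≡ k → lab z ≡ lab z′
    lab-outside {z} {z′} s e = decide enough
      where
      room : ∀ {n} {ρ : V n} {ys z z′} → Outside ρ ys z z′ → 1 ≤ size ρ
      room (here _ _)       = s≤s z≤n
      room (keep {r = r} s) = ≤-trans (room s) (m≤n+m _ (ι r))
      decide : suc r ≤ k ⊎ size ρ ≡ 0 → lab z ≡ lab z′
      decide (inj₂ ρ0) = ⊥-elim (1+n≰n (≤-trans (room s) (≤-reflexive ρ0)))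
      decide (inj₁ h) with outside-steps s (≤-trans (≤-trans (s≤s z≤n) h) (≤-reflexive (sym e)))
      ... | z₀ , inj₁ (a , b) = trans (sym (lab-step a e₀)) (lab-step b e₀)
        where e₀ = trans (sym (step-ins a)) e
      ... | z₀ , inj₂ (a , b) = trans (lab-step a e) (sym (lab-step b (trans (outside-ins s) e)))

    lab-linked : ∀ {z z′} → Linked ρ ys z z′ → ins ρ ys z ≡ k → lab z ≡ lab z′
    lab-linked nil           e = refl
    lab-linked (step s l)    e = trans (lab-step s e) (lab-linked l (trans (step-ins s) e))
    lab-linked (back s l)    e = trans (sym (lab-step s e′)) (lab-linked l e′)
      where e′ = trans (sym (step-ins s)) e
    lab-linked (irr s l)     e = trans (lab-irr s e) (lab-linked l (trans (irr-ins ys s) e))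
    lab-linked (outside s l) e = trans (lab-outside s e) (lab-linked l (trans (outside-ins s) e))

    lab-chain : ∀ z z′ → ins ρ ys z ≡ k → ins ρ ys z′ ≡ k → IrrChain ρ z z′ → lab z ≡ lab z′
    lab-chain z z′ e e′ i = lab-linked (walk ρ ys z z′ (trans e (sym e′)) i) e

    -- With a single free coordinate and two letters, one step along an edge flips the free coordinate.
    lab-detour : ∀ z z′ → ins ρ ys z ≡ k → ins ρ ys z′ ≡ k → (∀ z″ → FarOff ρ z z″ → IrrChain ρ z″ z′) → lab z ≡ lab z′
    lab-detour z z′ e e′ f with neighbour ρ ys z k (≤-trans (≤-reflexive (outs≡ e)) r≤k) k≤ρ
    ... | z″ , i , a , fo = trans (edge z z″ e i (few (subst (λ x → agr z z″ + x ≤ k) (outs≡ e) a)))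
      (lab-chain z″ z′ i e′ (f z″ fo))

-- Shifting and its reversal

pair-in : ∀ {n} → Fin (suc n) → Bool → Bool → V n → V (suc (suc n))
pair-in zero            a b z       = a ∷ b ∷ z
pair-in {suc n} (suc i) a b (c ∷ z) = c ∷ pair-in i a b z

pair-out : ∀ {n} (i : Fin (suc n)) v → ∃ λ a → ∃ λ b → ∃ λ z → v ≡ pair-in i a b z
pair-out zero            (a ∷ b ∷ z) = a , b , z , refl
pair-out {suc n} (suc i) (c ∷ v) with pair-out i v
... | a , b , z , refl = a , b , c ∷ z , refl

int-pair : ∀ {n} (i : Fin (suc n)) a b z a′ b′ z′ →
  int (pair-in i a b z) (pair-in i a′ b′ z′) ≡ ι (a ∧ a′) + (ι (b ∧ b′) + int z z′)
int-pair zero            a b z       a′ b′ z′        = refl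
int-pair {suc n} (suc i) a b (c ∷ z) a′ b′ (c′ ∷ z′) =
  trans (cong (ι (c ∧ c′) +_) (int-pair i a b z a′ b′ z′)) (pull (ι (c ∧ c′)) (ι (a ∧ a′)) (ι (b ∧ b′)) (int z z′))
  where
  pull : ∀ x y z w → x + (y + (z + w)) ≡ y + (z + (x + w))
  pull = solve-∀

size-pair : ∀ {n} (i : Fin (suc n)) a b z → size (pair-in i a b z) ≡ ι a + (ι b + size z)
size-pair zero            a b z       = refl
size-pair {suc n} (suc i) a b (c ∷ z) = trans (cong (ι c +_) (size-pair i a b z)) (pull (ι c) (ι a) (ι b) (size z))
  where
  pull : ∀ x y z w → x + (y + (z + w)) ≡ y + (z + (x + w))
  pull = solve-∀

∑-pair : ∀ {n} (i : Fin (suc n)) (f : V (suc (suc n)) → ℕ) → ∑ (B (suc (suc n))) f ≡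
  ∑ (B n) (λ z → (f (pair-in i false false z) + f (pair-in i true true z)) + (f (pair-in i true false z) + f (pair-in i false true z)))
∑-pair {n} zero f = trans (∑-B (suc n) f) (trans (cong₂ _+_ (∑-B n (λ v → f (false ∷ v))) (∑-B n (λ v → f (true ∷ v))))
  (trans (regroup (s false false) (s false true) (s true false) (s true true))
    (sym (trans (∑-+ (B n) _ _) (cong₂ _+_ (∑-+ (B n) _ _) (∑-+ (B n) _ _))))))
  where
  s : Bool → Bool → ℕ
  s a b = ∑ (B n) (λ z → f (a ∷ b ∷ z))
  regroup : ∀ a b c d → a + b + (c + d) ≡ a + d + (c + b)
  regroup = solve-∀
∑-pair {suc n} (suc i) f = trans (∑-B (suc (suc n)) f)
  (trans (cong₂ _+_ (∑-pair i (λ v → f (false ∷ v))) (∑-pair i (λ v → f (true ∷ v)))) (sym (∑-B n _)))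

-- Sum of the indices of the ones: each one is counted once for every coordinate before it. An
-- adjacent shift raises it by one.
pos : ∀ {n} → V n → ℕ
pos []      = 0
pos (a ∷ v) = pos v + size v

pos-pair : ∀ {n} (i : Fin (suc n)) z → pos (pair-in i false true z) ≡ suc (pos (pair-in i true false z))
pos-pair zero z = +-suc (pos z + size z) (size z)
pos-pair {suc n} (suc i) (c ∷ z) = cong₂ _+_ (pos-pair i z) (trans (size-pair i false true z) (sym (size-pair i true false z)))

shift-at : ∀ {n} → Fin (suc n) → Family (suc (suc n)) → Family (suc (suc n))
shift-at zero G (true ∷ false ∷ z)  = G (true ∷ false ∷ z) ∧ G (false ∷ true ∷ z)
shift-at zero G (false ∷ true ∷ z)  = G (true ∷ false ∷ z) ∨ G (false ∷ true ∷ z)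
shift-at zero G (true ∷ true ∷ z)   = G (true ∷ true ∷ z)
shift-at zero G (false ∷ false ∷ z) = G (false ∷ false ∷ z)
shift-at {suc n} (suc i) G (c ∷ v)  = shift-at i (λ u → G (c ∷ u)) v

shift-tf : ∀ {n} (i : Fin (suc n)) G z → shift-at i G (pair-in i true false z) ≡ G (pair-in i true false z) ∧ G (pair-in i false true z)
shift-tf zero            G z       = refl
shift-tf {suc n} (suc i) G (c ∷ z) = shift-tf i _ z

shift-ft : ∀ {n} (i : Fin (suc n)) G z → shift-at i G (pair-in i false true z) ≡ G (pair-in i true false z) ∨ G (pair-in i false true z)
shift-ft zero            G z       = refl
shift-ft {suc n} (suc i) G (c ∷ z) = shift-ft i _ z

shift-same : ∀ {n} (i : Fin (suc n)) G a z → shift-at i G (pair-in i a a z) ≡ G (pair-in i a a z)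
shift-same zero            G true  z       = refl
shift-same zero            G false z       = refl
shift-same {suc n} (suc i) G a     (c ∷ z) = shift-same i _ a z

-- The delicate pair is a set that stays at (1, 0) against one that was moved to (0, 1). The first
-- stays because its shifted form is in `G` too, and that form is compared with the second before
-- its move.
shift-int : ∀ {n t} (i : Fin (suc n)) (G : Family (suc (suc n))) → Int t G → Int t (shift-at i G)
shift-int {n} {t} i G int-G v u sv su with pair-out i v | pair-out i u
... | a , b , z , refl | a′ , b′ , z′ , refl = subst (t ≤_) (sym (int-pair i a b z a′ b′ z′)) (cases a b a′ b′ sv su)
  where
  meet : ∀ a b z a′ b′ z′ → G (pair-in i a b z) ≡ true → G (pair-in i a′ b′ z′) ≡ true →
    t ≤ ι (a ∧ a′) + (ι (b ∧ b′) + int z z′)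
  meet a b z a′ b′ z′ g g′ = subst (t ≤_) (int-pair i a b z a′ b′ z′) (int-G _ _ g g′)
  both : ∀ {z} → shift-at i G (pair-in i true false z) ≡ true → G (pair-in i true false z) ≡ true × G (pair-in i false true z) ≡ true
  both {z} e = ∧-true (trans (sym (shift-tf i G z)) e)
  one : ∀ {z} → shift-at i G (pair-in i false true z) ≡ true → G (pair-in i true false z) ≡ true ⊎ G (pair-in i false true z) ≡ true
  one {z} e with G (pair-in i true false z) | G (pair-in i false true z) | trans (sym (shift-ft i G z)) e
  ... | true  | _    | _ = inj₁ refl
  ... | false | true | _ = inj₂ refl
  same : ∀ {a z} → shift-at i G (pair-in i a a z) ≡ true → G (pair-in i a a z) ≡ true
  same {a} {z} e = trans (sym (shift-same i G a z)) e
  cases : ∀ a b a′ b′ → shift-at i G (pair-in i a b z) ≡ true → shift-at i G (pair-in i a′ b′ z′) ≡ true →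
    t ≤ ι (a ∧ a′) + (ι (b ∧ b′) + int z z′)
  cases true  true  true  true  s s′ = meet true true z true true z′ (same s) (same s′)
  cases true  true  true  false s s′ = meet true true z true false z′ (same s) (proj₁ (both s′))
  cases true  true  false false s s′ = meet true true z false false z′ (same s) (same s′)
  cases true  true  false true  s s′ with one s′
  ... | inj₁ g = meet true true z true false z′ (same s) g
  ... | inj₂ g = meet true true z false true z′ (same s) g
  cases false false true  true  s s′ = meet false false z true true z′ (same s) (same s′)
  cases false false true  false s s′ = meet false false z true false z′ (same s) (proj₁ (both s′))
  cases false false false false s s′ = meet false false z false false z′ (same s) (same s′)
  cases false false false true  s s′ with one s′
  ... | inj₁ g = meet false false z true false z′ (same s) g
  ... | inj₂ g = meet false false z false true z′ (same s) g
  cases true  false true  true  s s′ = meet true false z true true z′ (proj₁ (both s)) (same s′)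
  cases true  false true  false s s′ = meet true false z true false z′ (proj₁ (both s)) (proj₁ (both s′))
  cases true  false false false s s′ = meet true false z false false z′ (proj₁ (both s)) (same s′)
  cases true  false false true  s s′ with one s′
  ... | inj₁ g = meet false true z true false z′ (proj₂ (both s)) g
  ... | inj₂ g = meet true false z false true z′ (proj₁ (both s)) g
  cases false true  true  true  s s′ with one s
  ... | inj₁ g = meet true false z true true z′ g (same s′)
  ... | inj₂ g = meet false true z true true z′ g (same s′)
  cases false true  true  false s s′ with one s
  ... | inj₁ g = meet true false z false true z′ g (proj₂ (both s′))
  ... | inj₂ g = meet false true z true false z′ g (proj₁ (both s′))
  cases false true  false false s s′ with one s
  ... | inj₁ g = meet true false z false false z′ g (same s′)
  ... | inj₂ g = meet false true z false false z′ g (same s′)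
  cases false true  false true  s s′ with one s | one s′
  ... | inj₁ g | inj₁ g′ = meet true false z true false z′ g g′
  ... | inj₁ g | inj₂ g′ = ≤-trans (meet true false z false true z′ g g′) (n≤1+n _)
  ... | inj₂ g | inj₁ g′ = ≤-trans (meet false true z true false z′ g g′) (n≤1+n _)
  ... | inj₂ g | inj₂ g′ = meet false true z false true z′ g g′

find-unshifted : ∀ {n} (G : Family (suc (suc n))) → Shifted G ⊎
  (∃ λ i → ∃ λ z → G (pair-in i true false z) ≡ true × G (pair-in i false true z) ≡ false)
find-unshifted {n} G with search (B n) (λ z → G (true ∷ false ∷ z) ∧ not (G (false ∷ true ∷ z)))
... | inj₁ (z , e) = inj₂ (zero , z , proj₁ (∧-true e) , not-true (proj₂ (∧-true {G (true ∷ false ∷ z)} e)))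
... | inj₂ none = sections n G head
  where
  head : ∀ v → G (true ∷ false ∷ v) ≡ true → G (false ∷ true ∷ v) ≡ true
  head v g with none (∈-B v)
  ... | e rewrite g = not-false e
  sections : ∀ n (G : Family (suc (suc n))) → HeadShifted G → Shifted G ⊎
    (∃ λ i → ∃ λ z → G (pair-in i true false z) ≡ true × G (pair-in i false true z) ≡ false)
  sections zero    G h = inj₁ (h , (tt , tt , tt) , (tt , tt , tt))
  sections (suc n) G h with find-unshifted (λ v → G (true ∷ v)) | find-unshifted (λ v → G (false ∷ v))
  ... | inj₂ (i , z , e) | _                = inj₂ (suc i , true ∷ z , e)
  ... | inj₁ _           | inj₂ (i , z , e) = inj₂ (suc i , false ∷ z , e)
  ... | inj₁ st          | inj₁ sf          = inj₁ (h , st , sf)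

-- Frankl's families. For t = 1 the clause on r leaves only the families of all sets containing a
-- given point.
Threshold : ∀ {n} → ℕ → Family n → Set
Threshold {n} t G = ∃ λ (R : V n) → ∃ λ r → size R ≡ t + (r + r) × (2 ≤ t ⊎ r ≡ 0) × (∀ v → G v ≡ (t + r ≤ᵇ int v R))

bit-far-out : ∀ (_ : ⊤) v → v ≡ true → ∃ λ u → u ≡ false × v ∧ u ≡ false
bit-far-out _ true _ = false , refl , refl

bit-far-in : ∀ (_ : ⊤) v → v ≡ false → ∃ λ u → u ≡ true × v ∧ u ≡ false
bit-far-in _ false _ = true , refl , refl

-- Sets as words in two letters: the only window is {true}, and letters are close when both are
-- true, so that `agr` is the size of the intersection.
module BitConnectivity = Connectivity {Bool} {⊤} _∧_ (λ _ v → v) bit-far-out bit-far-in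

module _ where
  open BitConnectivity

  units : ∀ n → Vec ⊤ n
  units zero    = []
  units (suc n) = tt ∷ units n

  bit-pattern : ∀ {n} (z : V n) → pattern-of (units n) z ≡ z
  bit-pattern []      = refl
  bit-pattern (a ∷ z) = cong (a ∷_) (bit-pattern z)

  bit-agr : ∀ {n} (z z′ : V n) → agr z z′ ≡ int z z′
  bit-agr []      []        = refl
  bit-agr (a ∷ z) (b ∷ z′) = cong (ι (a ∧ b) +_) (bit-agr z z′)

  bit-chain : ∀ {n} (ρ z z′ : V n) → IrrChain ρ z z′
  bit-chain []          []      []       = []
  bit-chain (true ∷ ρ)  (a ∷ z) (b ∷ z′) = on (bit-chain ρ z z′)
  bit-chain (false ∷ ρ) (a ∷ z) (b ∷ z′) = off (link false (Bool.∧-zeroʳ a) (Bool.∧-zeroʳ b) nil) (bit-chain ρ z z′)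

  bit-constant : ∀ {n} (ρ : V n) t k r → suc k ≡ t + r → size ρ ≡ k + r → suc r ≤ k ⊎ size ρ ≡ 0 → (lab : V n → Bool) →
    (∀ z z′ → int z ρ ≡ k → int z′ ρ ≡ k → int z z′ < t → lab z ≡ lab z′) →
    ∀ z z′ → int z ρ ≡ k → int z′ ρ ≡ k → lab z ≡ lab z′
  bit-constant {n} ρ t k r k≡ ρ≡ enough lab edge z z′ e e′ =
    Constant.lab-chain ρ (units n) t k r k≡ ρ≡ enough lab
      (λ z z′ e e′ lt → edge z z′ (from e) (from e′) (subst (_< t) (bit-agr z z′) lt)) z z′ (to e) (to e′) (bit-chain ρ z z′)
    where
    from : ∀ {z} → int (pattern-of (units n) z) ρ ≡ k → int z ρ ≡ k
    from {z} = subst (λ w → int w ρ ≡ k) (bit-pattern z)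
    to : ∀ {z} → int z ρ ≡ k → int (pattern-of (units n) z) ρ ≡ k
    to {z} = subst (λ w → int w ρ ≡ k) (sym (bit-pattern z))

room-for-swap : ∀ {t k r} → 1 ≤ t → suc k ≡ t + r → 2 ≤ t ⊎ r ≡ 0 → suc r ≤ k ⊎ k + r ≡ 0
room-for-swap {suc zero}    {k}     _ e (inj₂ refl)    = inj₂ (trans (+-identityʳ k) (suc-injective e))
room-for-swap {suc zero}            _ e (inj₁ (s≤s ()))
room-for-swap {suc (suc t)} {r = r} _ e _              = inj₁ (≤-trans (s≤s (m≤n+m r t)) (≤-reflexive (sym (suc-injective e))))

-- On the middle level exactly one of the two placements of the shifted element belongs to `G`.
-- Middle sets with different placements meet in at least t points, so the placement is constant
-- along the edges of the graph; by connectivity `G` is the threshold family with the two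
-- coordinates interchanged.
unshift : ∀ {n t} (i : Fin (suc n)) (G : Family (suc (suc n))) → 1 ≤ t → Int t G →
  (∃ λ z → G (pair-in i true false z) ≡ true × G (pair-in i false true z) ≡ false) →
  Threshold t (shift-at i G) → Threshold t G
unshift {n} {t} i G 1≤t int-G (z₀ , g₀ , g₀′) (R , r , R≡ , large , value) with pair-out i R
... | r₁ , r₂ , R′ , refl = cases r₁ r₂ R≡ (λ a b z → trans (value (pair-in i a b z)) (cong (t + r ≤ᵇ_) (int-pair i a b z r₁ r₂ R′)))
  where
  cases : ∀ r₁ r₂ → size (pair-in i r₁ r₂ R′) ≡ t + (r + r) →
    (∀ a b z → shift-at i G (pair-in i a b z) ≡ (t + r ≤ᵇ ι (a ∧ r₁) + (ι (b ∧ r₂) + int z R′))) → Threshold t G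
  low₀ : shift-at i G (pair-in i true false z₀) ≡ false
  low₀ = trans (shift-tf i G z₀) (cong₂ _∧_ g₀ g₀′)
  high₀ : shift-at i G (pair-in i false true z₀) ≡ true
  high₀ = trans (shift-ft i G z₀) (cong₂ _∨_ g₀ g₀′)
  -- In the shifted family z₀ is absent with the element in front and present with it behind, so R
  -- contains the second coordinate of the pair and not the first.
  cases true  true  _ val = ⊥-elim (true≢false (trans (trans (val true false z₀) (sym (val false true z₀))) high₀) low₀)
  cases false false _ val = ⊥-elim (true≢false (trans (trans (val true false z₀) (sym (val false true z₀))) high₀) low₀)
  cases true  false _ val = ⊥-elim (true≢false
    (trans (val true false z₀) (true-≤ᵇ (m≤n⇒m≤1+n (≤ᵇ-true {t + r} (trans (sym (val false true z₀)) high₀))))) low₀)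
  cases false true R≡ val = pair-in i true false R′ , r ,
    trans (size-pair i true false R′) (trans (sym (size-pair i false true R′)) R≡) , large , value′
    where
    k : ℕ
    k = t + r ∸ 1
    k≡ : suc k ≡ t + r
    k≡ = m+[n∸m]≡n (≤-trans 1≤t (m≤m+n t r))
    ρ≡ : size R′ ≡ k + r
    ρ≡ = suc-injective (trans (sym (size-pair i false true R′)) (trans R≡ (trans (sym (+-assoc t r r)) (cong (_+ r) (sym k≡)))))
    lab : V n → Bool
    lab z = G (pair-in i true false z)
    middle-∨ : ∀ {z} → int z R′ ≡ k → lab z ∨ G (pair-in i false true z) ≡ true
    middle-∨ {z} e = trans (sym (shift-ft i G z)) (trans (val false true z) (true-≤ᵇ (≤-reflexive (trans (sym k≡) (cong suc (sym e))))))
    middle-∧ : ∀ {z} → int z R′ ≡ k → lab z ∧ G (pair-in i false true z) ≡ false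
    middle-∧ {z} e = trans (sym (shift-tf i G z)) (trans (val true false z) (false-≤ᵇ {t + r} (≤-reflexive (trans (cong suc e) k≡))))
    other : ∀ {z} → int z R′ ≡ k → lab z ≡ false → G (pair-in i false true z) ≡ true
    other {z} e l = trans (cong (_∨ G (pair-in i false true z)) (sym l)) (middle-∨ e)
    separated : ∀ z z′ → lab z ≡ true → lab z′ ≡ false → int z′ R′ ≡ k → t ≤ int z z′
    separated z z′ l l′ e′ = ≤-trans (int-G _ _ l (other e′ l′)) (≤-reflexive (int-pair i true false z false true z′))
    edge : ∀ z z′ → int z R′ ≡ k → int z′ R′ ≡ k → int z z′ < t → lab z ≡ lab z′
    edge z z′ e e′ lt with lab z in l | lab z′ in l′
    ... | true  | true  = refl
    ... | false | false = refl
    ... | true  | false = ⊥-elim (<⇒≱ lt (separated z z′ l l′ e′))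
    ... | false | true  = ⊥-elim (<⇒≱ lt (≤-trans (separated z′ z l′ l e) (≤-reflexive (int-comm z′ z))))
    z₀-level : int z₀ R′ ≡ k
    z₀-level = ≤-antisym
      (s≤s⁻¹ (≤-trans (≤ᵇ-false {t + r} (trans (sym (val true false z₀)) low₀)) (≤-reflexive (sym k≡))))
      (s≤s⁻¹ (≤-trans (≤-reflexive k≡) (≤ᵇ-true {t + r} (trans (sym (val false true z₀)) high₀))))
    lab≡ : ∀ z → int z R′ ≡ k → lab z ≡ true
    lab≡ z e = trans (bit-constant R′ t k r k≡ ρ≡ room lab edge z z₀ e z₀-level) g₀
      where
      room : suc r ≤ k ⊎ size R′ ≡ 0
      room with room-for-swap 1≤t k≡ large
      ... | inj₁ h = inj₁ h
      ... | inj₂ h = inj₂ (trans ρ≡ h)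
    or-false : ∀ {a b} → a ∨ b ≡ false → a ≡ false × b ≡ false
    or-false {false} {false} _ = refl , refl
    below : ∀ {z} → int z R′ < k → suc (suc (int z R′)) ≤ t + r
    below lt = ≤-trans (s≤s lt) (≤-reflexive k≡)
    above : ∀ {z} → k < int z R′ → t + r ≤ int z R′
    above gt = ≤-trans (≤-reflexive (sym k≡)) gt
    below-∨ : ∀ {z} → int z R′ < k → lab z ≡ false × G (pair-in i false true z) ≡ false
    below-∨ {z} lt = or-false (trans (sym (shift-ft i G z)) (trans (val false true z) (false-≤ᵇ {t + r} (below {z} lt))))
    above-∧ : ∀ {z} → k < int z R′ → lab z ≡ true × G (pair-in i false true z) ≡ true
    above-∧ {z} gt = ∧-true (trans (sym (shift-tf i G z)) (trans (val true false z) (true-≤ᵇ (above {z} gt))))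
    value-tf : ∀ z → lab z ≡ (t + r ≤ᵇ suc (int z R′))
    value-tf z with <-cmp (int z R′) k
    ... | tri< lt _ _ = trans (proj₁ (below-∨ {z} lt)) (sym (false-≤ᵇ {t + r} (below {z} lt)))
    ... | tri≈ _ e _  = trans (lab≡ z e) (sym (true-≤ᵇ (≤-reflexive (trans (sym k≡) (cong suc (sym e))))))
    ... | tri> _ _ gt = trans (proj₁ (above-∧ {z} gt)) (sym (true-≤ᵇ (m≤n⇒m≤1+n (above {z} gt))))
    value-ft : ∀ z → G (pair-in i false true z) ≡ (t + r ≤ᵇ int z R′)
    value-ft z with <-cmp (int z R′) k
    ... | tri< lt _ _ = trans (proj₂ (below-∨ {z} lt)) (sym (false-≤ᵇ {t + r} (≤-trans (n≤1+n _) (below {z} lt))))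
    ... | tri≈ _ e _  = trans (trans (cong (_∧ G (pair-in i false true z)) (sym (lab≡ z e))) (middle-∧ e))
      (sym (false-≤ᵇ {t + r} (≤-reflexive (trans (cong suc e) k≡))))
    ... | tri> _ _ gt = trans (proj₂ (above-∧ {z} gt)) (sym (true-≤ᵇ (above {z} gt)))
    value-z : ∀ a b z → G (pair-in i a b z) ≡ (t + r ≤ᵇ ι (a ∧ true) + (ι (b ∧ false) + int z R′))
    value-z true  true  z = trans (sym (shift-same i G true z)) (val true true z)
    value-z false false z = trans (sym (shift-same i G false z)) (val false false z)
    value-z true  false z = value-tf z
    value-z false true  z = value-ft z
    value′ : ∀ v → G v ≡ (t + r ≤ᵇ int v (pair-in i true false R′))
    value′ v with pair-out i v
    ... | a , b , z , refl = trans (value-z a b z) (cong (t + r ≤ᵇ_) (sym (int-pair i a b z true false R′)))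

-- Weighted measures

module Weighted (p q : ℕ) where

  wt : ∀ {n} → V n → ℕ
  wt []          = 1
  wt (true ∷ v)  = p * wt v
  wt (false ∷ v) = q * wt v

  module μ {n : ℕ} = Exchange (B n) wt
  open μ public using (μ; μ-cong; μ-mono; swap; μ-swap; μ-zero)

  μ-split : ∀ {n} (G : Family (suc n)) → μ G ≡ q * μ (G ∘ (false ∷_)) + p * μ (G ∘ (true ∷_))
  μ-split {n} G = trans (∑-B n _) (cong₂ _+_
    (trans (∑-cong (B n) (λ v → pull (ι (G (false ∷ v))) q (wt v))) (∑-*ˡ (B n) q _))
    (trans (∑-cong (B n) (λ v → pull (ι (G (true ∷ v))) p (wt v))) (∑-*ˡ (B n) p _)))
    where
    pull : ∀ x y z → x * (y * z) ≡ y * (x * z)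
    pull = solve-∀

  Opt : ∀ {n} → ℕ → Family n → Set
  Opt {n} t G = Int t G × (∀ (H : Family n) → Int t H → μ H ≤ μ G)

  opt-≤ : ∀ {n t} {G H : Family n} → Opt t G → Int t H → μ G ≤ μ H → Opt t H
  opt-≤ (i , m) h e = h , (λ H′ h′ → ≤-trans (m H′ h′) e)

  -- By optimality the swapped family is not heavier than `G`. As `G` is t-intersecting, only pairs
  -- with an added set have to be checked.
  exchange : ∀ {n t} {G : Family n} (Rem Add : Family n) → Opt t G →
    (∀ v → Rem v ≡ true → G v ≡ true) → (∀ v → Add v ≡ true → G v ≡ false) →
    (∀ v u → Add v ≡ true → Add u ≡ true → t ≤ int v u) →
    (∀ v u → Add v ≡ true → G u ≡ true → Rem u ≡ false → t ≤ int v u) →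
    Int t (swap G Rem Add) × μ Add ≤ μ Rem
  exchange {n} {t} {G} Rem Add (i , m) hr ha haa hag = int′ ,
    lin 0 (m _ int′) ((trans (+-comm (μ Rem) _) (trans (μ-swap G Rem Add hr ha) (trans (+-comm (μ G) (μ Add)) (sym (+-identityʳ _))))))
    where
    int′ : Int t (swap G Rem Add)
    int′ v u ev eu with Add v in av | Add u in au | G v in gv | G u in gu | Rem v in rv | Rem u in ru
    ... | true  | true  | _ | _ | _ | _ = haa v u av au
    ... | true  | false | _ | true | _ | false = hag v u av gu ru
    ... | false | true  | true | _ | false | _ = subst (t ≤_) (int-comm u v) (hag u v au gv rv)
    ... | false | false | true | true | _ | _ = i v u gv gu
    int′ v u () eu | false | _ | false | _ | _ | _
    int′ v u () eu | false | _ | true  | _ | true | _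
    int′ v u ev () | _ | false | _ | false | _ | _
    int′ v u ev () | _ | false | _ | true  | _ | true

  module Positive (1≤p : 1 ≤ p) (1≤q : 1 ≤ q) where

    wt>0 : ∀ {n} (v : V n) → 1 ≤ wt v
    wt>0 []          = ≤-refl
    wt>0 (true ∷ v)  = *-mono-≤ 1≤p (wt>0 v)
    wt>0 (false ∷ v) = *-mono-≤ 1≤q (wt>0 v)

    module _ {n : ℕ} where
      open μ.Complete {n} ∈-B wt>0 public

    -- Otherwise v alone could be added, and every single set has positive weight.
    opt-maximal : ∀ {n t} {G : Family n} → Opt t G → ∀ v → t ≤ size v →
      (∀ u → G u ≡ true → t ≤ int v u) → G v ≡ true
    opt-maximal {n} {t} {G} o v tv tu with G v in e
    ... | true  = refl
    ... | false = ⊥-elim (<⇒≱ (μ-pos {G = is v} (is-refl v)) (≤-trans (proj₂ result) (≤-reflexive (μ-zero {n} {λ _ → false} (λ _ → refl)))))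
      where
      is : ∀ {k} → V k → V k → Bool
      is []      []      = true
      is (a ∷ v) (b ∷ u) = (if a then b else not b) ∧ is v u
      is-refl : ∀ {k} (v : V k) → is v v ≡ true
      is-refl []          = refl
      is-refl (true ∷ v)  = is-refl v
      is-refl (false ∷ v) = is-refl v
      is-≡ : ∀ {k} (v u : V k) → is v u ≡ true → v ≡ u
      is-≡ []          []          h = refl
      is-≡ (true ∷ v)  (true ∷ u)  h = cong (true ∷_) (is-≡ v u h)
      is-≡ (false ∷ v) (false ∷ u) h = cong (false ∷_) (is-≡ v u h)
      result : Int t (swap G (λ _ → false) (is v)) × μ (is v) ≤ μ {n} (λ _ → false)
      result = exchange (λ _ → false) (is v) o (λ _ ()) (λ u h → trans (cong G (sym (is-≡ v u h))) e)
        (λ x y hx hy → subst₂ (λ a b → t ≤ int a b) (is-≡ v x hx) (is-≡ v y hy) (≤-trans tv (≤-reflexive (sym (int-self v)))))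
        (λ x y hx gy _ → subst (λ a → t ≤ int a y) (is-≡ v x hx) (tu y gy))

    opt-up : ∀ {n t} {G : Family (suc n)} → Opt t G → ∀ v → G (false ∷ v) ≡ true → G (true ∷ v) ≡ true
    opt-up {n} {t} {G} o v g = opt-maximal o (true ∷ v)
      (m≤n⇒m≤1+n (≤-trans (proj₁ o _ _ g g) (≤-reflexive (int-self v)))) meets
      where
      meets : ∀ u → G u ≡ true → t ≤ int (true ∷ v) u
      meets (b ∷ u) h = ≤-trans (proj₁ o _ _ g h) (m≤n+m (int v u) (ι b))

  wt-⧺ : ∀ {c k} (C : V c) (v : V k) → wt (C ⧺ v) ≡ wt C * wt v
  wt-⧺ []          v = sym (+-identityʳ _)
  wt-⧺ (true ∷ C)  v = trans (cong (p *_) (wt-⧺ C v)) (sym (*-assoc p (wt C) (wt v)))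
  wt-⧺ (false ∷ C) v = trans (cong (q *_) (wt-⧺ C v)) (sym (*-assoc q (wt C) (wt v)))

  ∑-⧺ : ∀ c {k} (f : V (c + k) → ℕ) → ∑ (B (c + k)) f ≡ ∑ (B c) (λ C → ∑ (B k) (λ v → f (C ⧺ v)))
  ∑-⧺ zero    f = sym (+-identityʳ _)
  ∑-⧺ (suc c) {k} f = trans (∑-B (c + k) f)
    (trans (cong₂ _+_ (∑-⧺ c (λ v → f (false ∷ v))) (∑-⧺ c (λ v → f (true ∷ v)))) (sym (∑-B c _)))

  μ-⧺ : ∀ c {k} (G : Family (c + k)) (I : Family c) (H : Family k) → (∀ C v → G (C ⧺ v) ≡ I C ∧ H v) →
    μ G ≡ μ H * μ I
  μ-⧺ c {k} G I H e = trans (∑-⧺ c _) (trans (∑-cong (B c) row) (∑-*ˡ (B c) (μ H) _))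
    where
    pull : ∀ x y z w → x * y * (z * w) ≡ x * z * (y * w)
    pull = solve-∀
    row : ∀ C → ∑ (B k) (λ v → ι (G (C ⧺ v)) * wt (C ⧺ v)) ≡ μ H * (ι (I C) * wt C)
    row C = trans (∑-cong (B k) (λ v → trans (cong₂ _*_ (trans (cong ι (e C v)) (ι-∧ (I C) (H v))) (wt-⧺ C v))
      (pull (ι (I C)) (ι (H v)) (wt C) (wt v)))) (trans (∑-*ˡ (B k) (ι (I C) * wt C) _) (*-comm _ (μ H)))

  level : ∀ κ → ℕ → Family κ
  level κ j v = size v ≡ᵇ j

  level-suc : ∀ κ j → μ (level (suc κ) (suc j)) ≡ p * μ (level κ j) + q * μ (level κ (suc j))
  level-suc κ j = trans (μ-split (level (suc κ) (suc j))) (+-comm (q * _) _)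

  level-zero : ∀ κ → μ (level (suc κ) 0) ≡ q * μ (level κ 0)
  level-zero κ = trans (μ-split (level (suc κ) 0))
    (trans (cong (λ x → q * μ (level κ 0) + p * x) (μ-zero {κ} {λ _ → false} (λ _ → refl)))
      (trans (cong (q * μ (level κ 0) +_) (*-zeroʳ p)) (+-identityʳ _)))

  -- (j + 1) C(κ, j + 1) = (κ - j) C(κ, j), with weights.
  level-step : ∀ κ j → suc j * (q * μ (level κ (suc j))) + j * (p * μ (level κ j)) ≡ κ * (p * μ (level κ j))
  level-step zero zero = cong (λ x → x + 0 + 0) (*-zeroʳ q)
  level-step zero (suc j) rewrite *-zeroʳ q | *-zeroʳ p | *-zeroʳ j = refl
  level-step (suc κ) zero rewrite level-suc κ 0 | level-zero κ = arith p q (μ (level κ 0)) (μ (level κ 1)) κ (level-step κ 0)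
    where
    arith : ∀ p q x y k → 1 * (q * y) + 0 * (p * x) ≡ k * (p * x) →
      1 * (q * (p * x + q * y)) + 0 * (p * (q * x)) ≡ suc k * (p * (q * x))
    arith p q x y k e = trans (l p q x y) (trans (cong (λ z → q * (p * x) + q * z) e) (r p q x k))
      where
      l : ∀ p q x y → 1 * (q * (p * x + q * y)) + 0 * (p * (q * x)) ≡ q * (p * x) + q * (1 * (q * y) + 0 * (p * x))
      l = solve-∀
      r : ∀ p q x k → q * (p * x) + q * (k * (p * x)) ≡ suc k * (p * (q * x))
      r = solve-∀
  level-step (suc κ) (suc j) rewrite level-suc κ (suc j) | level-suc κ j =
    arith p q (μ (level κ j)) (μ (level κ (suc j))) (μ (level κ (suc (suc j)))) κ j (level-step κ j) (level-step κ (suc j))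
    where
    arith : ∀ p q x y z k j → suc j * (q * y) + j * (p * x) ≡ k * (p * x) →
      suc (suc j) * (q * z) + suc j * (p * y) ≡ k * (p * y) →
      suc (suc j) * (q * (p * y + q * z)) + suc j * (p * (p * x + q * y)) ≡ suc k * (p * (p * x + q * y))
    arith p q x y z k j e f = +-cancelʳ-≡ (q * (k * (p * y)) + p * (k * (p * x))) _ _
      (trans (ring p q x y z k j) (cong (suc k * (p * (p * x + q * y)) +_) (cong₂ (λ a b → q * a + p * b) f e)))
      where
      ring : ∀ p q x y z k j → suc (suc j) * (q * (p * y + q * z)) + suc j * (p * (p * x + q * y)) + (q * (k * (p * y)) + p * (k * (p * x)))
        ≡ suc k * (p * (p * x + q * y)) + (q * (suc (suc j) * (q * z) + suc j * (p * y)) + p * (suc j * (q * y) + j * (p * x)))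
      ring = solve-∀

  level-step′ : ∀ b d → suc b * (q * μ (level (b + d) (suc b))) ≡ d * (p * μ (level (b + d) b))
  level-step′ b d = +-cancelʳ-≡ (b * (p * μ (level (b + d) b))) _ _
    (trans (level-step (b + d) b) (trans (*-distribʳ-+ (p * μ (level (b + d) b)) b d) (+-comm _ (d * (p * μ (level (b + d) b))))))

-- Potential of a family, and families with equal weights

ι-pair : ∀ a b x → ι (a ∧ b) * x + ι (a ∨ b) * x ≡ ι a * x + ι b * x
ι-pair true  true  x = refl
ι-pair true  false x = sym (+-identityʳ (x + 0))
ι-pair false true  x = refl
ι-pair false false x = refl

module _ (p q : ℕ) where
  open Weighted p q

  wt-pair : ∀ {n} (i : Fin (suc n)) z → wt (pair-in i true false z) ≡ wt (pair-in i false true z)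
  wt-pair zero z = swap-factors p q (wt z)
    where
    swap-factors : ∀ x y z → x * (y * z) ≡ y * (x * z)
    swap-factors = solve-∀
  wt-pair {suc n} (suc i) (true ∷ z)  = cong (p *_) (wt-pair i z)
  wt-pair {suc n} (suc i) (false ∷ z) = cong (q *_) (wt-pair i z)

  μ-shift : ∀ {n} (i : Fin (suc n)) G → μ (shift-at i G) ≡ μ G
  μ-shift {n} i G = trans (∑-pair i _) (trans (∑-cong (B n) row) (sym (∑-pair i _)))
    where
    row : ∀ z → _ ≡ _
    row z = cong₂ _+_
      (cong₂ _+_ (cong (λ b → ι b * wt (pair-in i false false z)) (shift-same i G false z)) (cong (λ b → ι b * wt (pair-in i true true z)) (shift-same i G true z)))
      (trans (cong₂ _+_ (cong (λ b → ι b * wt (pair-in i true false z)) (shift-tf i G z)) (cong₂ (λ b w → ι b * w) (shift-ft i G z) (sym (wt-pair i z))))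
        (trans (ι-pair (G (pair-in i true false z)) (G (pair-in i false true z)) (wt (pair-in i true false z)))
          (cong (λ w → ι (G (pair-in i true false z)) * wt (pair-in i true false z) + ι (G (pair-in i false true z)) * w) (wt-pair i z))))

potential : ∀ {n} → Family n → ℕ
potential {n} G = ∑ (B n) (λ v → ι (G v) * pos v)

potential-bound : ∀ {n} (G : Family n) → potential G ≤ ∑ (B n) pos
potential-bound {n} G = ∑-mono (B n) (λ v → ≤-trans (*-monoˡ-≤ (pos v) (ι≤1 (G v))) (≤-reflexive (+-identityʳ (pos v))))

-- Every moved set gains one in `pos`, and the witness is moved. This bounds the number of shifts.
potential-shift : ∀ {n} (i : Fin (suc n)) G → (∃ λ z → G (pair-in i true false z) ≡ true × G (pair-in i false true z) ≡ false) →
  potential G < potential (shift-at i G)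
potential-shift {n} i G (z₀ , g₀ , g₀′) = begin-strict
  potential G              ≡⟨ ∑-pair i _ ⟩
  ∑ (B n) old              <⟨ strictly ⟩
  ∑ (B n) new              ≡⟨ sym (∑-pair i _) ⟩
  potential (shift-at i G)    ∎
  where
  open ≤-Reasoning
  old new moved : V n → ℕ
  old z = (ι (G (pair-in i false false z)) * pos (pair-in i false false z) + ι (G (pair-in i true true z)) * pos (pair-in i true true z))
    + (ι (G (pair-in i true false z)) * pos (pair-in i true false z) + ι (G (pair-in i false true z)) * pos (pair-in i false true z))
  new z = (ι (shift-at i G (pair-in i false false z)) * pos (pair-in i false false z) + ι (shift-at i G (pair-in i true true z)) * pos (pair-in i true true z))
    + (ι (shift-at i G (pair-in i true false z)) * pos (pair-in i true false z) + ι (shift-at i G (pair-in i false true z)) * pos (pair-in i false true z))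
  moved z = ι (G (pair-in i true false z) ∧ not (G (pair-in i false true z)))
  bits : ∀ a b x → ι (a ∧ b) * x + ι (a ∨ b) * suc x ≡ ι a * x + ι b * suc x + ι (a ∧ not b)
  bits true  true  x = sym (+-identityʳ _)
  bits true  false x = ring x
    where
    ring : ∀ x → suc (x + 0) ≡ x + 0 + 0 + 1
    ring = solve-∀
  bits false true  x = sym (+-identityʳ _)
  bits false false x = refl
  row : ∀ z → new z ≡ old z + moved z
  row z rewrite shift-same i G false z | shift-same i G true z | shift-tf i G z | shift-ft i G z | pos-pair i z =
    trans (cong (ι (G (pair-in i false false z)) * pos (pair-in i false false z) + ι (G (pair-in i true true z)) * pos (pair-in i true true z) +_)
      (bits (G (pair-in i true false z)) (G (pair-in i false true z)) (pos (pair-in i true false z)))) (sym (+-assoc (ι (G (pair-in i false false z)) * pos (pair-in i false false z) + ι (G (pair-in i true true z)) * pos (pair-in i true true z)) _ (moved z)))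
  strictly : ∑ (B n) old < ∑ (B n) new
  strictly = ≤-trans (≤-reflexive (+-comm 1 _)) (≤-trans (+-monoʳ-≤ (∑ (B n) old)
    (≤-trans (≤-reflexive (sym (cong ι (cong₂ (λ a b → a ∧ not b) g₀ g₀′)))) (∑-term moved (∈-B z₀))))
    (≤-reflexive (trans (sym (∑-+ (B n) old moved)) (∑-cong (B n) (λ z → sym (row z))))))

-- Threshold families and the coordinates they ignore

zeros : ∀ {n} → V n → ℕ
zeros []      = 0
zeros (a ∷ v) = ι (not a) + zeros v

zeros+size : ∀ {n} (v : V n) → zeros v + size v ≡ n
zeros+size []          = refl
zeros+size (true ∷ v)  = trans (+-suc (zeros v) (size v)) (cong suc (zeros+size v))
zeros+size (false ∷ v) = cong suc (zeros+size v)

threshold-int : ∀ {n t r} (R : V n) → size R ≡ t + (r + r) → Int t (λ v → t + r ≤ᵇ int v R)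
threshold-int {t = t} {r} R R≡ v u e f = lin 0
  (+-mono-≤ (+-mono-≤ (≤ᵇ-true {t + r} e) (≤ᵇ-true {t + r} f)) (≤-trans (int-relative v u R) (≤-reflexive (cong (_+ int v u) R≡))))
  (ring t r (int v R) (int u R) (int v u))
  where
  ring : ∀ t r x y z → z + (t + r + (t + r) + (x + y)) ≡ t + (x + y + (t + (r + r) + z)) + 0
  ring = solve-∀

-- With equal weights a threshold family ignoring two coordinates is beaten by the one with two more coordinates.
module Uniform (t : ℕ) (2≤t : 2 ≤ t) where
  open Weighted 1 1
  open Positive ≤-refl ≤-refl

  atLeast : ℕ → ℕ → ℕ
  atLeast k c = μ {k} (λ v → c ≤ᵇ size v)

  atLeast-suc : ∀ k c → atLeast (suc k) (suc c) ≡ atLeast k (suc c) + atLeast k c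
  atLeast-suc k c = trans (μ-split {k} (λ v → suc c ≤ᵇ size v)) (cong₂ _+_ (+-identityʳ _)
    (trans (+-identityʳ _) (μ-cong {k} {λ v → c <ᵇ suc (size v)} {λ v → c ≤ᵇ size v} (λ v → sym (≤ᵇ-suc c (size v))))))

  atLeast-level : ∀ k c → atLeast k c ≡ atLeast k (suc c) + μ (level k c)
  atLeast-level k c = trans (∑-cong (B k) row) (∑-+ (B k) _ _)
    where
    bits : ∀ c s → ι (c ≤ᵇ s) ≡ ι (suc c ≤ᵇ s) + ι (s ≡ᵇ c)
    bits zero    zero    = refl
    bits zero    (suc s) = refl
    bits (suc c) zero    = refl
    bits (suc zero) (suc zero) = refl
    bits (suc (suc c)) (suc zero) = refl
    bits (suc zero) (suc (suc s)) = refl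
    bits (suc (suc c)) (suc (suc s)) = bits (suc c) (suc s)
    row : ∀ v → ι (c ≤ᵇ size v) * wt v ≡ ι (suc c ≤ᵇ size v) * wt v + ι (level k c v) * wt v
    row v = trans (cong (_* wt v) (bits c (size v))) (*-distribʳ-+ (wt v) (ι (suc c ≤ᵇ size v)) (ι (size v ≡ᵇ c)))

  weight : ∀ {n} (R : V n) c → μ (λ v → c ≤ᵇ int v R) ≡ 2 ^ zeros R * atLeast (size R) c
  weight [] c = sym (+-identityʳ _)
  weight {suc n} (false ∷ R) c = trans (μ-split (λ v → c ≤ᵇ int v (false ∷ R)))
    (trans (cong₂ (λ x y → 1 * x + 1 * y) (weight R c) (weight R c)) (ring (2 ^ zeros R) (atLeast (size R) c)))
    where
    ring : ∀ x y → 1 * (x * y) + 1 * (x * y) ≡ 2 * x * y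
    ring = solve-∀
  weight {suc n} (true ∷ R) zero = trans (μ-split (λ v → 0 ≤ᵇ int v (true ∷ R)))
    (trans (cong₂ (λ x y → 1 * x + 1 * y) (weight R 0) (weight R 0))
      (trans (ring (2 ^ zeros R) (atLeast (size R) 0)) (cong (2 ^ zeros R *_) (sym (μ-split {size R} (λ v → 0 ≤ᵇ size v))))))
    where
    ring : ∀ x y → 1 * (x * y) + 1 * (x * y) ≡ x * (1 * y + 1 * y)
    ring = solve-∀
  weight {suc n} (true ∷ R) (suc c) = trans (μ-split (λ v → suc c ≤ᵇ int v (true ∷ R)))
    (trans (cong₂ (λ x y → 1 * x + 1 * y) (weight R (suc c)) (trans (μ-cong {n} {λ v → c <ᵇ suc (int v R)} {λ v → c ≤ᵇ int v R} (λ v → sym (≤ᵇ-suc c (int v R)))) (weight R c)))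
      (trans (ring (2 ^ zeros R) (atLeast (size R) (suc c)) (atLeast (size R) c)) (cong (2 ^ zeros R *_) (sym (atLeast-suc (size R) c)))))
    where
    ring : ∀ x y z → 1 * (x * y) + 1 * (x * z) ≡ x * (y + z)
    ring = solve-∀

  -- Two further coordinates turn consecutive tail counts a ≥ b ≥ c into a + 2b + c. This exceeds 4b
  -- exactly if level t + r - 1 outweighs level t + r; the ratio of the latter to the former is (r +
  -- 1) / (t + r), which is below 1 for t ≥ 2.
  more-is-better : ∀ r → 4 * atLeast (t + (r + r)) (t + r) < atLeast (suc (suc (t + (r + r)))) (suc (t + r))
  more-is-better r = at-level (t + r ∸ 1) (m+[n∸m]≡n (≤-trans (≤-trans (s≤s z≤n) 2≤t) (m≤m+n t r)))
    where
    k : ℕ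
    k = t + (r + r)
    at-level : ∀ j → suc j ≡ t + r → 4 * atLeast k (t + r) < atLeast (suc (suc k)) (suc (t + r))
    at-level j e = subst (λ c → 4 * atLeast k c < atLeast (suc (suc k)) (suc c)) e
      (expand (atLeast k j) (atLeast k (suc j)) (atLeast k (suc (suc j))) (μ (level k j)) (μ (level k (suc j)))
        (atLeast-level k j) (atLeast-level k (suc j)) smaller
        (trans (atLeast-suc (suc k) (suc j)) (cong₂ _+_ (atLeast-suc k (suc j)) (atLeast-suc k j))))
      where
      expand : ∀ a b c x y {w} → a ≡ b + x → b ≡ c + y → y < x → w ≡ c + b + (b + a) → 4 * b < w
      expand _ _ c x y refl refl lt refl = lin 0 lt (ring c x y)
        where
        ring : ∀ c x y → c + (c + y) + (c + y + (c + y + x)) + suc y ≡ suc (4 * (c + y)) + x + 0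
        ring = solve-∀
      k≡ : k ≡ j + suc r
      k≡ = trans (sym (+-assoc t r r)) (trans (cong (_+ r) (sym e)) (sym (+-suc j r)))
      ratio : suc j * (1 * μ (level k (suc j))) ≡ suc r * (1 * μ (level k j))
      ratio = subst (λ k → suc j * (1 * μ (level k (suc j))) ≡ suc r * (1 * μ (level k j))) (sym k≡) (level-step′ j (suc r))
      level>0 : 1 ≤ μ (level k j)
      level>0 = μ-pos {k} {level k j} {ones k j} (trans (cong (_≡ᵇ j) (size-ones (≤-trans (m≤m+n j (suc r)) (≤-reflexive (sym k≡))))) (true-≡ᵇ j))
      smaller : μ (level k (suc j)) < μ (level k j)
      smaller = *-cancelˡ-< (suc j) _ _ (≤-<-trans (≤-reflexive (trans (cong (suc j *_) (sym (+-identityʳ _))) (trans ratio (cong (suc r *_) (+-identityʳ _)))))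
        (*-monoˡ-< (μ (level k j)) {{>-nonZero level>0}} (≤-trans (+-monoˡ-≤ r 2≤t) (≤-reflexive (sym e)))))

  -- Two ignored coordinates could be added to R with the threshold raised by one, giving more
  -- weight. The weight depends only on the size of R, so an initial segment `R⁺` of the new size
  -- serves.
  one-free-coordinate : ∀ {n} (G : Family n) → Opt t G → (R : V n) → ∀ r → size R ≡ t + (r + r) → (∀ v → G v ≡ (t + r ≤ᵇ int v R)) → zeros R ≤ 1
  one-free-coordinate {n} G o R r R≡ value with zeros R ≤? 1
  ... | yes h = h
  ... | no ¬h = ⊥-elim (<⇒≱ bigger (proj₂ o _ (threshold-int {r = suc r} R⁺ R⁺≡)))
    where
    f : ℕ
    f = zeros R ∸ 2
    f≡ : zeros R ≡ 2 + f
    f≡ = sym (m+[n∸m]≡n (≰⇒> ¬h))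
    n≡ : f + suc (suc (size R)) ≡ n
    n≡ = trans (trans (+-suc f _) (cong suc (+-suc f _))) (trans (cong (_+ size R) (sym f≡)) (zeros+size R))
    R⁺ : V n
    R⁺ = ones n (suc (suc (size R)))
    s⁺ : size R⁺ ≡ suc (suc (size R))
    s⁺ = size-ones (≤-trans (m≤n+m _ f) (≤-reflexive n≡))
    R⁺≡ : size R⁺ ≡ t + (suc r + suc r)
    R⁺≡ = trans s⁺ (trans (cong (λ s → suc (suc s)) R≡) (ring t r))
      where
      ring : ∀ t r → suc (suc (t + (r + r))) ≡ t + (suc r + suc r)
      ring = solve-∀
    z⁺ : zeros R⁺ ≡ f
    z⁺ = +-cancelʳ-≡ (size R⁺) _ f (trans (zeros+size R⁺) (trans (sym n≡) (cong (f +_) (sym s⁺))))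
    bigger : μ G < μ (λ v → t + suc r ≤ᵇ int v R⁺)
    bigger = begin-strict
      μ G                                                      ≡⟨ μ-cong value ⟩
      μ (λ v → t + r ≤ᵇ int v R)                               ≡⟨ weight R (t + r) ⟩
      2 ^ zeros R * atLeast (size R) (t + r)                   ≡⟨ cong₂ (λ x y → 2 ^ x * atLeast y (t + r)) f≡ R≡ ⟩
      2 ^ (2 + f) * atLeast (t + (r + r)) (t + r)              ≡⟨ ring (2 ^ f) (atLeast (t + (r + r)) (t + r)) ⟩
      2 ^ f * (4 * atLeast (t + (r + r)) (t + r))              <⟨ *-monoʳ-< (2 ^ f) {{>-nonZero (m^n>0 2 f)}} (more-is-better r) ⟩
      2 ^ f * atLeast (suc (suc (t + (r + r)))) (suc (t + r))  ≡⟨ cong₂ (λ x y → 2 ^ x * atLeast y (suc (t + r))) (sym z⁺) (sym (trans s⁺ (cong (λ s → suc (suc s)) R≡))) ⟩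
      2 ^ zeros R⁺ * atLeast (size R⁺) (suc (t + r))           ≡⟨ cong (λ x → 2 ^ zeros R⁺ * atLeast (size R⁺) x) (sym (+-suc t r)) ⟩
      2 ^ zeros R⁺ * atLeast (size R⁺) (t + suc r)             ≡⟨ sym (weight R⁺ (t + suc r)) ⟩
      μ (λ v → t + suc r ≤ᵇ int v R⁺)                          ∎
      where
      open ≤-Reasoning
      ring : ∀ x y → 2 * (2 * x) * y ≡ x * (4 * y)
      ring = solve-∀

few-free : ∀ {p q t} → p ≡ 1 → q ≡ 1 → 2 ≤ t → ∀ {n} (G : Family n) → Weighted.Opt p q t G → (R : V n) → ∀ r →
  size R ≡ t + (r + r) → (∀ v → G v ≡ (t + r ≤ᵇ int v R)) → zeros R ≤ 1
few-free {t = t} refl refl 2≤t = Uniform.one-free-coordinate t 2≤t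

size-full : ∀ n → size (ones n n) ≡ n
size-full n = size-ones ≤-refl

int-full : ∀ {n} (v : V n) → int v (ones n n) ≡ size v
int-full []      = refl
int-full (a ∷ v) = cong₂ (λ b x → ι b + x) (Bool.∧-identityʳ a) (int-full v)

full : ∀ {n} (v : V n) → zeros v ≡ 0 → v ≡ ones n n
full []         e = refl
full (true ∷ v) e = cong (true ∷_) (full v e)

double-injective : ∀ t r r′ → t + (r + r) ≡ t + (r′ + r′) → r ≡ r′
double-injective t r r′ e = *-cancelˡ-≡ r r′ 2
  (trans (cong (r +_) (+-identityʳ r)) (trans (+-cancelˡ-≡ t _ _ e) (sym (cong (r′ +_) (+-identityʳ r′)))))

shifted-pair : ∀ {n} (G : Family (suc (suc n))) → Shifted G → ∀ i z → G (pair-in i true false z) ≡ true → G (pair-in i false true z) ≡ true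
shifted-pair G (h , _ , _)  zero z g = h z g
shifted-pair {suc n} G (_ , st , _) (suc i) (true ∷ z)  g = shifted-pair (λ v → G (true ∷ v)) st i z g
shifted-pair {suc n} G (_ , _ , sf) (suc i) (false ∷ z) g = shifted-pair (λ v → G (false ∷ v)) sf i z g

pair-shifted : ∀ {n} (G : Family (suc (suc n))) → (∀ i z → G (pair-in i true false z) ≡ true → G (pair-in i false true z) ≡ true) → Shifted G
pair-shifted G h with find-unshifted G
... | inj₁ sh = sh
... | inj₂ (i , z , g , g′) = ⊥-elim (true≢false (h i z g) g′)

-- Optimal t-intersecting families

module Bits (p q t : ℕ) (1≤t : 1 ≤ t) (1≤p : 1 ≤ p) (p≤q : p ≤ q) where

  open Weighted p q
  1≤q : 1 ≤ q
  1≤q = ≤-trans 1≤p p≤q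
  open Positive 1≤p 1≤q

  -- The pivots in `I` become independent of the head by being added without it, at the price of
  -- deleting the sets with head over `J`.
  move : ∀ {n} → Family (suc n) → (I J : Family n) → Family (suc n)
  move G I J = swap G (withTrue J) (withFalse I)

  μ-withFalse : ∀ {n} (I : Family n) → μ (withFalse I) ≡ q * μ I
  μ-withFalse {n} I = trans (μ-split (withFalse I)) (trans (cong (λ x → q * μ I + p * x) (μ-zero {n} {λ _ → false} (λ _ → refl)))
    (trans (cong (q * μ I +_) (*-zeroʳ p)) (+-identityʳ _)))

  μ-withTrue : ∀ {n} (J : Family n) → μ (withTrue J) ≡ p * μ J
  μ-withTrue {n} J = trans (μ-split (withTrue J)) (trans (cong (λ x → q * x + p * μ J) (μ-zero {n} {λ _ → false} (λ _ → refl)))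
    (cong (_+ p * μ J) (*-zeroʳ q)))

  module _ {n : ℕ} {G : Family (suc n)} (I J : Family n)
    (hI : ∀ v → I v ≡ true → pivot G v ≡ true) (hJ : ∀ v → J v ≡ true → pivot G v ≡ true) where

    removed-in : ∀ v → withTrue J v ≡ true → G v ≡ true
    removed-in (true ∷ v) h = proj₁ (∧-true (hJ v h))

    added-out : ∀ v → withFalse I v ≡ true → G v ≡ false
    added-out (false ∷ v) h = not-true (proj₂ (∧-true {G (true ∷ v)} (hI v h)))

    -- An added set is a member of `G` stripped of its head. It can fail to meet only a set that has
    -- the head and whose headless form is absent, that is, a pivot.
    move-head : Opt t G → (∀ v → I v ≡ true → J v ≡ false) →
      (∀ v u → I v ≡ true → pivot G u ≡ true → J u ≡ false → t ≤ int v u) →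
      Int t (move G I J) × q * μ I ≤ p * μ J
    move-head o dis cond with exchange {t = t} {G = G} (withTrue J) (withFalse I) o removed-in added-out aa ag
      where
      aa : ∀ v u → withFalse I v ≡ true → withFalse I u ≡ true → t ≤ int v u
      aa (false ∷ v) (false ∷ u) hv hu = cond v u hv (hI u hu) (dis u hu)
      ag : ∀ v u → withFalse I v ≡ true → G u ≡ true → withTrue J u ≡ false → t ≤ int v u
      ag (false ∷ v) (false ∷ u) hv gu _ = proj₁ o _ _ (proj₁ (∧-true (hI v hv))) gu
      ag (false ∷ v) (true ∷ u)  hv gu ju with G (false ∷ u) in e
      ... | true  = proj₁ o _ _ (proj₁ (∧-true (hI v hv))) e
      ... | false = cond v u hv (true-∧ gu (cong not e)) ju
    ... | i , le = i , subst₂ _≤_ (μ-withFalse I) (μ-withTrue J) le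

    move-opt : Opt t G → Int t (move G I J) → p * μ J ≤ q * μ I → Opt t (move G I J)
    move-opt o i le = opt-≤ o i (lin 0 le (trans (cong (μ (move G I J) +_) (sym (μ-withTrue J)))
      (trans (μ-swap G (withTrue J) (withFalse I) removed-in added-out) (trans (cong (μ G +_) (μ-withFalse I)) (sym (+-identityʳ _))))))

  -- Pivots of a shifted optimal family

  module Pivots {N : ℕ} {G : Family (suc N)} (o : Opt t G) (sh : Shifted G) where

    C : Family N
    C = pivot G

    -- The head of v can be shifted into a common gap. The new member of `G` has no head, so the t
    -- common points with u all lie off the head.
    uncovered : ∀ v u → C v ≡ true → C u ≡ true → cover v u ≡ false → t ≤ int v u
    uncovered v u cv cu e with shift-into-gap G sh v u e (proj₁ (∧-true cv))
    ... | v′ , g , i = subst (t ≤_) i (proj₁ o _ _ g (proj₁ (∧-true cu)))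

    -- Two pivots that cannot both be made independent of the head have union everything and meet in t - 1 points.
    conflict : ∀ v u → C v ≡ true → C u ≡ true → int v u < t → suc (size v + size u) ≡ N + t
    conflict v u cv cu lt with cover v u in e
    ... | false = ⊥-elim (<⇒≱ lt (uncovered v u cv cu e))
    ... | true  = trans (cong suc (cover-size v u e)) (trans (sym (+-suc N (int v u)))
      (cong (N +_) (≤-antisym lt (proj₁ o _ _ (proj₁ (∧-true cv)) (proj₁ (∧-true cu))))))

    -- By `conflict` the sizes of two conflicting pivots add up to N + t - 1. A small pivot
    -- conflicts only with large ones, so freeing all small ones costs only the large ones, and
    -- conversely.
    low high : Family N
    low v  = C v ∧ (2 * size v + 2 ≤ᵇ N + t)
    high v = C v ∧ (N + t ≤ᵇ 2 * size v)

    lowC : ∀ v → low v ≡ true → C v ≡ true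
    lowC v h = proj₁ (∧-true h)

    highC : ∀ v → high v ≡ true → C v ≡ true
    highC v h = proj₁ (∧-true h)

    low≤ : ∀ v → low v ≡ true → 2 * size v + 2 ≤ N + t
    low≤ v h = ≤ᵇ-true (proj₂ (∧-true {C v} h))

    high≤ : ∀ v → high v ≡ true → N + t ≤ 2 * size v
    high≤ v h = ≤ᵇ-true (proj₂ (∧-true {C v} h))

    not-low : ∀ v → C v ≡ true → low v ≡ false → N + t < 2 * size v + 2
    not-low v c h = ≤ᵇ-false (trans (sym (cong (_∧ _) c)) h)

    not-high : ∀ v → C v ≡ true → high v ≡ false → 2 * size v < N + t
    not-high v c h = ≤ᵇ-false (trans (sym (cong (_∧ _) c)) h)

    low-high : ∀ v → low v ≡ true → high v ≡ false
    low-high v h with high v in e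
    ... | false = refl
    ... | true  = ⊥-elim (lin-absurd 1 (≤-trans (low≤ v h) (high≤ v e)) (arith (size v)))
      where
      arith : ∀ s → 2 * s + 2 ≡ suc (2 * s + 1)
      arith = solve-∀

    high-low : ∀ v → high v ≡ true → low v ≡ false
    high-low v h with low v in e
    ... | false = refl
    ... | true  = ⊥-elim (true≢false h (low-high v e))

    conflict-low : ∀ v u → low v ≡ true → C u ≡ true → high u ≡ false → t ≤ int v u
    conflict-low v u lv cu hu with t ≤? int v u
    ... | yes h = h
    ... | no  h = ⊥-elim (arith (size v) (size u) (conflict v u (lowC v lv) cu (≰⇒> h)) (low≤ v lv) (not-high u cu hu))
      where
      arith : ∀ x y {k} → suc (x + y) ≡ k → 2 * x + 2 ≤ k → 2 * y < k → ⊥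
      arith x y refl h₁ h₂ = lin-absurd 0 (+-mono-≤ h₁ h₂) (ring x y)
        where
        ring : ∀ x y → 2 * x + 2 + suc (2 * y) ≡ suc (suc (x + y) + suc (x + y) + 0)
        ring = solve-∀

    conflict-high : ∀ v u → high v ≡ true → C u ≡ true → low u ≡ false → t ≤ int v u
    conflict-high v u hv cu lu with t ≤? int v u
    ... | yes h = h
    ... | no  h = ⊥-elim (arith (size v) (size u) (conflict v u (highC v hv) cu (≰⇒> h)) (high≤ v hv) (not-low u cu lu))
      where
      arith : ∀ x y {k} → suc (x + y) ≡ k → k ≤ 2 * x → k < 2 * y + 2 → ⊥
      arith x y refl h₁ h₂ = lin-absurd 0 (+-mono-≤ h₁ h₂) (ring x y)
        where
        ring : ∀ x y → suc (x + y) + suc (suc (x + y)) ≡ suc (2 * x + (2 * y + 2) + 0)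
        ring = solve-∀

    move-low : Int t (move G low high) × q * μ low ≤ p * μ high
    move-low = move-head low high lowC highC o low-high conflict-low

    move-high : Int t (move G high low) × q * μ high ≤ p * μ low
    move-high = move-head high low highC lowC o high-low conflict-high

    mid : ∀ v → C v ≡ true → low v ≡ false → high v ≡ false → suc (2 * size v) ≡ N + t
    mid v c l h = ≤-antisym (not-high v c h) (s≤s⁻¹ (≤-trans (not-low v c l) (≤-reflexive (+-comm (2 * size v) 2))))

    -- The two exchanges bound the weights of `low` and `high` by each other, both times with the
    -- factor p/q < 1.
    low-high-empty : p < q → (∀ v → low v ≡ false) × (∀ v → high v ≡ false)
    low-high-empty p<q = μ≡0 {G = low} (zero-of low {high} (proj₂ move-low) (proj₂ move-high)) ,
      μ≡0 {G = high} (zero-of high {low} (proj₂ move-high) (proj₂ move-low))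
      where
      strict : ∀ x y → q * x ≤ p * y → q * y ≤ p * x → x ≡ 0
      strict zero    y       _ _ = refl
      strict (suc x) zero    h₁ h₂ = ⊥-elim (<⇒≱ (*-mono-≤ 1≤q (s≤s z≤n)) (≤-trans h₁ (≤-reflexive (*-zeroʳ p))))
      strict (suc x) (suc y) h₁ h₂ with ≤-total x y
      ... | inj₁ x≤y = ⊥-elim (<⇒≱ (<-≤-trans (*-monoˡ-< (suc x) p<q) (*-monoʳ-≤ q (s≤s x≤y))) h₂)
      ... | inj₂ y≤x = ⊥-elim (<⇒≱ (<-≤-trans (*-monoˡ-< (suc y) p<q) (*-monoʳ-≤ q (s≤s y≤x))) h₁)
      zero-of : ∀ I {J : Family N} → q * μ I ≤ p * μ J → q * μ J ≤ p * μ I → μ I ≡ 0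
      zero-of I {J} = strict (μ I) (μ J)

    -- Averaging, over the points k, the exchange that frees the pivots missing k.
    pivot-density : ∀ {a r} → N ≡ a + r → (∀ v → C v ≡ true → size v ≡ a) → (∃ λ v → C v ≡ true) → q * r ≤ p * a
    pivot-density {a} {r} refl sz (v₀ , c₀) = *-cancelʳ-≤ (q * r) (p * a) (μ C) {{>-nonZero (μ-pos {G = C} c₀)}}
      (subst₂ _≤_ (total q (λ v k → not (lookup v k)) r count-I) (total p lookup a count-J) (∑-mono (allFin N) single))
      where
      I J : Fin N → Family N
      I k v = C v ∧ not (lookup v k)
      J k v = C v ∧ lookup v k
      single : ∀ k → q * μ (I k) ≤ p * μ (J k)
      -- Two pivots that both miss k have a gap in common, hence no conflict.
      single k = proj₂ (move-head (I k) (J k) (λ v h → proj₁ (∧-true h)) (λ v h → proj₁ (∧-true h)) o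
        (λ v h → trans (cong (C v ∧_) (not-true (proj₂ (∧-true {C v} h)))) (Bool.∧-zeroʳ (C v)))
        (λ v u hv cu ju → uncovered v u (proj₁ (∧-true hv)) cu
          (cover-gap v u k (not-true (proj₂ (∧-true {C v} hv))) (trans (sym (cong (_∧ lookup u k) cu)) ju))))
      count-J : ∀ v → C v ≡ true → ∑ (allFin N) (λ k → ι (lookup v k)) ≡ a
      count-J v c = trans (∑-lookup v) (sz v c)
      count-I : ∀ v → C v ≡ true → ∑ (allFin N) (λ k → ι (not (lookup v k))) ≡ r
      count-I v c = +-cancelʳ-≡ a _ r (trans (cong (∑ (allFin N) (λ k → ι (not (lookup v k))) +_) (sym (sz v c)))
        (trans (∑-not-lookup v) (+-comm a r)))
      row : ∀ (f : V N → Fin N → Bool) y → (∀ v → C v ≡ true → ∑ (allFin N) (λ k → ι (f v k)) ≡ y) →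
        ∀ v → ∑ (allFin N) (λ k → ι (C v ∧ f v k) * wt v) ≡ y * (ι (C v) * wt v)
      row f y h v with C v | h v
      ... | false | _ = trans (∑-zero (allFin N)) (sym (*-zeroʳ y))
      ... | true  | e = trans (∑-cong (allFin N) (λ k → *-comm (ι (f v k)) (wt v)))
        (trans (∑-*ˡ (allFin N) (wt v) _) (trans (cong (wt v *_) (e refl)) (trans (*-comm (wt v) y) (cong (y *_) (sym (+-identityʳ (wt v)))))))
      total : ∀ x (f : V N → Fin N → Bool) y → (∀ v → C v ≡ true → ∑ (allFin N) (λ k → ι (f v k)) ≡ y) →
        ∑ (allFin N) (λ k → x * μ (λ v → C v ∧ f v k)) ≡ x * y * μ C
      total x f y h = trans (∑-*ˡ (allFin N) x _) (trans (cong (x *_)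
        (trans (∑-swap (allFin N) (B N) _) (trans (∑-cong (B N) (row f y h)) (∑-*ˡ (B N) y _)))) (sym (*-assoc x y (μ C))))

  -- Exchanges between a coordinate and a block of interchangeable ones

  levelWeight : ∀ {κ} → ℕ → ℕ
  levelWeight {κ} b = p * μ (level κ b)

  levelWeight>0 : ∀ {κ b} → b ≤ κ → 1 ≤ levelWeight {κ} b
  levelWeight>0 {κ} {b} h = *-mono-≤ 1≤p (μ-pos {G = level κ b} {x = ones κ b} (trans (cong (_≡ᵇ b) (size-ones h)) (true-≡ᵇ b)))

  scaled : ∀ {κ b b′ d x y} → κ ≡ b′ + d → levelWeight {κ} b * x ≤ q * μ (level κ (suc b′)) * y →
    suc b′ * (levelWeight {κ} b * x) ≤ d * (levelWeight {κ} b′ * y)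
  scaled {b = b} {b′} {d} {x} {y} refl h = ≤-trans (*-monoʳ-≤ (suc b′) h) (≤-reflexive
    (trans (sym (*-assoc (suc b′) (q * μ (level (b′ + d) (suc b′))) y)) (trans (cong (_* y) (level-step′ b′ d)) (*-assoc d (levelWeight {b′ + d} b′) y))))

  -- Vectors are split into a context, one distinguished coordinate, and a block of which only the
  -- size matters. The aim is to let the distinguished coordinate join the block.
  module Block {c κ : ℕ} {G : Family (c + suc κ)}
    (o : Opt t G) (sh : Shifted G)
    (symmetric : ∀ C k (v v′ : V κ) → size v ≡ size v′ → G (C ⧺ k ∷ v) ≡ G (C ⧺ k ∷ v′)) where

    g : Bool → ℕ → Family c
    g k j C = G (C ⧺ k ∷ ones κ j)

    G≡g : ∀ C k v → G (C ⧺ k ∷ v) ≡ g k (size v) C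
    G≡g C k v = symmetric C k v (ones κ (size v)) (sym (size-ones (size≤ v)))

    g⇒G : ∀ {C k j v} → size v ≡ j → g k j C ≡ true → G (C ⧺ k ∷ v) ≡ true
    g⇒G {C} {k} {v = v} refl e = trans (G≡g C k v) e

    g-int : ∀ {C k j C′ k′ j′} → j ≤ κ → j′ ≤ κ → g k j C ≡ true → g k′ j′ C′ ≡ true →
      t ≤ int C C′ + (ι (k ∧ k′) + ((j + j′) ∸ κ))
    g-int {C} {k} {j} {C′} {k′} {j′} j≤ j′≤ e e′ with least-int κ j j′ j≤ j′≤
    ... | v , u , sv , su , i = subst (λ x → t ≤ int C C′ + (ι (k ∧ k′) + x)) i
      (≤-trans (proj₁ o _ _ (g⇒G {k = k} sv e) (g⇒G {k = k′} su e′)) (≤-reflexive (int-⧺ C C′ (k ∷ v) (k′ ∷ u))))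

    -- The contexts C in which an element of the block cannot be exchanged for the distinguished one.
    X : ℕ → Family c
    X b C = (suc b ≤ᵇ κ) ∧ (g false (suc b) C ∧ not (g true b C))

    X-size : ∀ {b C} → X b C ≡ true → suc b ≤ κ
    X-size e = ≤ᵇ-true (proj₁ (∧-true e))

    X-in : ∀ {b C} → X b C ≡ true → g false (suc b) C ≡ true
    X-in {b} {C} e = proj₁ (∧-true {g false (suc b) C} (proj₂ (∧-true {suc b ≤ᵇ κ} e)))

    X-out : ∀ {b C} → X b C ≡ true → g true b C ≡ false
    X-out {b} {C} e = not-true (proj₂ (∧-true {g false (suc b) C} (proj₂ (∧-true {suc b ≤ᵇ κ} e))))

    X-intro : ∀ {b C} → suc b ≤ κ → g false (suc b) C ≡ true → g true b C ≡ false → X b C ≡ true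
    X-intro h e f = true-∧ (true-≤ᵇ h) (true-∧ e (cong not f))

    -- The only configuration in which trading a block element for the distinguished coordinate can
    -- destroy the t-th common point, as `pair` shows.
    Conflict : ℕ → V c → ℕ → V c → Set
    Conflict b C b′ C′ = int C C′ ≡ 0 × b + b′ + 2 ≡ κ + t

    -- If the contexts share a point, shifting it onto the distinguished coordinate gives a member
    -- of `G` with one context point less, and its intersections yield the bound. If they share
    -- none, the bound can fail by one only, which fixes b + b′.
    pair : ∀ {b C b′ C′} → X b C ≡ true → X b′ C′ ≡ true →
      (t ≤ int C C′ + ((suc b + b′) ∸ κ)) ⊎ Conflict b C b′ C′
    pair {b} {C} {b′} {C′} x x′ with t ≤? int C C′ + ((suc b + b′) ∸ κ)
    ... | yes h = inj₁ h
    ... | no ¬h with int C C′ in ie | g-int {k = false} {k′ = false} (X-size x) (X-size x′) (X-in x) (X-in x′)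
    ...   | zero  | h = inj₂ (refl , arith (b + b′) κ (≰⇒> ¬h) (subst (λ y → t ≤ y ∸ κ) (cong suc (+-suc b b′)) h))
      where
      arith : ∀ s κ → suc s ∸ κ < t → t ≤ suc (suc s) ∸ κ → s + 2 ≡ κ + t
      arith s zero    h₁ h₂ = trans (+-comm s 2) (≤-antisym h₁ h₂)
      arith s (suc zero) h₁ h₂ = trans (+-comm s 2) (cong suc (≤-antisym h₁ h₂))
      arith zero (suc (suc κ)) h₁ h₂ = ⊥-elim (<⇒≱ h₁ (≤-trans h₂ (≤-trans (≤-reflexive (0∸n≡0 κ)) z≤n)))
      arith (suc s) (suc (suc κ)) h₁ h₂ = cong suc (arith s (suc κ) h₁ h₂)
    ...   | suc i | h with least-int κ (suc b) (suc b′) (X-size x) (X-size x′)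
    ...     | v , u , sv , su , iv with shift-common-past G sh C C′ v (≤-trans (s≤s z≤n) (≤-reflexive (sym ie))) (g⇒G {k = false} sv (X-in x))
    ...       | C⁻ , e , g⁻ = ⊥-elim (¬h (arith (trans e ie) (≤-trans (proj₁ o _ _ g⁻ (g⇒G {k = false} su (X-in x′)))
        (≤-reflexive (trans (int-⧺ C⁻ C′ (true ∷ v) (false ∷ u)) (cong (int C⁻ C′ +_) iv))))))
      where
      step : ∀ s κ → suc s ∸ κ ≤ suc (s ∸ κ)
      step s       zero          = ≤-refl
      step zero    (suc κ)       = ≤-trans (≤-reflexive (0∸n≡0 κ)) z≤n
      step (suc s) (suc κ)       = step s κ
      arith : ∀ {m} → suc m ≡ suc i → t ≤ m + ((suc b + suc b′) ∸ κ) → t ≤ suc i + ((suc b + b′) ∸ κ)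
      arith refl h = ≤-trans h (≤-trans (+-monoʳ-≤ i (≤-trans (≤-reflexive (cong (_∸ κ) (+-suc (suc b) b′))) (step (suc b + b′) κ)))
        (≤-reflexive (+-suc i _)))

    size-int : ∀ (v u : V κ) → (size v + size u) ∸ κ ≤ int v u
    size-int v u = ≤-trans (∸-monoˡ-≤ κ (size+size≤ v u)) (≤-reflexive (m+n∸m≡n κ (int v u)))

    module _ (b : ℕ) (I : Family c) (b′ : ℕ) (J : Family c)
      (I⊆X : ∀ C → I C ≡ true → X b C ≡ true) (J⊆X : ∀ C → J C ≡ true → X b′ C ≡ true)
      (independent : ∀ C C′ → I C ≡ true → I C′ ≡ true → Conflict b C b C′ → ⊥)
      (removed : ∀ C b″ C′ → I C ≡ true → X b″ C′ ≡ true → Conflict b C b″ C′ → b″ ≡ b′ × J C′ ≡ true) where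

      addBlock remBlock : V c → Family (suc κ)
      addBlock C (true ∷ v)  = I C ∧ (size v ≡ᵇ b)
      addBlock C (false ∷ v) = false
      remBlock C (true ∷ v)  = false
      remBlock C (false ∷ v) = J C ∧ (size v ≡ᵇ suc b′)

      -- Over `I` a block element is traded for the distinguished coordinate, and sets over `J` are
      -- given up. Another member of `G` without the distinguished coordinate either has its own
      -- traded form in `G`, which forces the missing common point, or is obstructed, and then
      -- `pair` applies.
      block-exchange : p * μ (level κ b) * μ I ≤ q * μ (level κ (suc b′)) * μ J
      block-exchange = subst₂ _≤_ weigh-add weigh-rem
        (proj₂ (exchange {t = t} {G = G} (lift c remBlock) (lift c addBlock) o (by-split rem) (by-split add) (by-split₂ aa) (by-split₂ ag)))
        where
        by-split : {P : V (c + suc κ) → Set} → (∀ C k v → P (C ⧺ k ∷ v)) → ∀ w → P w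
        by-split f w with splitAt c w
        ... | C , k ∷ v , refl = f C k v
        by-split₂ : {P : V (c + suc κ) → V (c + suc κ) → Set} → (∀ C k v C′ k′ v′ → P (C ⧺ k ∷ v) (C′ ⧺ k′ ∷ v′)) → ∀ w w′ → P w w′
        by-split₂ {P} f = by-split {λ w → ∀ w′ → P w w′} (λ C k v → by-split {P (C ⧺ k ∷ v)} (f C k v))
        rem : ∀ C k v → lift c remBlock (C ⧺ k ∷ v) ≡ true → G (C ⧺ k ∷ v) ≡ true
        rem C k v h rewrite lift-⧺ remBlock C (k ∷ v) with k | h
        ... | false | h = g⇒G {k = false} (≡ᵇ-true (proj₂ (∧-true {J C} h))) (X-in (J⊆X C (proj₁ (∧-true h))))
        add : ∀ C k v → lift c addBlock (C ⧺ k ∷ v) ≡ true → G (C ⧺ k ∷ v) ≡ false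
        add C k v h rewrite lift-⧺ addBlock C (k ∷ v) with k | h
        ... | true | h = trans (G≡g C true v) (trans (cong (λ j → g true j C) (≡ᵇ-true (proj₂ (∧-true {I C} h)))) (X-out (I⊆X C (proj₁ (∧-true h)))))
        aa : ∀ C k v C′ k′ v′ → lift c addBlock (C ⧺ k ∷ v) ≡ true → lift c addBlock (C′ ⧺ k′ ∷ v′) ≡ true →
          t ≤ int (C ⧺ k ∷ v) (C′ ⧺ k′ ∷ v′)
        aa C k v C′ k′ v′ h h′ rewrite lift-⧺ addBlock C (k ∷ v) | lift-⧺ addBlock C′ (k′ ∷ v′) with k | k′ | h | h′
        ... | true | true | h | h′ with pair (I⊆X C (proj₁ (∧-true h))) (I⊆X C′ (proj₁ (∧-true h′)))
        ...   | inj₂ x = ⊥-elim (independent C C′ (proj₁ (∧-true h)) (proj₁ (∧-true h′)) x)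
        ...   | inj₁ x = ≤-trans x (≤-trans (+-monoʳ-≤ (int C C′) enough) (≤-reflexive (sym (int-⧺ C C′ (true ∷ v) (true ∷ v′)))))
          where
          enough : (suc b + b) ∸ κ ≤ suc (int v v′)
          enough = subst₂ (λ x y → (suc x + y) ∸ κ ≤ suc (int v v′)) (≡ᵇ-true {size v} (proj₂ (∧-true {I C} h))) (≡ᵇ-true {size v′} (proj₂ (∧-true {I C′} h′)))
            (≤-trans (∸-monoˡ-≤ κ (≤-trans (s≤s (size+size≤ v v′)) (≤-reflexive (sym (+-suc κ (int v v′)))))) (≤-reflexive (m+n∸m≡n κ (suc (int v v′)))))
        ag : ∀ C k v C′ k′ v′ → lift c addBlock (C ⧺ k ∷ v) ≡ true → G (C′ ⧺ k′ ∷ v′) ≡ true →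
          lift c remBlock (C′ ⧺ k′ ∷ v′) ≡ false → t ≤ int (C ⧺ k ∷ v) (C′ ⧺ k′ ∷ v′)
        ag C k v C′ k′ v′ h gu r rewrite lift-⧺ addBlock C (k ∷ v) | lift-⧺ remBlock C′ (k′ ∷ v′) with k | h
        ... | true | h = ≤-trans (meets k′ (trans (sym (G≡g C′ k′ v′)) gu) r) (≤-reflexive (sym (int-⧺ C C′ (true ∷ v) (k′ ∷ v′))))
          where
          IC : I C ≡ true
          IC = proj₁ (∧-true h)
          sv : size v ≡ b
          sv = ≡ᵇ-true (proj₂ (∧-true {I C} h))
          C∈X : X b C ≡ true
          C∈X = I⊆X C IC
          meets : ∀ k′ → g k′ (size v′) C′ ≡ true → remBlock C′ (k′ ∷ v′) ≡ false → t ≤ int C C′ + (ι k′ + int v v′)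
          meets true gu _ = ≤-trans (g-int {k = false} {k′ = true} (X-size C∈X) (size≤ v′) (X-in C∈X) gu) (+-monoʳ-≤ (int C C′)
            (subst (λ x → (suc x + size v′) ∸ κ ≤ suc (int v v′)) sv
            (≤-trans (∸-monoˡ-≤ κ (≤-trans (s≤s (size+size≤ v v′)) (≤-reflexive (sym (+-suc κ (int v v′)))))) (≤-reflexive (m+n∸m≡n κ (suc (int v v′)))))))
          meets false gu r with size v′ in sv′
          -- An empty block has no element to trade, but the least overlap with it is zero.
          ... | zero = ≤-trans (g-int {k = false} {k′ = false} (X-size C∈X) z≤n (X-in C∈X) gu) (+-monoʳ-≤ (int C C′)
            (≤-trans (≤-reflexive (m≤n⇒m∸n≡0 (≤-trans (≤-reflexive (+-identityʳ (suc b))) (X-size C∈X)))) z≤n))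
          ... | suc b″ with g true b″ C′ in gt
          ...   | true = ≤-trans (g-int {k = false} {k′ = true} (X-size C∈X) (≤-trans (n≤1+n b″) b″<κ) (X-in C∈X) gt) (+-monoʳ-≤ (int C C′) meeting)
            where
            b″<κ : suc b″ ≤ κ
            b″<κ = subst (_≤ κ) sv′ (size≤ v′)
            meeting : (suc b + b″) ∸ κ ≤ int v v′
            meeting = subst (λ x → x ∸ κ ≤ int v v′) (trans (cong₂ _+_ sv sv′) (+-suc b b″)) (size-int v v′)
          ...   | false with pair C∈X (X-intro (subst (_≤ κ) sv′ (size≤ v′)) gu gt)
          ...     | inj₁ x = ≤-trans x (+-monoʳ-≤ (int C C′) (subst (λ x → x ∸ κ ≤ int v v′) (trans (cong₂ _+_ sv sv′) (+-suc b b″)) (size-int v v′)))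
          ...     | inj₂ x with removed C b″ C′ IC (X-intro (subst (_≤ κ) sv′ (size≤ v′)) gu gt) x
          ...       | refl , j = ⊥-elim (true≢false (true-∧ j (true-≡ᵇ b″)) r)
        weigh-add : μ (lift c addBlock) ≡ p * μ (level κ b) * μ I
        weigh-add = trans (μ-⧺ c (lift c addBlock) I H (λ C v → trans (lift-⧺ addBlock C v) (eq C v))) (cong (_* μ I) weigh-H)
          where
          H : Family (suc κ)
          H (true ∷ v)  = size v ≡ᵇ b
          H (false ∷ v) = false
          eq : ∀ C v → addBlock C v ≡ I C ∧ H v
          eq C (true ∷ v)  = refl
          eq C (false ∷ v) = sym (Bool.∧-zeroʳ (I C))
          weigh-H : μ H ≡ p * μ (level κ b)
          weigh-H = trans (μ-split H) (trans (cong (λ x → q * x + p * μ (level κ b)) (μ-zero {κ} {λ _ → false} (λ _ → refl))) (cong (_+ p * μ (level κ b)) (*-zeroʳ q)))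
        weigh-rem : μ (lift c remBlock) ≡ q * μ (level κ (suc b′)) * μ J
        weigh-rem = trans (μ-⧺ c (lift c remBlock) J H (λ C v → trans (lift-⧺ remBlock C v) (eq C v))) (cong (_* μ J) weigh-H)
          where
          H : Family (suc κ)
          H (true ∷ v)  = false
          H (false ∷ v) = size v ≡ᵇ suc b′
          eq : ∀ C v → remBlock C v ≡ J C ∧ H v
          eq C (true ∷ v)  = sym (Bool.∧-zeroʳ (J C))
          eq C (false ∷ v) = refl
          weigh-H : μ H ≡ q * μ (level κ (suc b′))
          weigh-H = trans (μ-split H) (trans (cong (λ x → q * μ (level κ (suc b′)) + p * x) (μ-zero {κ} {λ _ → false} (λ _ → refl)))
            (trans (cong (q * μ (level κ (suc b′)) +_) (*-zeroʳ p)) (+-identityʳ _)))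

  module NoObstruction (2≤t : 2 ≤ t) {c κ : ℕ} {G : Family (c + suc κ)}
    (o : Opt t G) (sh : Shifted G)
    (symmetric : ∀ C k (v v′ : V κ) → size v ≡ size v′ → G (C ⧺ k ∷ v) ≡ G (C ⧺ k ∷ v′)) where

    open Block {c} {κ} {G} o sh symmetric

    -- For b ≠ b′ there is no conflict inside level b, so all of `X b` is traded at once, at the
    -- cost of `X b′`.
    opposite : ∀ b b′ → b + b′ + 2 ≡ κ + t → (b + b + 2 ≡ κ + t → ⊥) → levelWeight {κ} b * μ (X b) ≤ q * μ (level κ (suc b′)) * μ (X b′)
    opposite b b′ e ne = block-exchange b (X b) b′ (X b′) (λ _ h → h) (λ _ h → h)
      (λ _ _ _ _ (_ , f) → ne f)
      (λ _ b″ _ _ x (_ , f) → same b″ f , subst (λ z → X z _ ≡ true) (same b″ f) x)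
      where
      same : ∀ b″ → b + b″ + 2 ≡ κ + t → b″ ≡ b′
      same b″ f = +-cancelˡ-≡ b b″ b′ (+-cancelʳ-≡ 2 (b + b″) (b + b′) (trans f (sym e)))

    -- Off balance, the levels b and b′ = κ + t - 2 - b are exchanged for each other in both
    -- directions. As t ≥ 2 gives κ - b ≤ b′ and κ - b′ ≤ b, the two inequalities are incompatible.
    balanced : ∀ {b C} → X b C ≡ true → b + b + 2 ≡ κ + t
    balanced {b} {C} x with b + b + 2 ≟ κ + t
    ... | yes e = e
    ... | no ne = ⊥-elim (crossed (b′ <? κ))
      where
      b<κ : suc b ≤ κ
      b<κ = X-size {b} {C} x
      b+2≤ : b + 2 ≤ κ + t
      b+2≤ = ≤-trans (≤-reflexive (+-suc b 1)) (+-mono-≤ {suc b} {κ} {1} b<κ (≤-trans (s≤s z≤n) 2≤t))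
      b′ : ℕ
      b′ = (κ + t) ∸ (b + 2)
      e : b + b′ + 2 ≡ κ + t
      e = trans (rearrange b b′) (m+[n∸m]≡n b+2≤)
        where
        rearrange : ∀ b b′ → b + b′ + 2 ≡ b + 2 + b′
        rearrange = solve-∀
      e′ : b′ + b + 2 ≡ κ + t
      e′ = trans (cong (_+ 2) (+-comm b′ b)) e
      ne′ : b′ + b′ + 2 ≡ κ + t → ⊥
      ne′ f = ne (subst (λ z → z + z + 2 ≡ κ + t) (+-cancelʳ-≡ b′ b′ b (+-cancelʳ-≡ 2 (b′ + b′) (b + b′) (trans f (sym e)))) f)
      P>0 : 1 ≤ levelWeight {κ} b * μ (X b)
      P>0 = *-mono-≤ (levelWeight>0 (≤-trans (n≤1+n b) b<κ)) (μ-pos {G = X b} x)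
      crossed : Dec (b′ < κ) → ⊥
      -- For b′ outside the block nothing has to be given up, so a positive weight would be gained
      -- for free.
      crossed (no ¬b′<κ) = <⇒≱ P>0 (≤-trans (opposite b b′ e ne) (≤-reflexive (trans
        (cong (q * μ (level κ (suc b′)) *_) (μ-zero {c} {X b′} empty)) (*-zeroʳ (q * μ (level κ (suc b′)))))))
        where
        empty : ∀ D → X b′ D ≡ false
        empty D with X b′ D in eD
        ... | false = refl
        ... | true  = ⊥-elim (¬b′<κ (X-size {b′} {D} eD))
      crossed (yes b′<κ) = arith b b′ (levelWeight {κ} b * μ (X b)) (levelWeight {κ} b′ * μ (X b′)) P>0
          (≤-trans (scaled κ≡′ (opposite b b′ e ne)) (*-monoˡ-≤ _ d′≤b))
          (≤-trans (scaled κ≡ (opposite b′ b e′ ne′)) (*-monoˡ-≤ _ d≤b′))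
        where
        κ≡ : κ ≡ b + (κ ∸ b)
        κ≡ = sym (m+[n∸m]≡n (≤-trans (n≤1+n b) b<κ))
        κ≡′ : κ ≡ b′ + (κ ∸ b′)
        κ≡′ = sym (m+[n∸m]≡n (≤-trans (n≤1+n b′) b′<κ))
        compl : ∀ b b′ d → b + b′ + 2 ≡ κ + t → κ ≡ b + d → d ≤ b′
        compl b b′ d e refl = ring b b′ d t e 2≤t
          where
          ring : ∀ b b′ d t → b + b′ + 2 ≡ b + d + t → 2 ≤ t → d ≤ b′
          ring b b′ d t e h = lin 0 (+-mono-≤ (≤-reflexive (sym e)) h) (ring′ b b′ d t)
            where
            ring′ : ∀ b b′ d t → b′ + (b + d + t + 2) ≡ d + (b + b′ + 2 + t) + 0
            ring′ = solve-∀
        d≤b′ : κ ∸ b ≤ b′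
        d≤b′ = compl b b′ _ e κ≡
        d′≤b : κ ∸ b′ ≤ b
        d′≤b = compl b′ b _ e′ κ≡′
        arith : ∀ b b′ P Q → 1 ≤ P → suc b′ * P ≤ b * Q → suc b * Q ≤ b′ * P → ⊥
        arith b b′ P Q h h₁ h₂ = <⇒≱ h (lin {A = suc b * (suc b′ * P) + b * (suc b * Q)} {B = suc b * (b * Q) + b * (b′ * P)} (b * P + b′ * P) (+-mono-≤ (*-monoʳ-≤ (suc b) h₁) (*-monoʳ-≤ b h₂)) (ring b b′ P Q))
          where
          ring : ∀ b b′ P Q → 0 + (suc b * (suc b′ * P) + b * (suc b * Q)) ≡ P + (suc b * (b * Q) + b * (b′ * P)) + (b * P + b′ * P)
          ring = solve-∀

  module NoObstructionBelow (2≤t : 2 ≤ t) {c κ : ℕ} {G : Family (suc c + suc κ)}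
    (o : Opt t G) (sh : Shifted G)
    (symmetric : ∀ (C : V (suc c)) k (v v′ : V κ) → size v ≡ size v′ → G (C ⧺ k ∷ v) ≡ G (C ⧺ k ∷ v′))
    {a r : ℕ} (a≡ : suc a ≡ t + r) (n≡ : suc c + suc κ + t ≡ 2 * suc a) (density : q * r ≤ p * a) (hp : HeadPivot G a) where

    open Block {suc c} {κ} {G} o sh symmetric

    module _ {b : ℕ} (bal : b + b + 2 ≡ κ + t) (b<κ : suc b ≤ κ) where

      -- The contexts, split by the first coordinate: those obstructed for either value of it, only for 1, only for 0.
      both good bad : Family c
      both D = X b (false ∷ D) ∧ X b (true ∷ D)
      good D = not (X b (false ∷ D)) ∧ X b (true ∷ D)
      bad D  = X b (false ∷ D) ∧ not (X b (true ∷ D))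

      -- If D′ is obstructed for the value 0 only, then monotonicity in the head and the missing
      -- obstruction at 1 put its traded form with head 1 into `G`. With D disjoint from D′ this set
      -- would share only t - 1 points with a member over D.
      bad-meets : ∀ {D D′} → bad D′ ≡ true → X b (false ∷ D) ≡ true → int D D′ ≡ 0 → ⊥
      bad-meets {D} {D′} bd x i0 = decide (g true b (true ∷ D′)) refl
        where
        arith : ∀ t b κ → b + b + 2 ≡ κ + t → 1 ≤ t → suc ((suc b + b) ∸ κ) ≡ t
        arith (suc t) b κ e _ = cong suc (trans (cong (_∸ κ) (suc-injective (trans (sym (+-comm (b + b) 2)) (trans e (+-suc κ t))))) (m+n∸m≡n κ t))
        decide : ∀ y → g true b (true ∷ D′) ≡ y → ⊥
        decide false gt = true≢false (X-intro {b} {true ∷ D′} b<κ (opt-up o _ (X-in {b} {false ∷ D′} (proj₁ (∧-true bd)))) gt)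
          (not-true (proj₂ (∧-true {X b (false ∷ D′)} bd)))
        decide true gt = <⇒≱ (≤-reflexive (arith t b κ bal (≤-trans (s≤s z≤n) 2≤t)))
          (subst (λ z → t ≤ z + ((suc b + b) ∸ κ)) i0
            (g-int {C = false ∷ D} {false} {suc b} {true ∷ D′} {true} {b} b<κ (≤-trans (n≤1+n b) b<κ) (X-in {b} {false ∷ D} x) gt))

      sameLevel : ∀ b″ → b + b″ + 2 ≡ κ + t → b″ ≡ b
      sameLevel b″ f = +-cancelˡ-≡ b b″ b (+-cancelʳ-≡ 2 (b + b″) (b + b) (trans f (sym bal)))

      -- Contexts with first coordinate 1 never conflict with each other, and by `bad-meets` bad
      -- ones never conflict with those obstructed for the value 0. This admits two exchanges, whose
      -- inequalities are the input of `balance`.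
      I₁ J₁ I₂ J₂ : Family (suc c)
      I₁ (true ∷ D)  = both D
      I₁ (false ∷ D) = bad D
      J₁ (true ∷ D)  = good D
      J₁ (false ∷ D) = both D
      I₂ (true ∷ D)  = X b (true ∷ D)
      I₂ (false ∷ D) = false
      J₂ (true ∷ D)  = false
      J₂ (false ∷ D) = X b (false ∷ D)

      exchange₁ : levelWeight {κ} b * μ I₁ ≤ q * μ (level κ (suc b)) * μ J₁
      exchange₁ = block-exchange b I₁ b J₁ I⊆ J⊆ ind rem
        where
        I⊆ : ∀ C → I₁ C ≡ true → X b C ≡ true
        I⊆ (true ∷ D)  h = proj₂ (∧-true {X b (false ∷ D)} h)
        I⊆ (false ∷ D) h = proj₁ (∧-true {X b (false ∷ D)} h)
        J⊆ : ∀ C → J₁ C ≡ true → X b C ≡ true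
        J⊆ (true ∷ D)  h = proj₂ (∧-true {not (X b (false ∷ D))} h)
        J⊆ (false ∷ D) h = proj₁ (∧-true {X b (false ∷ D)} h)
        false∈ : ∀ {D} C → I₁ C ≡ true → C ≡ true ∷ D ⊎ C ≡ false ∷ D → X b (false ∷ D) ≡ true
        false∈ (true ∷ D)  h (inj₁ refl) = proj₁ (∧-true {X b (false ∷ D)} h)
        false∈ (false ∷ D) h (inj₂ refl) = proj₁ (∧-true {X b (false ∷ D)} h)
        ind : ∀ C C′ → I₁ C ≡ true → I₁ C′ ≡ true → Conflict b C b C′ → ⊥
        ind (true ∷ D)  (true ∷ D′)  h h′ (() , _)
        ind (true ∷ D)  (false ∷ D′) h h′ (i , _) = bad-meets h′ (false∈ (true ∷ D) h (inj₁ refl)) i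
        ind (false ∷ D) (b′ ∷ D′)    h h′ (i , _) = bad-meets h (false∈ (b′ ∷ D′) h′ (which b′)) (trans (int-comm D′ D) i)
          where
          which : ∀ b′ → b′ ∷ D′ ≡ true ∷ D′ ⊎ b′ ∷ D′ ≡ false ∷ D′
          which true  = inj₁ refl
          which false = inj₂ refl
        rem : ∀ C b″ C′ → I₁ C ≡ true → X b″ C′ ≡ true → Conflict b C b″ C′ → b″ ≡ b × J₁ C′ ≡ true
        rem C b″ C′ h x (i , f) with sameLevel b″ f
        rem (true ∷ D) _ (true ∷ D′) h x (() , f) | refl
        rem (a ∷ D) _ (false ∷ D′) h x (i , f) | refl with X b (true ∷ D′) in e
        ... | true  = refl , true-∧ x refl
        ... | false = ⊥-elim (bad-meets {D} {D′} (true-∧ x (cong not e)) (false∈ (a ∷ D) h (which a)) (int0 a i))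
          where
          which : ∀ a → a ∷ D ≡ true ∷ D ⊎ a ∷ D ≡ false ∷ D
          which true  = inj₁ refl
          which false = inj₂ refl
          int0 : ∀ a → int (a ∷ D) (false ∷ D′) ≡ 0 → int D D′ ≡ 0
          int0 true  i = i
          int0 false i = i
        rem (false ∷ D) _ (true ∷ D′) h x (i , f) | refl with X b (false ∷ D′) in e
        ... | false = refl , x
        ... | true  = ⊥-elim (bad-meets {D′} {D} h e (trans (int-comm D′ D) i))

      exchange₂ : levelWeight {κ} b * μ I₂ ≤ q * μ (level κ (suc b)) * μ J₂
      exchange₂ = block-exchange b I₂ b J₂ I⊆ J⊆ ind rem
        where
        I⊆ : ∀ C → I₂ C ≡ true → X b C ≡ true
        I⊆ (true ∷ D)  h = h
        J⊆ : ∀ C → J₂ C ≡ true → X b C ≡ true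
        J⊆ (false ∷ D) h = h
        ind : ∀ C C′ → I₂ C ≡ true → I₂ C′ ≡ true → Conflict b C b C′ → ⊥
        ind (true ∷ D) (true ∷ D′) h h′ (() , _)
        rem : ∀ C b″ C′ → I₂ C ≡ true → X b″ C′ ≡ true → Conflict b C b″ C′ → b″ ≡ b × J₂ C′ ≡ true
        rem (true ∷ D) b″ (true ∷ D′)  h x (() , f)
        rem (true ∷ D) b″ (false ∷ D′) h x (i , f) with sameLevel b″ f
        ... | refl = refl , x

      d : ℕ
      d = κ ∸ b

      κ≡ : κ ≡ b + d
      κ≡ = sym (m+[n∸m]≡n (≤-trans (n≤1+n b) b<κ))

      divide : ∀ x y → levelWeight {κ} b * x ≤ q * μ (level κ (suc b)) * y → suc b * x ≤ d * y
      divide x y h = *-cancelˡ-≤ (levelWeight {κ} b) {{>-nonZero (levelWeight>0 (≤-trans (n≤1+n b) b<κ))}}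
        (subst₂ _≤_ (pull (suc b) (levelWeight {κ} b) x) (pull d (levelWeight {κ} b) y) (scaled {x = x} {y = y} κ≡ h))
        where
        pull : ∀ x y z → x * (y * z) ≡ y * (x * z)
        pull = solve-∀

      μ-true : μ (λ D → X b (true ∷ D)) ≡ μ both + μ good
      μ-true = trans (∑-cong (B c) (λ D → cases (X b (false ∷ D)) (X b (true ∷ D)) (wt D))) (∑-+ (B c) _ _)
        where
        cases : ∀ x y w → ι y * w ≡ ι (x ∧ y) * w + ι (not x ∧ y) * w
        cases true  y w = sym (+-identityʳ (ι y * w))
        cases false y w = refl

      μ-false : μ (λ D → X b (false ∷ D)) ≡ μ both + μ bad
      μ-false = trans (∑-cong (B c) (λ D → cases (X b (false ∷ D)) (X b (true ∷ D)) (wt D))) (∑-+ (B c) _ _)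
        where
        cases : ∀ x y w → ι x * w ≡ ι (x ∧ y) * w + ι (x ∧ not y) * w
        cases false y     w = refl
        cases true  true  w = sym (+-identityʳ _)
        cases true  false w = refl

      μ-zeros : μ {c} (λ _ → false) ≡ 0
      μ-zeros = μ-zero {c} {λ _ → false} (λ _ → refl)

      inequality₁ : suc b * (q * μ bad + p * μ both) ≤ d * (q * μ both + p * μ good)
      inequality₁ = subst₂ (λ x y → suc b * x ≤ d * y) (μ-split I₁) (μ-split J₁) (divide (μ I₁) (μ J₁) exchange₁)

      inequality₂ : suc b * (p * (μ both + μ good)) ≤ d * (q * (μ both + μ bad))
      inequality₂ = subst₂ (λ x y → suc b * x ≤ d * y)
        (trans (μ-split I₂) (trans (cong (λ x → q * x + p * μ (λ D → X b (true ∷ D))) μ-zeros) (trans (cong (_+ p * μ (λ D → X b (true ∷ D))) (*-zeroʳ q)) (cong (p *_) μ-true))))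
        (trans (μ-split J₂) (trans (cong (λ x → q * μ (λ D → X b (false ∷ D)) + p * x) μ-zeros) (trans (cong (q * μ (λ D → X b (false ∷ D)) +_) (*-zeroʳ p)) (trans (+-identityʳ _) (cong (q *_) μ-false)))))
        (divide (μ I₂) (μ J₂) exchange₂)

      -- `balance` forces h = 0, and counting coordinates then gives c = 0: the context is the head
      -- alone. It is obstructed for both values of the head, which rules out either shape of the
      -- given pivot.
      unobstructed : ∀ {C} → X b C ≡ true → ⊥
      unobstructed {k ∷ D₀} x = refute (search (B c) both) hp
        where
        -- `e` = t - 2 and `h` = a - (b + 1) bring the parameters into the subtraction-free form of
        -- `balance`.
        e h : ℕ
        e = proj₁ (m≤n⇒∃[o]m+o≡n 2≤t)
        t≡ : 2 + e ≡ t
        t≡ = proj₂ (m≤n⇒∃[o]m+o≡n 2≤t)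
        suc-b≡ : suc b ≡ d + suc e
        suc-b≡ = arith b d e κ t bal κ≡ t≡
          where
          arith : ∀ b d e κ t → b + b + 2 ≡ κ + t → κ ≡ b + d → 2 + e ≡ t → suc b ≡ d + suc e
          arith b d e _ _ eq refl refl = +-cancelˡ-≡ (suc b) _ _ (trans (ringˡ b) (trans eq (ringʳ b d e)))
            where
            ringˡ : ∀ b → suc b + suc b ≡ b + b + 2
            ringˡ = solve-∀
            ringʳ : ∀ b d e → b + d + (2 + e) ≡ suc b + (d + suc e)
            ringʳ = solve-∀
        c+2b≡ : c + 2 * suc b ≡ 2 * a
        c+2b≡ = arith c b a κ t bal n≡
          where
          arith : ∀ c b a κ t → b + b + 2 ≡ κ + t → suc c + suc κ + t ≡ 2 * suc a → c + 2 * suc b ≡ 2 * a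
          arith c b a κ t eq f = +-cancelʳ-≡ 2 _ _ (trans (ringˡ c b) (trans (cong (λ z → suc (suc c) + z) eq) (trans (ringᵐ c κ t) (trans f (ringʳ a)))))
            where
            ringˡ : ∀ c b → c + 2 * suc b + 2 ≡ suc (suc c) + (b + b + 2)
            ringˡ = solve-∀
            ringᵐ : ∀ c κ t → suc (suc c) + (κ + t) ≡ suc c + suc κ + t
            ringᵐ = solve-∀
            ringʳ : ∀ a → 2 * suc a ≡ 2 * a + 2
            ringʳ = solve-∀
        suc-b≤a : suc b ≤ a
        suc-b≤a = *-cancelˡ-≤ 2 (≤-trans (m≤n+m _ c) (≤-reflexive c+2b≡))
        h = a ∸ suc b
        a≡′ : a ≡ suc b + h
        a≡′ = sym (m+[n∸m]≡n suc-b≤a)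
        r≡ : r ≡ d + h
        r≡ = arith a b d e h r t a≡ a≡′ suc-b≡ t≡
          where
          arith : ∀ a b d e h r t → suc a ≡ t + r → a ≡ suc b + h → suc b ≡ d + suc e → 2 + e ≡ t → r ≡ d + h
          arith _ b d e h r _ eq refl f refl = +-cancelˡ-≡ (2 + e) _ _ (trans (sym eq) (trans (cong (λ z → suc (z + h)) f) (ring d e h)))
            where
            ring : ∀ d e h → suc (d + suc e + h) ≡ 2 + e + (d + h)
            ring = solve-∀
        density′ : q * (d + h) ≤ p * (d + suc e + h)
        density′ = subst₂ (λ x y → q * x ≤ p * y) r≡ (trans a≡′ (cong (_+ h) suc-b≡)) density
        nonempty : 1 ≤ μ both + (μ bad + μ good)
        nonempty = cases (X b (false ∷ D₀)) (X b (true ∷ D₀)) k refl refl x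
          where
          cases : ∀ y z k → X b (false ∷ D₀) ≡ y → X b (true ∷ D₀) ≡ z → X b (k ∷ D₀) ≡ true → 1 ≤ μ both + (μ bad + μ good)
          cases true  true  k     ey ez x = ≤-trans (μ-pos {G = both} {D₀} (true-∧ ey ez)) (m≤m+n _ _)
          cases true  false k     ey ez x = ≤-trans (μ-pos {G = bad} {D₀} (true-∧ ey (cong not ez))) (≤-trans (m≤m+n (μ bad) (μ good)) (m≤n+m (μ bad + μ good) (μ both)))
          cases false true  k     ey ez x = ≤-trans (μ-pos {G = good} {D₀} (true-∧ (cong not ey) ez)) (≤-trans (m≤n+m (μ good) (μ bad)) (m≤n+m (μ bad + μ good) (μ both)))
          cases false false true  ey ez x = ⊥-elim (true≢false x ez)
          cases false false false ey ez x = ⊥-elim (true≢false x ey)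
        core : 1 ≤ μ both × h ≡ 0
        core = balance d e h (μ both) (μ bad) (μ good) 1≤p p≤q nonempty (subst (λ z → z * (q * μ bad + p * μ both) ≤ d * (q * μ both + p * μ good)) suc-b≡ inequality₁)
          (subst (λ z → z * (p * (μ both + μ good)) ≤ d * (q * (μ both + μ bad))) suc-b≡ inequality₂) density′
        c≡0 : c ≡ 0
        c≡0 = arith c b a h c+2b≡ a≡′ (proj₂ core)
          where
          arith : ∀ c b a h → c + 2 * suc b ≡ 2 * a → a ≡ suc b + h → h ≡ 0 → c ≡ 0
          arith c b _ _ eq refl refl = +-cancelʳ-≡ (2 * suc b) c 0 (trans eq (cong (2 *_) (+-identityʳ (suc b))))
        unique : ∀ {c} → c ≡ 0 → (D D′ : V c) → D ≡ D′
        unique refl [] [] = refl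
        size0 : ∀ {c} → c ≡ 0 → (D : V c) → size D ≡ 0
        size0 refl [] = refl
        refute : (∃ λ D → both D ≡ true) ⊎ (∀ {D} → D ∈ B c → both D ≡ false) → HeadPivot G a → ⊥
        refute (inj₂ none) _ = 1+n≰n (≤-trans (proj₁ core) (≤-reflexive (μ-zero {c} {both} (λ D → none (∈-B D)))))
        refute (inj₁ (D , bD)) (v , pv , sv) = split (splitAt c v) pv sv
          where
          cases : ∀ k′ v′ → pivot G (D ⧺ k′ ∷ v′) ≡ true → size (k′ ∷ v′) ≡ suc b → ⊥
          cases false v′ pv s = true≢false (g⇒G {false ∷ D} {false} s (X-in {b} {false ∷ D} (proj₁ (∧-true bD))))
            (not-true (proj₂ (∧-true {G (true ∷ (D ⧺ false ∷ v′))} pv)))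
          cases true v′ pv s = true≢false (proj₁ (∧-true pv)) (trans (G≡g (true ∷ D) true v′)
            (trans (cong (λ z → g true z (true ∷ D)) (suc-injective s)) (X-out {b} {true ∷ D} (proj₂ (∧-true {X b (false ∷ D)} bD)))))
          size≡ : ∀ w → size (D ⧺ w) ≡ a → size w ≡ suc b
          size≡ w s = trans (cong (_+ size w) (sym (size0 c≡0 D))) (trans (sym (size-⧺ D w))
            (trans s (trans a≡′ (trans (cong (suc b +_) (proj₂ core)) (+-identityʳ (suc b))))))
          split : ∀ {v} → (∃ λ D′ → ∃ λ w → v ≡ D′ ⧺ w) → pivot G v ≡ true → size v ≡ a → ⊥
          split (D′ , k′ ∷ v′ , refl) pv s = cases k′ v′ (subst (λ z → pivot G (z ⧺ k′ ∷ v′) ≡ true) (unique c≡0 D′ D) pv)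
            (size≡ (k′ ∷ v′) (subst (λ z → size (z ⧺ k′ ∷ v′) ≡ a) (unique c≡0 D′ D) s))

  -- From invariance under permutations to threshold families

  opt-upward : ∀ {n} {G : Family n} → Opt t G → (v u : V n) → (∀ w → int v w ≤ int u w) → G v ≡ true → G u ≡ true
  opt-upward o v u h g = opt-maximal o u
    (≤-trans (proj₁ o v v g g) (≤-trans (h v) (int≤size u v)))
    (λ w gw → ≤-trans (proj₁ o v w g gw) (h w))

  module _ (2≤t : 2 ≤ t) where

    -- Shiftedness gives one half of the invariance for κ + 1 coordinates, and the other half fails
    -- only at an obstruction. With an empty context a balanced obstruction contradicts parity: n +
    -- t would be both 2 (a + 1) and 2 (b + 1) + 1.
    propagate : ∀ {n} {G : Family n} → Opt t G → Shifted G → ∀ {a r} → suc a ≡ t + r → n + t ≡ 2 * suc a → q * r ≤ p * a →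
      HeadPivot G a → ∀ {κ} → (∀ v v′ → Tail κ v v′ → G v ≡ G v′) → ∀ v v′ → Tail (suc κ) v v′ → G v ≡ G v′
    propagate {G = G} o sh {a} {r} a≡ n≡ dens hp {κ} ih v v′ s with tail-view s
    ... | view {c} C k w k′ w′ e = cases C k w k′ w′ e
      where
      symmetric : ∀ C k v v′ → size v ≡ size v′ → G (C ⧺ k ∷ v) ≡ G (C ⧺ k ∷ v′)
      symmetric C k v v′ e = ih _ _ (tail-⧺ C k e)
      open Block {c} {κ} {G} o sh symmetric
      impossible : ∀ c {G : Family (c + suc κ)} (o : Opt t G) (sh : Shifted G) → c + suc κ + t ≡ 2 * suc a → HeadPivot G a →
        (sy : ∀ C k v v′ → size v ≡ size v′ → G (C ⧺ k ∷ v) ≡ G (C ⧺ k ∷ v′)) →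
        ∀ {b C} → Block.X {c} {κ} {G} o sh sy b C ≡ true → ⊥
      impossible zero {G} o sh n≡ hp sy {b} {C} x = even≢odd (suc a) (suc b)
        (trans (sym n≡) (cong suc (trans (sym (NoObstruction.balanced 2≤t {zero} {κ} {G} o sh sy {b} {C} x)) (double b))))
        where
        double : ∀ b → b + b + 2 ≡ 2 * suc b
        double = solve-∀
      impossible (suc c) {G} o sh n≡ hp sy {b} {C} x = NoObstructionBelow.unobstructed 2≤t {c} {κ} {G} o sh sy a≡ n≡ dens hp
        (NoObstruction.balanced 2≤t {suc c} {κ} {G} o sh sy {b} {C} x)
        (Block.X-size {suc c} {κ} {G} o sh sy {b} {C} x) x
      swapped : ∀ (C : V c) w w′ → size w ≡ suc (size w′) → G (C ⧺ false ∷ w) ≡ G (C ⧺ true ∷ w′)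
      swapped C w w′ e = bool-ext there-and back
        where
        b<κ : suc (size w′) ≤ κ
        b<κ = subst (_≤ κ) e (size≤ w)
        back : G (C ⧺ true ∷ w′) ≡ true → G (C ⧺ false ∷ w) ≡ true
        back g′ with shift-head (λ u → G (C ⧺ u)) (shifted-section G C sh) w′ b<κ g′
        ... | w″ , e″ , g″ = trans (symmetric C false w w″ (trans e (sym e″))) g″
        there-and : G (C ⧺ false ∷ w) ≡ true → G (C ⧺ true ∷ w′) ≡ true
        there-and gw with G (C ⧺ true ∷ w′) in gt
        ... | true  = refl
        ... | false = ⊥-elim (impossible c o sh n≡ hp symmetric {size w′} {C} (X-intro {size w′} {C} b<κ
          (trans (cong (λ z → g false z C) (sym e)) (trans (sym (G≡g C false w)) gw)) (trans (sym (G≡g C true w′)) gt)))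
      cases : ∀ (C : V c) k w k′ w′ → size (k ∷ w) ≡ size (k′ ∷ w′) → G (C ⧺ k ∷ w) ≡ G (C ⧺ k′ ∷ w′)
      cases C true  w true  w′ e = symmetric C true w w′ (suc-injective e)
      cases C false w false w′ e = symmetric C false w w′ e
      cases C false w true  w′ e = swapped C w w′ e
      cases C true  w false w′ e = sym (swapped C w′ w (sym e))

    symmetric-all : ∀ {n} {G : Family n} → Opt t G → Shifted G → ∀ {a r} → suc a ≡ t + r → n + t ≡ 2 * suc a → q * r ≤ p * a →
      HeadPivot G a → ∀ v v′ → size v ≡ size v′ → G v ≡ G v′
    symmetric-all {n} {G} o sh a≡ n≡ dens hp v v′ e = all n v v′ (stop e)
      where
      all : ∀ κ v v′ → Tail κ v v′ → G v ≡ G v′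
      all zero    v v′ s = cong G (tail₀ s)
      all (suc κ) = propagate o sh a≡ n≡ dens hp (all κ)

  module _ {N : ℕ} {G : Family (suc N)} (o : Opt t G) (sh : Shifted G) (strict : p < q ⊎ 2 ≤ t) where

    open Pivots o sh

    -- All pivots have one size, so `pivot-density` supplies the bound on which full symmetry rests.
    -- A symmetric upward closed family is given by a threshold on the size, and a pivot of size a
    -- puts it at a + 1 = t + r.
    middle : (∃ λ v → C v ≡ true) → (∀ v → C v ≡ true → suc (2 * size v) ≡ N + t) →
      ∃ λ r → suc N ≡ t + (r + r) × (2 ≤ t ⊎ r ≡ 0) × (∀ v → G v ≡ (t + r ≤ᵇ size v))
    middle (v₀ , c₀) mids = r , N≡ , large-t , value
      where
      a r : ℕ
      a = size v₀
      r = suc a ∸ t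
      a≡ : suc a ≡ t + r
      a≡ = sym (m+[n∸m]≡n (≤-trans (proj₁ o _ _ (proj₁ (∧-true c₀)) (proj₁ (∧-true c₀))) (≤-reflexive (cong suc (int-self v₀)))))
      N+t≡ : suc (2 * a) ≡ N + t
      N+t≡ = mids v₀ c₀
      sizes : ∀ v → C v ≡ true → size v ≡ a
      sizes v c = *-cancelˡ-≡ (size v) a 2 (suc-injective (trans (mids v c) (sym N+t≡)))
      N≡a+r : N ≡ a + r
      N≡a+r = arith N a r t N+t≡ a≡
        where
        arith : ∀ N a r t → suc (2 * a) ≡ N + t → suc a ≡ t + r → N ≡ a + r
        arith N a r t e f = +-cancelʳ-≡ t N (a + r) (trans (sym e) (trans (ringˡ a) (trans (cong (a +_) f) (ringʳ a t r))))
          where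
          ringˡ : ∀ a → suc (2 * a) ≡ a + suc a
          ringˡ = solve-∀
          ringʳ : ∀ a t r → a + (t + r) ≡ a + r + t
          ringʳ = solve-∀
      N≡ : suc N ≡ t + (r + r)
      N≡ = trans (cong suc N≡a+r) (trans (cong (_+ r) a≡) (+-assoc t r r))
      dens : q * r ≤ p * a
      dens = pivot-density {a} {r} N≡a+r sizes (v₀ , c₀)
      n≡ : suc N + t ≡ 2 * suc a
      n≡ = trans (cong suc (sym N+t≡)) (double a)
        where
        double : ∀ a → suc (suc (2 * a)) ≡ 2 * suc a
        double = solve-∀
      t≥2? : 2 ≤ t ⊎ N ≡ 0
      t≥2? = decide t strict a≡
        where
        decide : ∀ t → p < q ⊎ 2 ≤ t → suc a ≡ t + r → 2 ≤ t ⊎ N ≡ 0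
        decide t (inj₂ h) _ = inj₁ h
        decide (suc (suc t)) (inj₁ _) _ = inj₁ (s≤s (s≤s z≤n))
        -- For t = 1 the density bound reads q r ≤ p r, so p < q leaves r = 0 and only the head
        -- coordinate.
        decide (suc zero) (inj₁ p<q) e = inj₂ (trans N≡a+r (trans (cong (_+ r) (suc-injective e)) (cong (λ z → z + z) (r≡0 r (subst (λ z → q * r ≤ p * z) (suc-injective e) dens)))))
          where
          r≡0 : ∀ r → q * r ≤ p * r → r ≡ 0
          r≡0 zero    _ = refl
          r≡0 (suc r) h = ⊥-elim (<⇒≱ p<q (*-cancelʳ-≤ q p (suc r) h))
        decide zero (inj₁ p<q) e = ⊥-elim (<⇒≱ (*-monoˡ-< (suc a) p<q) (≤-trans (≤-reflexive (cong (q *_) e)) (≤-trans dens (*-monoʳ-≤ p (n≤1+n a)))))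
      large-t : 2 ≤ t ⊎ r ≡ 0
      large-t with t≥2?
      ... | inj₁ h = inj₁ h
      ... | inj₂ e = inj₂ (m+n≡0⇒n≡0 a (trans (sym N≡a+r) e))
      symmetric : ∀ v v′ → size v ≡ size v′ → G v ≡ G v′
      symmetric with t≥2?
      ... | inj₁ h = symmetric-all h o sh a≡ n≡ dens (v₀ , c₀ , refl)
      ... | inj₂ refl = λ { (true ∷ []) (true ∷ []) _ → refl ; (false ∷ []) (false ∷ []) _ → refl }
      f : ℕ → Bool
      f j = G (ones (suc N) j)
      G≡f : ∀ v → G v ≡ f (size v)
      G≡f v = symmetric v _ (sym (size-ones (size≤ v)))
      up : ∀ j k → f j ≡ true → f (k + j) ≡ true
      up j zero    e = e
      up j (suc k) e = opt-upward o (ones (suc N) (k + j)) (ones (suc N) (suc k + j)) (ones-grow (suc N) (k + j)) (up j k e)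
      f-top : f (suc a) ≡ true
      f-top = trans (sym (G≡f (true ∷ v₀))) (proj₁ (∧-true c₀))
      f-low : f a ≡ false
      f-low = trans (sym (G≡f (false ∷ v₀))) (not-true (proj₂ (∧-true {G (true ∷ v₀)} c₀)))
      value : ∀ v → G v ≡ (t + r ≤ᵇ size v)
      value v = trans (G≡f v) (trans (bool-ext {f (size v)} {suc a ≤ᵇ size v} to from) (cong (_≤ᵇ size v) a≡))
        where
        to : f (size v) ≡ true → (suc a ≤ᵇ size v) ≡ true
        to e with suc a ≤? size v
        ... | yes h = true-≤ᵇ h
        ... | no ¬h = ⊥-elim (true≢false (subst (λ z → f z ≡ true) (m∸n+n≡m (s≤s⁻¹ (≰⇒> ¬h))) (up (size v) (a ∸ size v) e)) f-low)
        from : (suc a ≤ᵇ size v) ≡ true → f (size v) ≡ true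
        from e = subst (λ z → f z ≡ true) (m∸n+n≡m (≤ᵇ-true {suc a} e)) (up (suc a) (size v ∸ suc a) f-top)

  Nonempty : ∀ {n} → Family n → Set
  Nonempty G = ∃ λ v → G v ≡ true

  opt-section : ∀ {n} {G : Family (suc n)} → Opt t G → (∀ v → G (true ∷ v) ≡ G (false ∷ v)) → Opt t (λ v → G (false ∷ v))
  opt-section {n} {G} (i , m) e = (λ v u a b → i (false ∷ v) (false ∷ u) a b) , λ H h →
    *-cancelˡ-≤ (q + p) {{>-nonZero (≤-trans 1≤q (m≤m+n q p))}} (subst₂ _≤_
      (trans (μ-split (H′ H)) (sym (*-distribʳ-+ (μ H) q p)))
      (trans (μ-split G) (trans (cong (λ x → q * μ (λ v → G (false ∷ v)) + p * x) (μ-cong e)) (sym (*-distribʳ-+ (μ (λ v → G (false ∷ v))) q p))))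
      (m (H′ H) (int′ H h)))
    where
    H′ : Family n → Family (suc n)
    H′ H (_ ∷ v) = H v
    int′ : ∀ H → Int t H → Int t (H′ H)
    int′ H h (a ∷ v) (b ∷ u) x y = ≤-trans (h v u x y) (m≤n+m _ (ι (a ∧ b)))

  threshold-section : ∀ {n} {G : Family (suc n)} → (∀ v → G (true ∷ v) ≡ G (false ∷ v)) → Threshold t (λ v → G (false ∷ v)) → Threshold t G
  threshold-section {n} {G} e (R , r , R≡ , l , value) = false ∷ R , r , R≡ , l , value′
    where
    value′ : ∀ v → G v ≡ (t + r ≤ᵇ int v (false ∷ R))
    value′ (true ∷ v)  = trans (e v) (value v)
    value′ (false ∷ v) = value v

  threshold-middle : ∀ {N} {G : Family (suc N)} (o : Opt t G) → Shifted G → p < q ⊎ 2 ≤ t → (∃ λ v → pivot G v ≡ true) →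
    (∀ v → pivot G v ≡ true → suc (2 * size v) ≡ N + t) → Threshold t G
  threshold-middle {N} o sh strict c mids with middle o sh strict c mids
  ... | r , N≡ , l , value = ones (suc N) (suc N) , r , trans (size-full (suc N)) N≡ , l ,
    λ v → trans (value v) (cong (t + r ≤ᵇ_) (sym (int-full v)))

  no-pivot : ∀ {n} {G : Family (suc n)} → Opt t G → (∀ {v} → v ∈ B n → pivot G v ≡ false) → ∀ v → G (true ∷ v) ≡ G (false ∷ v)
  no-pivot {G = G} o none v with G (false ∷ v) in e | G (true ∷ v) in e′ | none (∈-B v)
  ... | true  | true  | _  = refl
  ... | false | false | _  = refl
  ... | true  | false | _  = ⊥-elim (true≢false (opt-up o v e) e′)
  ... | false | true  | () 

  -- `low` and `high` now weigh the same, so either can be traded for the other without loss. Both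
  -- results are optimal and have only middle pivots, which makes them the same threshold family;
  -- yet they differ at any low pivot.
  module EqualWeights (p≡1 : p ≡ 1) (q≡1 : q ≡ 1) (2≤t : 2 ≤ t) where

    module _ {n : ℕ} {G : Family (suc n)} (I J : Family n) where

      move-true : ∀ v → G (true ∷ v) ≡ true → J v ≡ false → move G I J (true ∷ v) ≡ true
      move-true v g j rewrite g | j = refl

      move-true⁻ : ∀ v → move G I J (true ∷ v) ≡ true → G (true ∷ v) ≡ true × J v ≡ false
      move-true⁻ v m = proj₁ both , not-true (proj₂ both)
        where both = ∧-true {G (true ∷ v)} (trans (sym (Bool.∨-identityʳ (G (true ∷ v) ∧ not (J v)))) m)

      move-false : ∀ v → G (false ∷ v) ≡ true ⊎ I v ≡ true → move G I J (false ∷ v) ≡ true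
      move-false v (inj₁ g) rewrite g = refl
      move-false v (inj₂ i) = trans (cong ((G (false ∷ v) ∧ true) ∨_) i) (Bool.∨-zeroʳ (G (false ∷ v) ∧ true))

      move-false⁻ : ∀ v → move G I J (false ∷ v) ≡ true → G (false ∷ v) ≡ true ⊎ I v ≡ true
      move-false⁻ v m with G (false ∷ v)
      ... | true  = inj₁ refl
      ... | false = inj₂ m

    pivot-parts : ∀ {n} (G : Family (suc n)) v → pivot G v ≡ true → G (true ∷ v) ≡ true × G (false ∷ v) ≡ false
    pivot-parts G v e = proj₁ (∧-true e) , not-true (proj₂ (∧-true {G (true ∷ v)} e))

    -- Adjacent shifts preserve sizes, so moving all pivots of given sizes together keeps the family
    -- shifted.
    SizeClosed : ∀ {n} → Family (suc n) → Family n → Set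
    SizeClosed G I = (∀ v → I v ≡ true → pivot G v ≡ true) × (∀ v u → I v ≡ true → pivot G u ≡ true → size v ≡ size u → I u ≡ true)

    move-shifted : ∀ {N} {G : Family (suc N)} (I J : Family N) → SizeClosed G I → SizeClosed G J → Shifted G → Shifted (move G I J)
    move-shifted {zero}        I J _ _ _ = tt , tt , tt
    move-shifted {suc zero} {G} I J _ _ (h , _) =
      (λ v m → move-false {G = G} I J (true ∷ v) (inj₁ (h v (proj₁ (move-true⁻ {G = G} I J (false ∷ v) m))))) , (tt , tt , tt) , (tt , tt , tt)
    move-shifted {suc (suc n)} {G} I J (I⊆ , Is) (J⊆ , Js) (h , st , sf) =
      (λ v m → move-false {G = G} I J (true ∷ v) (inj₁ (h v (proj₁ (move-true⁻ {G = G} I J (false ∷ v) m))))) ,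
      pair-shifted (λ v → move G I J (true ∷ v)) true-section , pair-shifted (λ v → move G I J (false ∷ v)) false-section
      where
      tf ft : Fin (suc n) → V n → V (suc (suc n))
      tf i z = pair-in i true false z
      ft i z = pair-in i false true z
      sizes : ∀ i z → size (ft i z) ≡ size (tf i z)
      sizes i z = trans (size-pair i false true z) (sym (size-pair i true false z))
      true-section : ∀ i z → move G I J (true ∷ tf i z) ≡ true → move G I J (true ∷ ft i z) ≡ true
      true-section i z m = move-true {G = G} I J (ft i z) (shifted-pair (λ v → G (true ∷ v)) st i z g) (not-J (true-or-false (J (ft i z))))
        where
        g : G (true ∷ tf i z) ≡ true
        g = proj₁ (move-true⁻ {G = G} I J (tf i z) m)
        not-J : J (ft i z) ≡ true ⊎ J (ft i z) ≡ false → J (ft i z) ≡ false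
        not-J (inj₂ j) = j
        not-J (inj₁ j) with true-or-false (G (false ∷ tf i z))
        ... | inj₁ e = ⊥-elim (true≢false (shifted-pair (λ v → G (false ∷ v)) sf i z e) (proj₂ (pivot-parts G (ft i z) (J⊆ (ft i z) j))))
        ... | inj₂ e = ⊥-elim (true≢false (Js (ft i z) (tf i z) j (true-∧ g (cong not e)) (sizes i z)) (proj₂ (move-true⁻ {G = G} I J (tf i z) m)))
      false-section : ∀ i z → move G I J (false ∷ tf i z) ≡ true → move G I J (false ∷ ft i z) ≡ true
      false-section i z m with move-false⁻ {G = G} I J (tf i z) m | true-or-false (G (false ∷ ft i z))
      ... | inj₁ g | _        = move-false {G = G} I J (ft i z) (inj₁ (shifted-pair (λ v → G (false ∷ v)) sf i z g))
      ... | inj₂ _ | inj₁ g   = move-false {G = G} I J (ft i z) (inj₁ g)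
      ... | inj₂ e | inj₂ g   = move-false {G = G} I J (ft i z) (inj₂ (Is (tf i z) (ft i z) e
        (true-∧ (shifted-pair (λ v → G (true ∷ v)) st i z (proj₁ (pivot-parts G (tf i z) (I⊆ (tf i z) e)))) (cong not g)) (sym (sizes i z))))

    module _ {N : ℕ} (ih : ∀ (H : Family N) → Opt t H → Nonempty H → Threshold t H) {G : Family (suc N)} (o : Opt t G) (sh : Shifted G) where

      open Pivots o sh

      rest : Family N
      rest v = C v ∧ (not (low v) ∧ not (high v))

      Found : Set
      Found = (∃ λ v → rest v ≡ true) ⊎ (∀ {v} → v ∈ B N → rest v ≡ false)

      -- The set R of the threshold family after the exchange. It depends only on whether middle
      -- pivots remain, not on the direction of the exchange.
      top : Found → V (suc N)
      top (inj₁ _) = ones (suc N) (suc N)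
      top (inj₂ _) = false ∷ ones N N

      module Moved (I J : Family N) (cI : SizeClosed G I) (cJ : SizeClosed G J)
        (rest≡ : ∀ v → C v ≡ true → I v ≡ false → J v ≡ false → rest v ≡ true)
        (rest-I : ∀ v → rest v ≡ true → I v ≡ false) (rest-J : ∀ v → rest v ≡ true → J v ≡ false)
        (i : Int t (move G I J)) (weights : p * μ J ≤ q * μ I) (I≠∅ : ∃ λ v → I v ≡ true) where

        M : Family (suc N)
        M = move G I J

        M-opt : Opt t M
        M-opt = move-opt I J (proj₁ cI) (proj₁ cJ) o i weights

        M-pivot : ∀ v → pivot M v ≡ true → rest v ≡ true
        M-pivot v e = cases (G (true ∷ v)) (G (false ∷ v)) (I v) (J v) refl refl refl refl e
          where
          cases : ∀ x y a b → G (true ∷ v) ≡ x → G (false ∷ v) ≡ y → I v ≡ a → J v ≡ b →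
            ((x ∧ not b) ∨ false) ∧ not ((y ∧ true) ∨ a) ≡ true → rest v ≡ true
          cases true false false false ex ey ea eb _ = rest≡ v (true-∧ ex (cong not ey)) ea eb

        M-value : (s : Found) → ∃ λ r → size (top s) ≡ t + (r + r) × (∀ v → M v ≡ (t + r ≤ᵇ int v (top s)))
        M-value (inj₁ (v₀ , r₀)) = from-middle (middle M-opt (move-shifted I J cI cJ sh) (inj₂ 2≤t) (v₀ , rest-pivot) mids)
          where
          mids : ∀ v → pivot M v ≡ true → suc (2 * size v) ≡ N + t
          mids v e = mid v (proj₁ (∧-true r)) (not-true (proj₁ (∧-true (proj₂ (∧-true {C v} r))))) (not-true (proj₂ (∧-true {not (low v)} (proj₂ (∧-true {C v} r)))))
            where r = M-pivot v e
          rest-pivot : pivot M v₀ ≡ true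
          rest-pivot = true-∧ (move-true {G = G} I J v₀ (proj₁ parts) (rest-J v₀ r₀)) (cong not
            (cong₂ (λ a b → (a ∧ true) ∨ b) (proj₂ parts) (rest-I v₀ r₀)))
            where parts = pivot-parts G v₀ (proj₁ (∧-true r₀))
          from-middle : (∃ λ r → suc N ≡ t + (r + r) × (2 ≤ t ⊎ r ≡ 0) × (∀ v → M v ≡ (t + r ≤ᵇ size v))) →
            ∃ λ r → size (ones (suc N) (suc N)) ≡ t + (r + r) × (∀ v → M v ≡ (t + r ≤ᵇ int v (ones (suc N) (suc N))))
          from-middle (r , N≡ , _ , value) = r , trans (size-full (suc N)) N≡ , λ v → trans (value v) (cong (t + r ≤ᵇ_) (sym (int-full v)))
        M-value (inj₂ none) = from-section (ih (λ v → M (false ∷ v)) (opt-section M-opt free) nonempty)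
          where
          free : ∀ v → M (true ∷ v) ≡ M (false ∷ v)
          free = no-pivot M-opt (λ {v} v∈ → decide v (none v∈))
            where
            decide : ∀ v → rest v ≡ false → pivot M v ≡ false
            decide v e with pivot M v in ep
            ... | false = refl
            ... | true  = ⊥-elim (true≢false (M-pivot v ep) e)
          nonempty : ∃ λ v → M (false ∷ v) ≡ true
          nonempty = proj₁ I≠∅ , trans (cong ((G (false ∷ proj₁ I≠∅) ∧ true) ∨_) (proj₂ I≠∅)) (Bool.∨-zeroʳ _)
          from-section : Threshold t (λ v → M (false ∷ v)) → ∃ λ r → size (false ∷ ones N N) ≡ t + (r + r) × (∀ v → M v ≡ (t + r ≤ᵇ int v (false ∷ ones N N)))
          from-section (R , r , R≡ , l , value) = r , trans (cong size (sym R-full)) R≡ , value′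
            where
            value₀ : ∀ v → M v ≡ (t + r ≤ᵇ int v (false ∷ R))
            value₀ (true ∷ v)  = trans (free v) (value v)
            value₀ (false ∷ v) = value v
            R-full : R ≡ ones N N
            -- The head is ignored already, and equal weights allow no second ignored coordinate.
            R-full = full R (n≤0⇒n≡0 (s≤s⁻¹ (few-free p≡1 q≡1 2≤t M M-opt (false ∷ R) r R≡ value₀)))
            value′ : ∀ v → M v ≡ (t + r ≤ᵇ int v (false ∷ ones N N))
            value′ v = trans (value₀ v) (cong (λ S → t + r ≤ᵇ int v (false ∷ S)) R-full)

      low-closed : SizeClosed G low
      low-closed = lowC , λ v u l c e → true-∧ c (subst (λ s → (2 * s + 2 ≤ᵇ N + t) ≡ true) e (proj₂ (∧-true {C v} l)))

      high-closed : SizeClosed G high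
      high-closed = highC , λ v u l c e → true-∧ c (subst (λ s → (N + t ≤ᵇ 2 * s) ≡ true) e (proj₂ (∧-true {C v} l)))

      rest-low : ∀ v → rest v ≡ true → low v ≡ false
      rest-low v r = not-true (proj₁ (∧-true (proj₂ (∧-true {C v} r))))

      rest-high : ∀ v → rest v ≡ true → high v ≡ false
      rest-high v r = not-true (proj₂ (∧-true {not (low v)} (proj₂ (∧-true {C v} r))))

      p≡q : p ≡ q
      p≡q = trans p≡1 (sym q≡1)

      low≤high : p * μ low ≤ q * μ high
      low≤high = subst₂ (λ x y → x * μ low ≤ y * μ high) (sym p≡q) p≡q (proj₂ move-low)

      high≤low : p * μ high ≤ q * μ low
      high≤low = subst₂ (λ x y → x * μ high ≤ y * μ low) (sym p≡q) p≡q (proj₂ move-high)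

      other-nonempty : ∀ {I J : Family N} → p * μ I ≤ q * μ J → (∃ λ v → I v ≡ true) → ∃ λ v → J v ≡ true
      other-nonempty {I} {J} le (v , e) with search (B N) J
      ... | inj₁ x = x
      ... | inj₂ none = ⊥-elim (1+n≰n (≤-trans (*-mono-≤ 1≤p (μ-pos {G = I} e)) (≤-trans le
        (≤-reflexive (trans (cong (q *_) (μ-zero {N} {J} (λ u → none (∈-B u)))) (*-zeroʳ q))))))

      low-empty : (∃ λ v → low v ≡ true) → ⊥
      low-empty l@(v , lv) = same (search (B N) rest)
        where
        same : Found → ⊥
        same s with Moved.M-value low high low-closed high-closed (λ v c l h → true-∧ c (cong₂ (λ a b → not a ∧ not b) l h))
                      rest-low rest-high (proj₁ move-low) high≤low l s
                  | Moved.M-value high low high-closed low-closed (λ v c h l → true-∧ c (cong₂ (λ a b → not a ∧ not b) l h))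
                      rest-high rest-low (proj₁ move-high) low≤high (other-nonempty {low} {high} low≤high l) s
        ... | r , R≡ , value | r′ , R≡′ , value′ with double-injective t r r′ (trans (sym R≡) R≡′)
        -- The headless set v is added by the first exchange and absent after the second.
        ...   | refl = true≢false (trans (trans (value′ (false ∷ v)) (sym (value (false ∷ v)))) (move-false {G = G} low high v (inj₂ lv)))
                  (cong₂ (λ a b → (a ∧ true) ∨ b) (proj₂ (pivot-parts G v (lowC v lv))) (low-high v lv))

      all-middle : ∀ v → C v ≡ true → suc (2 * size v) ≡ N + t
      all-middle v c = mid v c (empty (true-or-false (low v)) low-empty)
        (empty (true-or-false (high v)) (λ h → low-empty (other-nonempty {high} {low} high≤low h)))
        where
        empty : ∀ {I : Family N} → I v ≡ true ⊎ I v ≡ false → ((∃ λ v → I v ≡ true) → ⊥) → I v ≡ false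
        empty (inj₁ e) h = ⊥-elim (h (v , e))
        empty (inj₂ e) h = e

  pivots-in-middle : p < q ⊎ (p ≡ 1 × q ≡ 1 × 2 ≤ t) → ∀ {N} → (∀ (H : Family N) → Opt t H → Nonempty H → Threshold t H) →
    {G : Family (suc N)} → Opt t G → Shifted G → ∀ v → pivot G v ≡ true → suc (2 * size v) ≡ N + t
  pivots-in-middle (inj₁ p<q) ih o sh v c = mid v c (proj₁ (low-high-empty p<q) v) (proj₂ (low-high-empty p<q) v)
    where open Pivots o sh
  pivots-in-middle (inj₂ (p≡1 , q≡1 , 2≤t)) ih o sh = EqualWeights.all-middle p≡1 q≡1 2≤t ih o sh

  -- Induction over the dimension and over shifts

  module Characterisation (strict : p < q ⊎ (p ≡ 1 × q ≡ 1 × 2 ≤ t)) where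

    strict′ : p < q ⊎ 2 ≤ t
    strict′ = weaken strict
      where
      weaken : p < q ⊎ (p ≡ 1 × q ≡ 1 × 2 ≤ t) → p < q ⊎ 2 ≤ t
      weaken (inj₁ h)           = inj₁ h
      weaken (inj₂ (_ , _ , h)) = inj₂ h

    Claim : ℕ → Set
    Claim n = (G : Family n) → Opt t G → Nonempty G → Threshold t G

    shifted-case : ∀ {N} → Claim N → (G : Family (suc N)) → Shifted G → Opt t G → Nonempty G → Threshold t G
    shifted-case {N} ih G sh o ne with search (B N) (pivot G)
    ... | inj₁ c = threshold-middle o sh strict′ c (pivots-in-middle strict ih o sh)
    ... | inj₂ none = threshold-section free (ih (λ v → G (false ∷ v)) (opt-section o free) (nonempty ne))
      where
      free : ∀ v → G (true ∷ v) ≡ G (false ∷ v)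
      free = no-pivot o none
      nonempty : Nonempty G → Nonempty (λ v → G (false ∷ v))
      nonempty (true ∷ v , e)  = v , trans (sym (free v)) e
      nonempty (false ∷ v , e) = v , e

    -- Induction on the distance of the potential from its upper bound.
    shifting : ∀ {n} → Claim (suc n) → ∀ fuel (G : Family (suc (suc n))) → ∑ (B (suc (suc n))) pos ≤ potential G + fuel →
      Opt t G → Nonempty G → Threshold t G
    shifting {n} ih fuel G bound o ne with find-unshifted G
    ... | inj₁ sh = shifted-case ih G sh o ne
    shifting {n} ih zero G bound o ne | inj₂ (i , w) = ⊥-elim (<⇒≱ (potential-shift i G w)
      (≤-trans (potential-bound (shift-at i G)) (≤-trans bound (≤-reflexive (+-identityʳ _)))))
    shifting {n} ih (suc fuel) G bound o ne | inj₂ (i , w) = unshift i G 1≤t (proj₁ o) w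
      (shifting ih fuel (shift-at i G) (≤-trans bound (≤-trans (≤-reflexive (+-suc _ fuel)) (+-monoˡ-≤ fuel (potential-shift i G w))))
        (opt-≤ o (shift-int i G (proj₁ o)) (≤-reflexive (sym (μ-shift p q i G)))) nonempty)
      where
      nonempty : Nonempty (shift-at i G)
      nonempty = pair-in i false true (proj₁ w) , trans (shift-ft i G (proj₁ w)) (cong (_∨ G (pair-in i false true (proj₁ w))) (proj₁ (proj₂ w)))

    characterise : ∀ n → Claim n
    characterise zero G o ([] , e) = ⊥-elim (1+n≰n (≤-trans 1≤t (proj₁ o [] [] e e)))
    characterise (suc zero) G o ne = shifted-case (characterise zero) G (tt , tt , tt) o ne
    characterise (suc (suc n)) G o ne = shifting (characterise (suc n)) (∑ (B (suc (suc n))) pos) G (m≤n+m _ (potential G)) o ne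

-- Arcs in ℤₘ, and counting

rsum : ℕ → (ℕ → ℕ) → ℕ
rsum zero    f = 0
rsum (suc n) f = f 0 + rsum n (f ∘ suc)

rsum-cong : ∀ n {f g : ℕ → ℕ} → (∀ i → f i ≡ g i) → rsum n f ≡ rsum n g
rsum-cong zero    h = refl
rsum-cong (suc n) h = cong₂ _+_ (h 0) (rsum-cong n (h ∘ suc))

rsum-mono : ∀ n {f g : ℕ → ℕ} → (∀ i → f i ≤ g i) → rsum n f ≤ rsum n g
rsum-mono zero    h = z≤n
rsum-mono (suc n) h = +-mono-≤ (h 0) (rsum-mono n (h ∘ suc))

rsum-+ : ∀ n (f g : ℕ → ℕ) → rsum n (λ i → f i + g i) ≡ rsum n f + rsum n g
rsum-+ zero    f g = refl
rsum-+ (suc n) f g = trans (cong (f 0 + g 0 +_) (rsum-+ n (f ∘ suc) (g ∘ suc))) (ring (f 0) (g 0) _ _)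
  where
  ring : ∀ a b c d → a + b + (c + d) ≡ a + c + (b + d)
  ring = solve-∀

rsum-term : ∀ n (f : ℕ → ℕ) i → i < n → f i ≤ rsum n f
rsum-term (suc n) f zero    _       = m≤m+n _ _
rsum-term (suc n) f (suc i) (s≤s h) = ≤-trans (rsum-term n (f ∘ suc) i h) (m≤n+m _ (f 0))

rsum-one : ∀ n → rsum n (λ _ → 1) ≡ n
rsum-one zero    = refl
rsum-one (suc n) = cong suc (rsum-one n)

rsum-last : ∀ n (f : ℕ → ℕ) → rsum n f + f n ≡ f 0 + rsum n (f ∘ suc)
rsum-last zero    f = +-comm 0 (f 0)
rsum-last (suc n) f = trans (+-assoc (f 0) _ _) (cong (f 0 +_) (rsum-last n (f ∘ suc)))

rsum-rotate : ∀ n (f : ℕ → ℕ) → (∀ i → f (i + n) ≡ f i) → ∀ k → rsum n (λ i → f (k + i)) ≡ rsum n f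
rsum-rotate n f per zero    = refl
rsum-rotate n f per (suc k) = trans (rsum-rotate n (f ∘ suc) (per ∘ suc) k)
  (+-cancelˡ-≡ (f 0) _ _ (trans (sym (rsum-last n f)) (trans (cong (rsum n f +_) (per 0)) (+-comm _ (f 0)))))

rsum-allFin : ∀ n (f : ℕ → ℕ) (g : Fin n → ℕ) → (∀ a → f (toℕ a) ≡ g a) → ∑ (allFin n) g ≡ rsum n f
rsum-allFin zero    f g h = refl
rsum-allFin (suc n) f g h = trans (∑-allFin n g) (cong₂ _+_ (sym (h zero)) (rsum-allFin n (f ∘ suc) (g ∘ suc) (h ∘ suc)))

-- The ones of a monotone sequence occupy its last positions, so their number determines it.
monotone-sequence : ∀ n (g : ℕ → Bool) → (∀ d → suc d < n → g d ≡ true → g (suc d) ≡ true) →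
  ∀ d → d < n → g d ≡ (n ≤ᵇ d + rsum n (ι ∘ g))
monotone-sequence (suc n) g mono d d<n with g 0 in e
... | true  = trans (upto d d<n) (sym (true-≤ᵇ (≤-trans (≤-reflexive (sym (cong suc (trans (sum n (g ∘ suc) (λ i h → upto (suc i) (s≤s h))) refl)))) (m≤n+m _ d))))
  where
  upto : ∀ d → d < suc n → g d ≡ true
  upto zero    _ = e
  upto (suc d) h = mono d h (upto d (<-trans (n<1+n d) h))
  sum : ∀ n (g : ℕ → Bool) → (∀ i → i < n → g i ≡ true) → rsum n (ι ∘ g) ≡ n
  sum zero    g h = refl
  sum (suc n) g h = cong₂ _+_ (cong ι (h 0 (s≤s z≤n))) (sum n (g ∘ suc) (λ i l → h (suc i) (s≤s l)))
monotone-sequence (suc n) g mono zero    d<n | false = trans e (sym (false-≤ᵇ {suc n} (s≤s (bound n (g ∘ suc)))))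
  where
  bound : ∀ n (g : ℕ → Bool) → rsum n (ι ∘ g) ≤ n
  bound n g = ≤-trans (rsum-mono n (λ i → ι≤1 (g i))) (≤-reflexive (rsum-one n))
monotone-sequence (suc n) g mono (suc d) (s≤s d<n) | false =
  trans (monotone-sequence n (g ∘ suc) (λ d h → mono (suc d) (s≤s h)) d d<n) (≤ᵇ-suc n (d + rsum n (λ i → ι (g (suc i)))))

-- Subsets of ℤₘ appear as predicates on ℕ of period m, so that indices need not be reduced.
module Periodic (m : ℕ) .{{_ : NonZero m}} where

  Period : {A : Set} → (ℕ → A) → Set
  Period f = ∀ i → f (i + m) ≡ f i

  period-multiple : ∀ {A : Set} {f : ℕ → A} → Period f → ∀ i k → f (i + k * m) ≡ f i
  period-multiple {f = f} per i zero = cong f (+-identityʳ i)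
  period-multiple {f = f} per i (suc k) = trans (cong f (regroup i m (k * m))) (trans (per (i + k * m)) (period-multiple per i k))
    where
    regroup : ∀ i m x → i + (m + x) ≡ i + x + m
    regroup = solve-∀

  period-% : ∀ {A : Set} {f : ℕ → A} → Period f → ∀ i → f i ≡ f (i % m)
  period-% {f = f} per i = trans (cong f (m≡m%n+[m/n]*n i m)) (period-multiple per (i % m) (i DivMod./ m))

  grow : (ℕ → Bool) → ℕ → Bool
  grow E i = E i ∨ E (suc i)

  end : (ℕ → Bool) → ℕ → Bool
  end E i = E i ∧ not (E (suc i))

  card : (ℕ → Bool) → ℕ
  card E = rsum m (ι ∘ E)

  card-shift : ∀ {E} → Period E → ∀ k → card (λ i → E (k + i)) ≡ card E
  card-shift per k = rsum-rotate m _ (λ i → cong ι (per i)) k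

  grow-period : ∀ {E} → Period E → Period (grow E)
  grow-period per i = cong₂ _∨_ (per i) (per (suc i))

  end-period : ∀ {E} → Period E → Period (end E)
  end-period per i = cong₂ (λ a b → a ∧ not b) (per i) (per (suc i))

  -- Each run of the set gains the point in front of it, so the gain is the number of runs, counted
  -- by their ends.
  card-grow : ∀ {E} → Period E → card (grow E) ≡ card E + card (end E)
  card-grow {E} per = trans (rsum-cong m (λ i → bits (E i) (E (suc i))))
    (trans (rsum-+ m _ _) (cong (_+ card (end E)) (card-shift per 1)))
    where
    bits : ∀ a b → ι (a ∨ b) ≡ ι b + ι (a ∧ not b)
    bits true  true  = refl
    bits true  false = refl
    bits false true  = refl
    bits false false = refl

  find-end : ∀ (E : ℕ → Bool) i j → E i ≡ true → E (i + j) ≡ false → ∃ λ k → end E k ≡ true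
  find-end E i zero    e f = ⊥-elim (true≢false e (trans (sym (cong E (+-identityʳ i))) f))
  find-end E i (suc j) e f with E (suc i) in g
  ... | true  = find-end E (suc i) j g (trans (cong E (sym (+-suc i j))) f)
  ... | false = i , true-∧ e (cong not g)

  has-end : ∀ {E} → Period E → ∀ i j → E i ≡ true → E j ≡ false → ∃ λ k → end E k ≡ true
  has-end {E} per i j e f = find-end E i (j + i * m ∸ i) e (trans (cong E (m+[n∸m]≡n i≤)) (trans (period-multiple per j i) f))
    where
    i≤ : i ≤ j + i * m
    i≤ = ≤-trans (≤-trans (≤-reflexive (sym (*-identityʳ i))) (*-monoʳ-≤ i (>-nonZero⁻¹ m))) (m≤n+m (i * m) j)

  card-term : ∀ {E} → Period E → ∀ {k} → E k ≡ true → 1 ≤ card E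
  card-term {E} per {k} e = ≤-trans (≤-reflexive (sym (cong ι (trans (sym (period-% per k)) e)))) (rsum-term m (ι ∘ E) (k % m) (m%n<n k m))

  grows : ℕ → (ℕ → Bool) → ℕ → Bool
  grows zero    E = E
  grows (suc j) E = grows j (grow E)

  grows-contains : ∀ j {E} i → grow E i ≡ true → grows (suc j) E i ≡ true
  grows-contains zero    i e = e
  grows-contains (suc j) {E} i e = grows-contains j {grow E} i (cong (_∨ grow E (suc i)) e)

  -- As long as some point is missed, a run has an end, and each step gains at least one point.
  grows-card : ∀ j {E} → Period E → ∀ i k → E i ≡ true → grows j E k ≡ false → card E + j ≤ card (grows j E)
  grows-card zero    per i k e f = ≤-reflexive (+-identityʳ _)
  grows-card (suc j) {E} per i k e f = ≤-trans
    (≤-trans (≤-reflexive (+-suc (card E) j)) (+-monoˡ-≤ j (≤-trans (≤-reflexive (+-comm 1 (card E))) (≤-trans (+-monoʳ-≤ (card E) one) (≤-reflexive (sym (card-grow per)))))))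
    (grows-card j {grow E} (grow-period {E} per) i k (cong (_∨ E (suc i)) e) f)
    where
    out : E k ≡ false
    out with E k in g
    ... | false = refl
    ... | true  = ⊥-elim (true≢false (grows-contains j {E} k (cong (_∨ E (suc k)) g)) f)
    one : 1 ≤ card (end E)
    one with has-end per i k e out
    ... | l , el = card-term (end-period per) el

  grows-member : ∀ j {E} i → grows j E i ≡ true → ∃ λ k → k ≤ j × E (i + k) ≡ true
  grows-member zero    {E} i e = 0 , z≤n , trans (cong E (+-identityʳ i)) e
  grows-member (suc j) {E} i e with grows-member j {grow E} i e
  ... | k , k≤ , g with E (i + k) in h
  ...   | true  = k , m≤n⇒m≤1+n k≤ , h
  ...   | false = suc k , s≤s k≤ , trans (cong E (+-suc i k)) g

-- Two periodic sets such that no element of the first lies s, …, m - s steps after an element of the second.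
module Separated (m : ℕ) .{{_ : NonZero m}} (s : ℕ) (1≤s : 1 ≤ s) (2s≤m : s + s ≤ m) (f f′ : ℕ → Bool)
  (f-per : Periodic.Period m f) (excluded : ∀ i e → s ≤ e → e + s ≤ m → f (i + e) ≡ true → f′ i ≡ false)
  (a b : ℕ) (fa : f a ≡ true) (f′b : f′ b ≡ true) where

  open Periodic m

  s≤m : s ≤ m
  s≤m = ≤-trans (m≤m+n s s) 2s≤m

  -- Moved by s, so that `grows gap E` holds at the points that have an element of f between s and m
  -- - s steps ahead.
  E : ℕ → Bool
  E i = f (s + i)

  gap : ℕ
  gap = m ∸ (s + s)

  gap≡ : gap + (s + s) ≡ m
  gap≡ = m∸n+n≡m 2s≤m

  E-period : Period E
  E-period i = trans (cong f (sym (+-assoc s i m))) (f-per (s + i))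

  avoids : ∀ i → grows gap E i ≡ true → f′ i ≡ false
  avoids i e with grows-member gap i e
  ... | k , k≤ , g = excluded i (s + k) (m≤m+n s k)
    (≤-trans (≤-reflexive (regroup s k)) (≤-trans (+-monoˡ-≤ (s + s) k≤) (≤-reflexive gap≡)))
    (trans (cong f (swap-terms i s k)) g)
    where
    regroup : ∀ s k → s + k + s ≡ k + (s + s)
    regroup = solve-∀
    swap-terms : ∀ i s k → i + (s + k) ≡ s + (i + k)
    swap-terms = solve-∀

  missed : grows gap E b ≡ false
  missed with grows gap E b in e
  ... | false = refl
  ... | true  = ⊥-elim (true≢false f′b (avoids b e))

  start : ℕ
  start = a + (m ∸ s)

  E-in : E start ≡ true
  E-in = trans (cong f (trans (swap-terms s a (m ∸ s)) (cong (a +_) (m+[n∸m]≡n s≤m)))) (trans (f-per a) fa)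
    where
    swap-terms : ∀ s a x → s + (a + x) ≡ a + (s + x)
    swap-terms = solve-∀

  complement : card (grows gap E) + card f′ ≤ m
  complement = ≤-trans (≤-reflexive (sym (rsum-+ m _ _))) (≤-trans (rsum-mono m bits) (≤-reflexive (rsum-one m)))
    where
    bits : ∀ i → ι (grows gap E i) + ι (f′ i) ≤ 1
    bits i with grows gap E i in e | f′ i in e′
    ... | true  | true  = ⊥-elim (true≢false e′ (avoids i e))
    ... | true  | false = ≤-refl
    ... | false | true  = ≤-refl
    ... | false | false = z≤n

  card-E : card E ≡ card f
  card-E = card-shift f-per s

  -- The set f, grown by m - 2s steps, is disjoint from f′, so |f| + (m - 2s) + |f′| ≤ m.
  bound : card f + card f′ ≤ s + s
  bound = lin 0 (+-mono-≤ (grows-card gap E-period start b E-in missed) (≤-trans complement (≤-reflexive (sym gap≡))))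
    (trans (cong (λ x → s + s + (x + gap + (card (grows gap E) + card f′))) card-E) (ring s (card f) (card f′) gap (card (grows gap E))))
    where
    ring : ∀ s x y g c → s + s + (x + g + (c + y)) ≡ x + y + (c + (g + (s + s))) + 0
    ring = solve-∀

  -- If both have size s, the first has a single end, since otherwise it would grow too fast.
  module Tight (2s<m : s + s < m) (|f| : card f ≡ s) (|f′| : card f′ ≡ s) where

    gap′ : ℕ
    gap′ = m ∸ suc (s + s)

    gap′≡ : suc gap′ + (s + s) ≡ m
    gap′≡ = trans (sym (+-suc gap′ (s + s))) (m∸n+n≡m 2s<m)

    gap≡suc : gap ≡ suc gap′
    gap≡suc = +-cancelʳ-≡ (s + s) _ _ (trans gap≡ (sym gap′≡))

    -- The first growing step gains one point per end, each later one at least one point, and m - 2s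
    -- points are available in all.
    single-end : card (end E) ≤ 1
    single-end = arith s (card (end E)) gap′ (card (grows (suc gap′) E)) (card E) (card (grow E)) m gap′≡
      (card-grow {E} E-period) (trans card-E |f|)
      (grows-card gap′ {grow E} (grow-period {E} E-period) start b (cong (_∨ E (suc start)) E-in)
        (subst (λ g → grows g E b ≡ false) gap≡suc missed))
      (subst₂ (λ g y → card (grows g E) + y ≤ m) gap≡suc |f′| complement)
      where
      arith : ∀ s e g c x y m → suc g + (s + s) ≡ m → y ≡ x + e → x ≡ s → y + g ≤ c → c + s ≤ m → e ≤ 1
      arith s e g c _ _ _ refl refl refl h h′ = lin 0 (+-mono-≤ h h′) (ring s e g c)
        where
        ring : ∀ s e g c → 1 + (s + e + g + (c + s)) ≡ e + (c + (suc g + (s + s))) + 0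
        ring = solve-∀

    out-E : E b ≡ false
    out-E with E b in g
    ... | false = refl
    ... | true  = ⊥-elim (true≢false f′b (excluded b s ≤-refl 2s≤m (trans (cong f (+-comm b s)) g)))

    e₀ : ∃ λ k → end f k ≡ true
    e₀ = shifted-end (has-end {E} E-period start b E-in out-E)
      where
      shifted-end : (∃ λ k → end E k ≡ true) → ∃ λ k → end f k ≡ true
      shifted-end (k , e) = s + k , trans (cong (λ x → f (s + k) ∧ not (f x)) (sym (+-suc s k))) e

    ends-f : card (end f) ≤ 1
    ends-f = ≤-trans (≤-reflexive (trans (sym (card-shift {end f} (end-period {f} f-per) s))
      (rsum-cong m (λ i → cong (λ x → ι (f (s + i) ∧ not (f x))) (sym (+-suc s i)))))) single-end

    e : ℕ
    e = proj₁ e₀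

    -- The set read from just after its end.
    g : ℕ → Bool
    g d = f (suc e + d)

    g-mono : ∀ d → suc d < m → g d ≡ true → g (suc d) ≡ true
    g-mono d d<m gd with g (suc d) in h
    ... | true  = refl
    ... | false = ⊥-elim (1+n≰n (≤-trans (two-ends m d<m) (≤-trans (≤-reflexive (card-shift {end f} (end-period {f} f-per) e)) ends-f)))
      where
      end-d : end f (e + suc d) ≡ true
      end-d = true-∧ (trans (cong f (+-suc e d)) gd) (cong not h)
      two-ends : ∀ n → suc d < n → 2 ≤ rsum n (λ i → ι (end f (e + i)))
      two-ends (suc n) (s≤s lt) = +-mono-≤ (≤-reflexive (sym (cong ι (trans (cong (end f) (+-identityʳ e)) (proj₂ e₀)))))
        (≤-trans (≤-reflexive (sym (cong ι end-d))) (rsum-term n (λ i → ι (end f (e + suc i))) d lt))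

    g≡ : ∀ d → d < m → g d ≡ (m ≤ᵇ d + s)
    g≡ d lt = trans (monotone-sequence m g g-mono d lt) (cong (λ x → m ≤ᵇ d + x) (trans (card-shift {f} f-per (suc e)) |f|))

    f′-out : ∀ d → d < m → g d ≡ false → f′ (suc e + d) ≡ false
    f′-out d lt h = excluded (suc e + d) j s≤j j+s≤m hit
      where
      d+s<m : d + s < m
      d+s<m = ≤ᵇ-false {m} (trans (sym (g≡ d lt)) h)
      j : ℕ
      -- The least distance j ≥ s for which d + j reaches the last s positions, which f occupies.
      j = s ⊔ (m ∸ s ∸ d)
      s≤j : s ≤ j
      s≤j = m≤m⊔n s _
      j≤ : j ≤ m ∸ s
      j≤ = ⊔-lub (m+n≤o⇒m≤o∸n s 2s≤m) (m∸n≤m (m ∸ s) d)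
      j+s≤m : j + s ≤ m
      j+s≤m = ≤-trans (+-monoˡ-≤ s j≤) (≤-reflexive (m∸n+n≡m s≤m))
      d≤m∸s : d ≤ m ∸ s
      d≤m∸s = m+n≤o⇒m≤o∸n d (<⇒≤ d+s<m)
      d+j<m : d + j < m
      d+j<m = cases (⊔-sel s (m ∸ s ∸ d))
        where
        cases : j ≡ s ⊎ j ≡ m ∸ s ∸ d → d + j < m
        cases (inj₁ x) = ≤-<-trans (≤-reflexive (cong (d +_) x)) d+s<m
        cases (inj₂ x) = ≤-<-trans (≤-reflexive (trans (cong (d +_) x) (m+[n∸m]≡n d≤m∸s)))
          (≤-trans (≤-trans (≤-reflexive (+-comm 1 (m ∸ s))) (+-monoʳ-≤ (m ∸ s) 1≤s)) (≤-reflexive (m∸n+n≡m s≤m)))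
      hit : f (suc e + d + j) ≡ true
      hit = trans (cong f (+-assoc (suc e) d j)) (trans (g≡ (d + j) d+j<m) (true-≤ᵇ (≤-trans (≤-reflexive (sym (m∸n+n≡m s≤m)))
        (+-monoˡ-≤ s (≤-trans (≤-reflexive (sym (m+[n∸m]≡n d≤m∸s))) (+-monoʳ-≤ d (m≤n⊔m s (m ∸ s ∸ d))))))))

-- Counting over thresholds, and enumeration

count-below : ∀ n k → rsum n (λ r → ι (suc r ≤ᵇ k)) ≡ n ⊓ k
count-below zero    k       = refl
count-below (suc n) zero    = trans (count-below n zero) (⊓-zeroʳ n)
count-below (suc n) (suc k) = cong suc (count-below n k)

count-above : ∀ n j → rsum n (λ r → ι (n ≤ᵇ j + r)) ≡ n ⊓ j
count-above zero    j = refl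
count-above (suc n) j = trans (cong₂ _+_ (cong (λ x → ι (suc n ≤ᵇ x)) (+-identityʳ j))
    (trans (rsum-cong n (λ r → cong ι (trans (cong (suc n ≤ᵇ_) (+-suc j r)) (sym (≤ᵇ-suc n (j + r)))))) (count-above n j))) (cases n j)
  where
  cases : ∀ n j → ι (suc n ≤ᵇ j) + n ⊓ j ≡ suc n ⊓ j
  cases n j with suc n ≤? j
  ... | yes h = trans (cong₂ (λ b x → ι b + x) (true-≤ᵇ h) (m≤n⇒m⊓n≡m (≤-trans (n≤1+n n) h))) (sym (m≤n⇒m⊓n≡m h))
  ... | no ¬h = trans (cong₂ (λ b x → ι b + x) (false-≤ᵇ {suc n} (≰⇒> ¬h)) (m≥n⇒m⊓n≡n (s≤s⁻¹ (≰⇒> ¬h)))) (sym (m≥n⇒m⊓n≡n (<⇒≤ (≰⇒> ¬h))))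

rsum-squeeze : ∀ n (f : ℕ → ℕ) W → (∀ i → i < n → f i ≤ W) → n * W ≤ rsum n f → ∀ i → i < n → f i ≡ W
rsum-squeeze (suc n) f W h e i i<n = go i i<n
  where
  rest : ∀ n (f : ℕ → ℕ) → (∀ i → i < n → f i ≤ W) → rsum n f ≤ n * W
  rest zero    f h = z≤n
  rest (suc n) f h = +-mono-≤ (h 0 (s≤s z≤n)) (rest n (f ∘ suc) (λ i l → h (suc i) (s≤s l)))
  go : ∀ i → i < suc n → f i ≡ W
  go zero _ = ≤-antisym (h 0 (s≤s z≤n)) (+-cancelʳ-≤ (n * W) W (f 0) (≤-trans e (+-monoʳ-≤ (f 0) (rest n (f ∘ suc) (λ i l → h (suc i) (s≤s l))))))
  go (suc i) (s≤s l) = rsum-squeeze n (f ∘ suc) W (λ i l → h (suc i) (s≤s l))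
    (+-cancelˡ-≤ W _ _ (≤-trans e (+-monoˡ-≤ _ (h 0 (s≤s z≤n))))) i l

rsum-bound : ∀ n (f : ℕ → ℕ) W → (∀ i → i < n → f i ≤ W) → rsum n f ≤ n * W
rsum-bound zero    f W h = z≤n
rsum-bound (suc n) f W h = +-mono-≤ (h 0 (s≤s z≤n)) (rsum-bound n (f ∘ suc) W (λ i l → h (suc i) (s≤s l)))

rsum-*ˡ : ∀ n c (f : ℕ → ℕ) → rsum n (λ i → c * f i) ≡ c * rsum n f
rsum-*ˡ zero    c f = sym (*-zeroʳ c)
rsum-*ˡ (suc n) c f = trans (cong (c * f 0 +_) (rsum-*ˡ n c (f ∘ suc))) (sym (*-distribˡ-+ c (f 0) _))

∑-rsum : ∀ {A : Set} (xs : List A) n (f : A → ℕ → ℕ) → ∑ xs (λ x → rsum n (f x)) ≡ rsum n (λ i → ∑ xs (λ x → f x i))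
∑-rsum xs zero    f = ∑-zero xs
∑-rsum xs (suc n) f = trans (∑-+ xs _ _) (cong (∑ xs (λ x → f x 0) +_) (∑-rsum xs n (λ x i → f x (suc i))))

choose : ∀ {A : Set} {P Q : A → Set} (xs : List A) → (∀ x → P x ⊎ Q x) → (∃ P) ⊎ (∀ {x} → x ∈ xs → Q x)
choose []       d = inj₂ (λ ())
choose (x ∷ xs) d with d x | choose xs d
... | inj₁ p | _      = inj₁ (x , p)
... | inj₂ _ | inj₁ r = inj₁ r
... | inj₂ y | inj₂ h = inj₂ (λ { (here refl) → y ; (there i) → h i })

-- Addition in the shape of turning l letters into bits one at a time, so that this recursion needs
-- no transport.
_⊕_ : ℕ → ℕ → ℕ
zero  ⊕ k = k
suc l ⊕ k = l ⊕ suc k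

pairs : {A B : Set} → List A → List B → List (A × B)
pairs xs ys = concatMap (λ a → map (a ,_) ys) xs

∑-pairs : {A B : Set} (xs : List A) (ys : List B) (f : A × B → ℕ) → ∑ (pairs xs ys) f ≡ ∑ xs (λ a → ∑ ys (λ b → f (a , b)))
∑-pairs xs ys f = trans (∑-concatMap _ xs f) (∑-cong xs (λ a → ∑-map (a ,_) ys f))

∈-pairs : {A B : Set} {xs : List A} {ys : List B} → (∀ a → a ∈ xs) → (∀ b → b ∈ ys) → ∀ z → z ∈ pairs xs ys
∈-pairs {ys = ys} ha hb (a , b) = ∈-concatMap⁺ (λ a → map (a ,_) ys) (member (ha a))
  where
  member : ∀ {xs} → a ∈ xs → Any (λ c → (a , b) ∈ map (c ,_) ys) xs
  member (here refl) = here (∈-map⁺ (a ,_) (hb b))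
  member (there i)   = there (member i)

zeros-⧺ : ∀ {c k} (C : V c) (v : V k) → zeros (C ⧺ v) ≡ zeros C + zeros v
zeros-⧺ []      v = refl
zeros-⧺ (a ∷ C) v = trans (cong (ι (not a) +_) (zeros-⧺ C v)) (sym (+-assoc (ι (not a)) _ _))

true-positions : ∀ {n} (v : V n) → Fin (size v) → Fin n
true-positions (true ∷ v)  zero    = zero
true-positions (true ∷ v)  (suc j) = suc (true-positions v j)
true-positions (false ∷ v) j       = suc (true-positions v j)

true-positions-injective : ∀ {n} (v : V n) → Injective _≡_ _≡_ (true-positions v)
true-positions-injective (true ∷ v)  {zero}  {zero}  e = refl
true-positions-injective (true ∷ v)  {suc i} {suc j} e = cong suc (true-positions-injective v (suc-injectiveᶠ e))
true-positions-injective (false ∷ v) e = true-positions-injective v (suc-injectiveᶠ e)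

true-positions-true : ∀ {n} (v : V n) j → lookup v (true-positions v j) ≡ true
true-positions-true (true ∷ v)  zero    = refl
true-positions-true (true ∷ v)  (suc j) = true-positions-true v j
true-positions-true (false ∷ v) j       = true-positions-true v j

rank : ∀ {n} (v : V n) i → lookup v i ≡ true → Fin (size v)
rank (true ∷ v)  zero    e = zero
rank (true ∷ v)  (suc i) e = suc (rank v i e)
rank (false ∷ v) (suc i) e = rank v i e

rank-injective : ∀ {n} (v : V n) i j (e : lookup v i ≡ true) (f : lookup v j ≡ true) → rank v i e ≡ rank v j f → i ≡ j
rank-injective (true ∷ v)  zero    zero    e f h = refl
rank-injective (true ∷ v)  (suc i) (suc j) e f h = cong suc (rank-injective v i j e f (suc-injectiveᶠ h))
rank-injective (false ∷ v) (suc i) (suc j) e f h = cong suc (rank-injective v i j e f h)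

-- All families up to pointwise equality, so that a heaviest t-intersecting one is found by search.
families : ∀ n → List (Family n)
families zero    = (λ _ → true) ∷ (λ _ → false) ∷ []
families (suc n) = map glue (pairs (families n) (families n))
  where
  glue : Family n × Family n → Family (suc n)
  glue (f , g) (true ∷ v)  = f v
  glue (f , g) (false ∷ v) = g v

families-complete : ∀ n (G : Family n) → ∃ λ H → H ∈ families n × (∀ v → H v ≡ G v)
families-complete zero G with G [] in e
... | true  = _ , here refl , λ { [] → sym e }
... | false = _ , there (here refl) , λ { [] → sym e }
families-complete (suc n) G with families-complete n (λ v → G (true ∷ v)) | families-complete n (λ v → G (false ∷ v))
... | f , f∈ , fe | g , g∈ , ge = _ , ∈-map⁺ _ (∈-pairs′ f∈ g∈) , λ { (true ∷ v) → fe v ; (false ∷ v) → ge v }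
  where
  ∈-pairs′ : {A B : Set} {xs : List A} {ys : List B} → ∀ {a b} → a ∈ xs → b ∈ ys → (a , b) ∈ pairs xs ys
  ∈-pairs′ {ys = ys} {a} {b} i j = ∈-concatMap⁺ (λ a → map (a ,_) ys) (member i)
    where
    member : ∀ {xs} → a ∈ xs → Any (λ c → (a , b) ∈ map (c ,_) ys) xs
    member (here refl) = here (∈-map⁺ (a ,_) j)
    member (there i)   = there (member i)

int? : ∀ {n} t (G : Family n) → (∃ λ v → ∃ λ u → G v ≡ true × G u ≡ true × int v u < t) ⊎ Int t G
int? {n} t G with choose (B n) (λ v → choose (B n) (λ u → pair? v u (true-or-false (G v)) (true-or-false (G u)) (t ≤? int v u)))
  where
  pair? : ∀ v u → G v ≡ true ⊎ G v ≡ false → G u ≡ true ⊎ G u ≡ false → Dec (t ≤ int v u) →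
    (G v ≡ true × G u ≡ true × int v u < t) ⊎ (G v ≡ true → G u ≡ true → t ≤ int v u)
  pair? v u (inj₂ e) _        _       = inj₂ (λ g _ → ⊥-elim (true≢false g e))
  pair? v u (inj₁ _) (inj₂ e) _       = inj₂ (λ _ g → ⊥-elim (true≢false g e))
  pair? v u (inj₁ _) (inj₁ _) (yes h) = inj₂ (λ _ _ → h)
  pair? v u (inj₁ e) (inj₁ f) (no ¬h) = inj₁ (e , f , ≰⇒> ¬h)
... | inj₁ w = inj₁ w
... | inj₂ h = inj₂ (λ v u gv gu → h (∈-B v) (∈-B u) gv gu)

maximum : {A : Set} {P : A → Set} (f : A → ℕ) (xs : List A) → (∀ x → P x ⊎ (P x → ⊥)) → (x₀ : A) → P x₀ →
  ∃ λ x → P x × f x₀ ≤ f x × (∀ {y} → y ∈ xs → P y → f y ≤ f x)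
maximum f []       d x₀ p₀ = x₀ , p₀ , ≤-refl , λ ()
maximum f (y ∷ ys) d x₀ p₀ with maximum f ys d x₀ p₀
... | x , p , le , h with d y | f y ≤? f x
...   | inj₂ ¬p | _     = x , p , le , λ { (here refl) py → ⊥-elim (¬p py) ; (there i) → h i }
...   | inj₁ py | yes l = x , p , le , λ { (here refl) _ → l ; (there i) → h i }
...   | inj₁ py | no ¬l = y , py , ≤-trans le (<⇒≤ (≰⇒> ¬l)) , λ { (here refl) _ → ≤-refl ; (there i) pz → ≤-trans (h i pz) (<⇒≤ (≰⇒> ¬l)) }

optimum : ∀ p q n t → ∃ λ (G : Family n) → Weighted.Opt p q t G
optimum p q n t with maximum μ (families n) decide (λ _ → false) (λ _ _ ())
  where
  open Weighted p q
  decide : ∀ (G : Family n) → Int t G ⊎ (Int t G → ⊥)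
  decide G with int? t G
  ... | inj₂ i                    = inj₁ i
  ... | inj₁ (v , u , gv , gu , lt) = inj₂ (λ i → <⇒≱ lt (i v u gv gu))
... | G , i , _ , h = G , i , best
  where
  open Weighted p q
  best : ∀ (H : Family n) → Int t H → μ H ≤ μ G
  best H hi with families-complete n H
  ... | H′ , H′∈ , e = ≤-trans (≤-reflexive (μ-cong (λ v → sym (e v)))) (h H′∈ (λ v u a b → hi v u (trans (sym (e v)) a) (trans (sym (e u)) b)))

count≡∑ : {A : Set} (f : A → Bool) (xs : List A) → count f xs ≡ ∑ xs (ι ∘ f)
count≡∑ f []       = refl
count≡∑ f (x ∷ xs) with f x
... | true  = cong suc (count≡∑ f xs)
... | false = count≡∑ f xs

⊕-identity : ∀ l k → l ⊕ k ≡ l + k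
⊕-identity zero    k = refl
⊕-identity (suc l) k = trans (⊕-identity l (suc k)) (+-suc l k)

-- Measures as fractions

module Fractions where

  open import Data.Integer using (+_)

  pos-≡ : ∀ a b c d → a * b ≡ c * d → (+ a) ℤ.* (+ b) ≡ (+ c) ℤ.* (+ d)
  pos-≡ a b c d e = trans (sym (ℤ.pos-* a b)) (trans (cong +_ e) (ℤ.pos-* c d))

  /-≡ : ∀ a b d e .{{_ : NonZero d}} .{{_ : NonZero e}} → a * e ≡ b * d → + a / d ≡ + b / e
  /-≡ a b (suc d) (suc e) h = ℚ.fromℚᵘ-cong {mkℚᵘ (+ a) d} {mkℚᵘ (+ b) e} (*≡* (pos-≡ a (suc e) b (suc d) h))

  /-injective : ∀ a b d .{{_ : NonZero d}} → + a / d ≡ + b / d → a ≡ b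
  /-injective a b (suc d) h with ℚᵘ.≃-trans (ℚᵘ.≃-sym (ℚ.toℚᵘ-fromℚᵘ (mkℚᵘ (+ a) d))) (ℚᵘ.≃-trans (ℚ.toℚᵘ-cong h) (ℚ.toℚᵘ-fromℚᵘ (mkℚᵘ (+ b) d)))
  ... | *≡* e = *-cancelʳ-≡ a b (suc d) (ℤ.+-injective (trans (ℤ.pos-* a (suc d)) (trans e (sym (ℤ.pos-* b (suc d))))))

  /-mono : ∀ a b d .{{_ : NonZero d}} → a ≤ b → + a / d ≤ℚ + b / d
  /-mono a b (suc d) h = ℚ.toℚᵘ-cancel-≤ (ℚᵘ.≤-respʳ-≃ (ℚᵘ.≃-sym (ℚ.toℚᵘ-fromℚᵘ (mkℚᵘ (+ b) d)))
    (ℚᵘ.≤-respˡ-≃ (ℚᵘ.≃-sym (ℚ.toℚᵘ-fromℚᵘ (mkℚᵘ (+ a) d))) (*≤* (subst₂ ℤ._≤_ (ℤ.pos-* a (suc d)) (ℤ.pos-* b (suc d)) (ℤ.+≤+ (*-monoˡ-≤ (suc d) h))))))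

  /-cancel : ∀ a b d .{{_ : NonZero d}} → + a / d ≤ℚ + b / d → a ≤ b
  /-cancel a b (suc d) h with ℚᵘ.≤-respʳ-≃ (ℚ.toℚᵘ-fromℚᵘ (mkℚᵘ (+ b) d)) (ℚᵘ.≤-respˡ-≃ (ℚ.toℚᵘ-fromℚᵘ (mkℚᵘ (+ a) d)) (ℚ.toℚᵘ-mono-≤ h))
  ... | *≤* e = *-cancelʳ-≤ a b (suc d) (ℤ.drop‿+≤+ (subst₂ ℤ._≤_ (sym (ℤ.pos-* a (suc d))) (sym (ℤ.pos-* b (suc d))) e))

  /-* : ∀ a b d e .{{_ : NonZero d}} .{{_ : NonZero e}} → (+ a / d) *ℚ (+ b / e) ≡ _/_ (+ (a * b)) (d * e) {{m*n≢0 d e}}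
  /-* a b (suc d) (suc e) = ℚ.toℚᵘ-injective (ℚᵘ.≃-trans (ℚ.toℚᵘ-homo-* (+ a / suc d) (+ b / suc e))
    (ℚᵘ.≃-trans (ℚᵘ.*-cong (ℚ.toℚᵘ-fromℚᵘ (mkℚᵘ (+ a) d)) (ℚ.toℚᵘ-fromℚᵘ (mkℚᵘ (+ b) e)))
      (ℚᵘ.≃-trans (ℚᵘ.≃-reflexive (cong (λ z → mkℚᵘ z (e + d * suc e)) (sym (ℤ.pos-* a b))))
        (ℚᵘ.≃-sym (ℚ.toℚᵘ-fromℚᵘ (mkℚᵘ (+ (a * b)) (e + d * suc e)))))))

  /-+ : ∀ a b d .{{_ : NonZero d}} → (+ a / d) +ℚ (+ b / d) ≡ + (a + b) / d
  /-+ a b (suc d) = ℚ.toℚᵘ-injective (ℚᵘ.≃-trans (ℚ.toℚᵘ-homo-+ (+ a / suc d) (+ b / suc d))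
    (ℚᵘ.≃-trans (ℚᵘ.+-cong (ℚ.toℚᵘ-fromℚᵘ (mkℚᵘ (+ a) d)) (ℚ.toℚᵘ-fromℚᵘ (mkℚᵘ (+ b) d)))
      (ℚᵘ.≃-trans (ℚᵘ.≃-trans (ℚᵘ.≃-reflexive (cong (λ z → mkℚᵘ z (d + d * suc d)) numerator)) (*≡* (pos-≡ (a * suc d + b * suc d) (suc d) (a + b) (suc d * suc d) (ring a b (suc d)))))
        (ℚᵘ.≃-sym (ℚ.toℚᵘ-fromℚᵘ (mkℚᵘ (+ (a + b)) d))))))
    where
    numerator : (+ a) ℤ.* (+ suc d) ℤ.+ (+ b) ℤ.* (+ suc d) ≡ + (a * suc d + b * suc d)
    numerator = trans (cong₂ ℤ._+_ (sym (ℤ.pos-* a (suc d))) (sym (ℤ.pos-* b (suc d)))) (sym (ℤ.pos-+ (a * suc d) (b * suc d)))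
    ring : ∀ a b d → (a * d + b * d) * d ≡ (a + b) * (d * d)
    ring = solve-∀

  /-zero : ∀ d .{{_ : NonZero d}} → + 0 / d ≡ 0ℚ
  /-zero d = /-≡ 0 0 d 1 refl

  /-one : ∀ d .{{_ : NonZero d}} → + d / d ≡ 1ℚ
  /-one d = /-≡ d 1 d 1 (*-comm d 1)

  /-complement : ∀ s m .{{_ : NonZero m}} → s ≤ m → 1ℚ -ℚ (+ s / m) ≡ + (m ∸ s) / m
  /-complement s m h = trans (cong (_-ℚ (+ s / m)) (trans (sym (/-one m)) (trans (cong (λ x → + x / m) (sym (m∸n+n≡m h))) (sym (/-+ (m ∸ s) s m)))))
    (trans (ℚ.+-assoc (+ (m ∸ s) / m) (+ s / m) (-ℚ (+ s / m))) (trans (cong ((+ (m ∸ s) / m) +ℚ_) (ℚ.+-inverseʳ (+ s / m))) (ℚ.+-identityʳ _)))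

  /-^ : ∀ a d k .{{_ : NonZero d}} → (+ a / d) ^ℚ k ≡ _/_ (+ (a ^ k)) (d ^ k) {{m^n≢0 d k}}
  /-^ a d zero    = sym (/-one 1)
  /-^ a d (suc k) {{nz}} = trans (cong ((+ a / d) *ℚ_) (/-^ a d k)) (/-* a (a ^ k) d (d ^ k) {{nz}} {{m^n≢0 d k}})

  module Measure (s m : ℕ) .{{_ : NonZero m}} (s≤m : s ≤ m) where

    open Weighted s (m ∸ s)

    wt-power : ∀ {n} (v : V n) → wt v ≡ s ^ size v * (m ∸ s) ^ (n ∸ size v)
    wt-power []          = refl
    wt-power (true ∷ v)  = trans (cong (s *_) (wt-power v)) (sym (*-assoc s _ _))
    wt-power {suc n} (false ∷ v) = trans (cong ((m ∸ s) *_) (wt-power v)) (trans (pull (m ∸ s) (s ^ size v) ((m ∸ s) ^ (n ∸ size v)))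
      (cong (λ k → s ^ size v * (m ∸ s) ^ k) (sym (+-∸-assoc 1 (size≤ v)))))
      where
      pull : ∀ x y z → x * (y * z) ≡ y * (x * z)
      pull = solve-∀

    μpSet≡ : ∀ {n} (v : V n) → μpSet n (+ s / m) v ≡ _/_ (+ wt v) (m ^ n) {{m^n≢0 m n}}
    μpSet≡ {n} v = trans (cong₂ (λ k p → ((+ s / m) ^ℚ k) *ℚ (p ^ℚ (n ∸ k))) (∣∣≡size v) (/-complement s m s≤m))
      (trans (cong₂ _*ℚ_ (/-^ s m (size v)) (/-^ (m ∸ s) m (n ∸ size v)))
        (trans (/-* (s ^ size v) ((m ∸ s) ^ (n ∸ size v)) (m ^ size v) (m ^ (n ∸ size v)) {{m^n≢0 m (size v)}} {{m^n≢0 m (n ∸ size v)}})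
          (/-≡ (s ^ size v * (m ∸ s) ^ (n ∸ size v)) (wt v) (m ^ size v * m ^ (n ∸ size v)) (m ^ n) {{m*n≢0 (m ^ size v) (m ^ (n ∸ size v)) {{m^n≢0 m (size v)}} {{m^n≢0 m (n ∸ size v)}}}} {{m^n≢0 m n}}
            (cong₂ _*_ (sym (wt-power v)) (trans (cong (m ^_) (sym (m+[n∸m]≡n (size≤ v)))) (^-distribˡ-+-* m (size v) (n ∸ size v)))))))

    -- The denominators m^k and m^(n - k) belonging to a set of size k multiply to m^n for every k.
    μp≡ : ∀ {n} (G : FamilyP n) → μp n (+ s / m) G ≡ _/_ (+ μ G) (m ^ n) {{m^n≢0 m n}}
    μp≡ {n} G = go (allSubsets n)
      where
      go : ∀ xs → foldr (λ A acc → (if G A then μpSet n (+ s / m) A else 0ℚ) +ℚ acc) 0ℚ xs ≡ _/_ (+ ∑ xs (λ v → ι (G v) * wt v)) (m ^ n) {{m^n≢0 m n}}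
      go []       = sym (/-zero (m ^ n) {{m^n≢0 m n}})
      go (v ∷ xs) = trans (cong₂ _+ℚ_ (head (G v)) (go xs)) (/-+ (ι (G v) * wt v) (∑ xs (λ u → ι (G u) * wt u)) (m ^ n) {{m^n≢0 m n}})
        where
        head : ∀ b → (if b then μpSet n (+ s / m) v else 0ℚ) ≡ _/_ (+ (ι b * wt v)) (m ^ n) {{m^n≢0 m n}}
        head true  = trans (μpSet≡ v) (cong (λ x → _/_ (+ x) (m ^ n) {{m^n≢0 m n}}) (sym (+-identityʳ (wt v))))
        head false = sym (/-zero (m ^ n) {{m^n≢0 m n}})

-- Families on ℤₘⁿ

module Cyclic (m : ℕ) .{{_ : NonZero m}} (s t : ℕ) (1≤s : 1 ≤ s) (2s≤m : s + s ≤ m) (1≤t : 1 ≤ t) where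

  at : ℕ → Fin m
  at i = i mod m

  toℕ-at : ∀ i → toℕ (at i) ≡ i % m
  toℕ-at i = toℕ-fromℕ< (m%n<n i m)

  at-toℕ : ∀ a → at (toℕ a) ≡ a
  at-toℕ a = toℕ-injective (trans (toℕ-at (toℕ a)) (m<n⇒m%n≡m (toℕ<n a)))

  at-period : ∀ i → at (i + m) ≡ at i
  at-period i = toℕ-injective (trans (toℕ-at (i + m)) (trans ([m+n]%n≡m%n i m) (sym (toℕ-at i))))

  diff-spec : ∀ (a b : Fin m) → diffMod a b < m × (toℕ a ≡ toℕ b + diffMod a b ⊎ toℕ a + m ≡ toℕ b + diffMod a b)
  diff-spec a b with toℕ b ≤ᵇ toℕ a in e
  ... | true  = ≤-<-trans (m∸n≤m (toℕ a) (toℕ b)) (toℕ<n a) , inj₁ (sym (m+[n∸m]≡n (≤ᵇ-true {toℕ b} e)))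
  ... | false = lin 0 (≤-trans (≤-reflexive (cong suc (m+[n∸m]≡n le))) (+-monoˡ-≤ m (≤ᵇ-false {toℕ b} e))) (ring m (toℕ b) _) , inj₂ (sym (m+[n∸m]≡n le))
    where
    le : toℕ b ≤ toℕ a + m
    le = ≤-trans (<⇒≤ (toℕ<n b)) (m≤n+m m (toℕ a))
    ring : ∀ m b d → m + suc (b + d) ≡ suc d + (b + m) + 0
    ring = solve-∀

  diff-unique : ∀ (a b : Fin m) k → k < m → toℕ a ≡ toℕ b + k ⊎ toℕ a + m ≡ toℕ b + k → diffMod a b ≡ k
  diff-unique a b k k<m h with diff-spec a b | h
  ... | d<m , inj₁ e | inj₁ f = +-cancelˡ-≡ (toℕ b) _ k (trans (sym e) f)
  ... | d<m , inj₂ e | inj₂ f = +-cancelˡ-≡ (toℕ b) _ k (trans (sym e) f)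
  ... | d<m , inj₁ e | inj₂ f = ⊥-elim (<⇒≱ k<m (+-cancelˡ-≤ (toℕ b) m k (≤-trans (+-monoˡ-≤ m (≤-trans (m≤m+n (toℕ b) _) (≤-reflexive (sym e)))) (≤-reflexive f))))
  ... | d<m , inj₂ e | inj₁ f = ⊥-elim (<⇒≱ d<m (+-cancelˡ-≤ (toℕ b) m _ (≤-trans (+-monoˡ-≤ m (≤-trans (m≤m+n (toℕ b) _) (≤-reflexive (sym f)))) (≤-reflexive e))))

  diff-at : ∀ i e → e < m → diffMod (at (i + e)) (at i) ≡ e
  diff-at i e e<m = diff-unique (at (i + e)) (at i) e e<m (cases (suc (i % m + e) ≤? m))
    where
    sum : toℕ (at (i + e)) ≡ (i % m + e) % m
    sum = trans (toℕ-at (i + e)) (trans (%-distribˡ-+ i e m) (cong (λ x → (i % m + x) % m) (m<n⇒m%n≡m e<m)))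
    cases : Dec (i % m + e < m) → _
    cases (yes h) = inj₁ (trans sum (trans (m<n⇒m%n≡m h) (cong (_+ e) (sym (toℕ-at i)))))
    cases (no ¬h) = inj₂ (trans (cong (_+ m) (trans sum (trans (sym (m≤n⇒[n∸m]%m≡n%m h)) (m<n⇒m%n≡m small))))
        (trans (m∸n+n≡m h) (cong (_+ e) (sym (toℕ-at i)))))
      where
      h : m ≤ i % m + e
      h = ≮⇒≥ ¬h
      small : i % m + e ∸ m < m
      small = +-cancelʳ-< m _ m (≤-<-trans (≤-reflexive (m∸n+n≡m h)) (+-mono-< (m%n<n i m) e<m))

  at-diff : ∀ i v → at (i + diffMod v (at i)) ≡ v
  at-diff i v with diff-spec v (at i)
  ... | d<m , h = toℕ-injective (trans (toℕ-at (i + diffMod v (at i))) (trans (%-distribˡ-+ i _ m)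
      (trans (cong₂ (λ x y → (x + y) % m) (sym (toℕ-at i)) (m<n⇒m%n≡m d<m)) (reduce h))))
    where
    reduce : ∀ {x} → toℕ v ≡ x ⊎ toℕ v + m ≡ x → x % m ≡ toℕ v
    reduce (inj₁ refl) = m<n⇒m%n≡m (toℕ<n v)
    reduce (inj₂ refl) = trans ([m+n]%n≡m%n (toℕ v) m) (m<n⇒m%n≡m (toℕ<n v))

  -- Stated negatively: the difference does not lie between s and m - s. In this form far letters
  -- are easy to exhibit.
  close : Fin m → Fin m → Bool
  close a b = not ((s ≤ᵇ diffMod a b) ∧ (diffMod a b + s ≤ᵇ m))

  In : Fin m → Fin m → Bool
  In y v = (1 ≤ᵇ diffMod v y) ∧ (diffMod v y ≤ᵇ s)

  s≤m : s ≤ m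
  s≤m = ≤-trans (m≤m+n s s) 2s≤m

  0<m : 0 < m
  0<m = ≤-trans 1≤s s≤m

  close⇒ : ∀ a b → close a b ≡ true → CloseUpTo s a b
  close⇒ a b c with diff-spec a b | s ≤ᵇ diffMod a b in e₁ | diffMod a b + s ≤ᵇ m in e₂
  ... | d<m , inj₁ e | false | _     = diffMod a b , ≤ᵇ-false {s} e₁ , inj₁ e
  ... | d<m , inj₂ e | false | _     = diffMod a b , ≤ᵇ-false {s} e₁ , inj₂ (inj₁ e)
  ... | d<m , h      | true  | false = m ∸ diffMod a b , small , inj₂ (inj₂ (back h))
    where
    small : m ∸ diffMod a b < s
    small = +-cancelˡ-< (diffMod a b) _ s (≤-<-trans (≤-reflexive (m+[n∸m]≡n (<⇒≤ d<m))) (≤ᵇ-false {diffMod a b + s} e₂))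
    back : toℕ a ≡ toℕ b + diffMod a b ⊎ toℕ a + m ≡ toℕ b + diffMod a b →
      toℕ b ≡ toℕ a + (m ∸ diffMod a b) ⊎ toℕ b + m ≡ toℕ a + (m ∸ diffMod a b)
    back (inj₁ e) = inj₂ (sym (trans (cong (_+ (m ∸ diffMod a b)) e) (trans (+-assoc (toℕ b) _ _) (cong (toℕ b +_) (m+[n∸m]≡n (<⇒≤ d<m))))))
    back (inj₂ e) = inj₁ (+-cancelʳ-≡ (diffMod a b) _ _ (sym (trans (+-assoc (toℕ a) _ _) (trans (cong (toℕ a +_) (m∸n+n≡m (<⇒≤ d<m))) e))))

  ⇒close : ∀ a b → CloseUpTo s a b → close a b ≡ true
  ⇒close a b (k , k<s , h) = cases h
    where
    k<m : k < m
    k<m = <-≤-trans k<s s≤m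
    nearby : diffMod a b ≡ k → close a b ≡ true
    nearby e = cong (λ x → not (x ∧ (diffMod a b + s ≤ᵇ m))) (false-≤ᵇ {s} (≤-<-trans (≤-reflexive e) k<s))
    far : 1 ≤ k → diffMod a b ≡ m ∸ k → close a b ≡ true
    far 1≤k e = cong not (trans (cong ((s ≤ᵇ diffMod a b) ∧_) (false-≤ᵇ {diffMod a b + s}
      (≤-<-trans (≤-reflexive (sym (m∸n+n≡m (<⇒≤ k<m)))) (<-≤-trans (+-monoʳ-< (m ∸ k) k<s) (≤-reflexive (cong (_+ s) (sym e))))))) (Bool.∧-zeroʳ (s ≤ᵇ diffMod a b)))
    wrap : 1 ≤ k → toℕ a ≡ toℕ b + (m ∸ k) ⊎ toℕ a + m ≡ toℕ b + (m ∸ k) → close a b ≡ true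
    wrap 1≤k h = far 1≤k (diff-unique a b (m ∸ k) (∸-monoʳ-< {m} {k} {0} 1≤k (<⇒≤ k<m)) h)
    cases : _ → close a b ≡ true
    cases (inj₁ e)        = nearby (diff-unique a b k k<m (inj₁ e))
    cases (inj₂ (inj₁ e)) = nearby (diff-unique a b k k<m (inj₂ e))
    cases (inj₂ (inj₂ (inj₁ e))) with k ≟ 0
    ... | yes refl = nearby (diff-unique a b 0 0<m (inj₁ (sym (trans (+-identityʳ _) (trans e (+-identityʳ _))))))
    ... | no k≢0   = wrap (n≢0⇒n>0 k≢0) (inj₂ (trans (cong (toℕ a +_) (sym (m+[n∸m]≡n (<⇒≤ k<m)))) (trans (sym (+-assoc (toℕ a) k _)) (cong (_+ (m ∸ k)) (sym e)))))
    cases (inj₂ (inj₂ (inj₂ e))) with k ≟ 0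
    ... | yes refl = ⊥-elim (<⇒≱ (toℕ<n a) (≤-trans (m≤n+m m (toℕ b)) (≤-reflexive (trans e (+-identityʳ _)))))
    ... | no k≢0   = wrap (n≢0⇒n>0 k≢0) (inj₁ (+-cancelʳ-≡ k _ _ (trans (sym e) (sym (trans (+-assoc (toℕ b) _ k) (cong (toℕ b +_) (m∸n+n≡m (<⇒≤ k<m))))))))

  far-apart : ∀ i e → s ≤ e → e + s ≤ m → close (at (i + e)) (at i) ≡ false
  far-apart i e s≤e e+s≤m = cong not (trans (cong (λ d → (s ≤ᵇ d) ∧ (d + s ≤ᵇ m)) (diff-at i e e<m)) (true-∧ (true-≤ᵇ s≤e) (true-≤ᵇ e+s≤m)))
    where
    e<m : e < m
    e<m = <-≤-trans (m<m+n e 1≤s) e+s≤m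

  close-sym : ∀ a b → close a b ≡ false → close b a ≡ false
  close-sym a b e with close b a in f
  ... | false = refl
  ... | true  = ⊥-elim (true≢false (⇒close a b (flip (close⇒ b a f))) e)
    where
    flip : CloseUpTo s b a → CloseUpTo s a b
    flip (k , l , inj₁ x)               = k , l , inj₂ (inj₂ (inj₁ x))
    flip (k , l , inj₂ (inj₁ x))        = k , l , inj₂ (inj₂ (inj₂ x))
    flip (k , l , inj₂ (inj₂ (inj₁ x))) = k , l , inj₁ x
    flip (k , l , inj₂ (inj₂ (inj₂ x))) = k , l , inj₂ (inj₁ x)

  In-at : ∀ i e → e < m → In (at i) (at (i + e)) ≡ (1 ≤ᵇ e) ∧ (e ≤ᵇ s)
  In-at i e h = cong (λ d → (1 ≤ᵇ d) ∧ (d ≤ᵇ s)) (diff-at i e h)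

  In-before : ∀ i → In (at i) (at (i + m)) ≡ false
  In-before i = trans (cong (In (at i)) (trans (at-period i) (cong at (sym (+-identityʳ i))))) (In-at i 0 0<m)

  In-inside : ∀ i e → 1 ≤ e → e ≤ s → In (at i) (at (i + e)) ≡ true
  In-inside i e 1≤e e≤s = trans (In-at i e (≤-<-trans e≤s (<-≤-trans (m<m+n s 1≤s) 2s≤m))) (true-∧ (true-≤ᵇ {1} 1≤e) (true-≤ᵇ e≤s))

  In-beyond : ∀ i e → s < e → e ≤ m → In (at i) (at (i + e)) ≡ false
  In-beyond i e s<e e≤m with m≤n⇒m<n∨m≡n e≤m
  ... | inj₂ refl = In-before i
  ... | inj₁ e<m  = trans (In-at i e e<m) (trans (cong ((1 ≤ᵇ e) ∧_) (false-≤ᵇ {e} s<e)) (Bool.∧-zeroʳ (1 ≤ᵇ e)))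

  In⁻ : ∀ y v → In y v ≡ true → 1 ≤ diffMod v y × diffMod v y ≤ s
  In⁻ y v e = ≤ᵇ-true {1} (proj₁ (∧-true e)) , ≤ᵇ-true (proj₂ (∧-true {1 ≤ᵇ diffMod v y} e))

  In⁻-false : ∀ y v → In y v ≡ false → ∃ λ J → s < J × J ≤ m × at (toℕ y + J) ≡ v
  In⁻-false y v e = cases (diffMod v y) refl
    where
    eq : at (toℕ y + diffMod v y) ≡ v
    eq = trans (cong (λ z → at (toℕ y + diffMod v z)) (sym (at-toℕ y))) (at-diff (toℕ y) v)
    cases : ∀ j → diffMod v y ≡ j → ∃ λ J → s < J × J ≤ m × at (toℕ y + J) ≡ v
    -- Offset 0 is read as m, so that every letter outside the window has an offset above s.
    cases zero    d = m , <-≤-trans (m<m+n s 1≤s) 2s≤m , ≤-refl ,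
      trans (at-period (toℕ y)) (trans (cong at (trans (sym (+-identityʳ (toℕ y))) (cong (toℕ y +_) (sym d)))) eq)
    cases (suc j) d = suc j , big (suc j ≤? s) , <⇒≤ (subst (_< m) d (proj₁ (diff-spec v y))) , trans (cong (λ z → at (toℕ y + z)) (sym d)) eq
      where
      big : Dec (suc j ≤ s) → s < suc j
      big (no h)  = ≰⇒> h
      big (yes h) = ⊥-elim (true≢false (trans (cong (λ z → (1 ≤ᵇ z) ∧ (z ≤ᵇ s)) d) (true-≤ᵇ h)) e)

  -- The letter s steps further lies beyond the window; since 2s ≤ m it wraps at most to y itself,
  -- which is outside.
  far-out : ∀ y v → In y v ≡ true → ∃ λ u → In y u ≡ false × close v u ≡ false
  far-out y v e = at (toℕ y + (j + s)) ,
    trans (cong (λ z → In z (at (toℕ y + (j + s)))) (sym (at-toℕ y))) (In-beyond (toℕ y) (j + s) (≤-trans (≤-reflexive (+-comm 1 s)) (≤-trans (+-monoʳ-≤ s 1≤j) (≤-reflexive (+-comm s j)))) (≤-trans (+-monoˡ-≤ s j≤s) 2s≤m)) ,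
    close-sym _ v (subst₂ (λ a b → close a b ≡ false) (cong at (+-assoc (toℕ y) j s)) v≡ (far-apart (toℕ y + j) s ≤-refl 2s≤m))
    where
    j = diffMod v y
    1≤j = proj₁ (In⁻ y v e)
    j≤s = proj₂ (In⁻ y v e)
    v≡ : at (toℕ y + j) ≡ v
    v≡ = trans (cong (λ z → at (toℕ y + diffMod v z)) (sym (at-toℕ y))) (at-diff (toℕ y) v)

  -- For v at offset J from y, s steps back is far enough if this lands in the window. Otherwise J >
  -- 2s, and the last window letter is J - s steps away, which lies between s and m - s.
  far-in : ∀ y v → In y v ≡ false → ∃ λ u → In y u ≡ true × close v u ≡ false
  far-in y v e with In⁻-false y v e
  ... | J , s<J , J≤m , v≡ with J ∸ s ≤? s
  ...   | yes h = at (toℕ y + (J ∸ s)) ,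
    trans (cong (λ z → In z (at (toℕ y + (J ∸ s)))) (sym (at-toℕ y))) (In-inside (toℕ y) (J ∸ s) (m<n⇒0<n∸m s<J) h) ,
    subst (λ a → close a (at (toℕ y + (J ∸ s))) ≡ false) (trans (cong at (trans (+-assoc (toℕ y) (J ∸ s) s) (cong (toℕ y +_) (m∸n+n≡m (<⇒≤ s<J))))) v≡)
      (far-apart (toℕ y + (J ∸ s)) s ≤-refl 2s≤m)
  ...   | no h = at (toℕ y + s) ,
    trans (cong (λ z → In z (at (toℕ y + s))) (sym (at-toℕ y))) (In-inside (toℕ y) s 1≤s ≤-refl) ,
    subst (λ a → close a (at (toℕ y + s)) ≡ false) (trans (cong at (trans (+-assoc (toℕ y) s (J ∸ s)) (cong (toℕ y +_) (m+[n∸m]≡n (<⇒≤ s<J))))) v≡)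
      (far-apart (toℕ y + s) (J ∸ s) (<⇒≤ (≰⇒> h)) (≤-trans (≤-reflexive (m∸n+n≡m (<⇒≤ s<J))) J≤m))

  -- Cross-close subsets of ℤₘ

  open Periodic m

  card-Fin : (Fin m → Bool) → ℕ
  card-Fin S = ∑ (allFin m) (ι ∘ S)

  card-at : ∀ S → card-Fin S ≡ card (S ∘ at)
  card-at S = rsum-allFin m (ι ∘ S ∘ at) (ι ∘ S) (λ a → cong (ι ∘ S) (at-toℕ a))

  Cross : (S S′ : Fin m → Bool) → Set
  Cross S S′ = ∀ a b → S a ≡ true → S′ b ≡ true → close a b ≡ true

  periodic : ∀ (S : Fin m → Bool) → Period (S ∘ at)
  periodic S i = cong S (at-period i)

  cross-excluded : ∀ {S S′} → Cross S S′ → ∀ i e → s ≤ e → e + s ≤ m → S (at (i + e)) ≡ true → S′ (at i) ≡ false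
  cross-excluded {S} {S′} cross i e h h′ g = decide (S′ (at i)) refl
    where
    decide : ∀ x → S′ (at i) ≡ x → S′ (at i) ≡ false
    decide false g′ = g′
    decide true  g′ = ⊥-elim (true≢false (cross (at (i + e)) (at i) g g′) (far-apart i e h h′))

  cross-bound : ∀ {S S′} → Cross S S′ → (∃ λ a → S a ≡ true) → (∃ λ b → S′ b ≡ true) → card-Fin S + card-Fin S′ ≤ s + s
  cross-bound {S} {S′} cross (a , Sa) (b , S′b) = subst₂ (λ x y → x + y ≤ s + s) (sym (card-at S)) (sym (card-at S′))
    (Separated.bound m s 1≤s 2s≤m (S ∘ at) (S′ ∘ at) (periodic S) (cross-excluded {S} {S′} cross) (toℕ a) (toℕ b)
      (trans (cong S (at-toℕ a)) Sa) (trans (cong S′ (at-toℕ b)) S′b))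

  element : ∀ {T : Fin m → Bool} → 1 ≤ card-Fin T → ∃ λ a → T a ≡ true
  element {T} e with search (allFin m) T
  ... | inj₁ x = x
  ... | inj₂ none = ⊥-elim (1+n≰n (≤-trans e (≤-reflexive (trans (∑-cong (allFin m) (λ a → cong ι (none (∈-allFin a)))) (∑-zero (allFin m))))))

  -- Read from just after e, the last s of the m letters end at e, so they form the window with base
  -- e - s, written e + (m - s).
  window-of : ∀ e d → d < m → In (at (e + (m ∸ s))) (at (suc e + d)) ≡ (m ≤ᵇ d + s)
  window-of e d lt = cases (m ≤ᵇ d + s) refl
    where
    cases : ∀ x → (m ≤ᵇ d + s) ≡ x → In (at (e + (m ∸ s))) (at (suc e + d)) ≡ (m ≤ᵇ d + s)
    cases true h = trans (trans (cong (λ x → In (at (e + (m ∸ s))) (at x)) (sym shift≡))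
        (In-inside (e + (m ∸ s)) (suc d ∸ (m ∸ s)) (m<n⇒0<n∸m (s≤s low)) small)) (sym h)
      where
      low : m ∸ s ≤ d
      low = ≤-trans (∸-monoˡ-≤ s (≤ᵇ-true {m} h)) (≤-reflexive (m+n∸n≡m d s))
      shift≡ : e + (m ∸ s) + (suc d ∸ (m ∸ s)) ≡ suc e + d
      shift≡ = trans (+-assoc e _ _) (trans (cong (e +_) (m+[n∸m]≡n (m≤n⇒m≤1+n low))) (+-suc e d))
      small : suc d ∸ (m ∸ s) ≤ s
      small = ≤-trans (∸-monoˡ-≤ (m ∸ s) lt) (≤-reflexive (m∸[m∸n]≡n s≤m))
    cases false h = trans (trans (cong (In (at (e + (m ∸ s)))) wrap) (In-beyond (e + (m ∸ s)) (suc d + s) (s≤s (m≤n+m s d)) (≤ᵇ-false {m} h))) (sym h)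
      where
      wrap : at (suc e + d) ≡ at (e + (m ∸ s) + (suc d + s))
      wrap = trans (sym (at-period (suc e + d))) (cong at (trans (cong (suc e + d +_) (sym (m∸n+n≡m s≤m))) (ring e d (m ∸ s) s)))
        where
        ring : ∀ e d x s → suc e + d + (x + s) ≡ e + x + (suc d + s)
        ring = solve-∀

  -- Tightness makes S an arc of s letters, and S′ has nothing off this arc; equal sizes then give
  -- equality.
  cross-window : s + s < m → ∀ {S S′} → Cross S S′ → card-Fin S ≡ s → card-Fin S′ ≡ s →
    (∃ λ y → ∀ v → S v ≡ In y v) × (∀ v → S v ≡ S′ v)
  cross-window 2s<m {S} {S′} cross |S| |S′| = (at (T.e + (m ∸ s)) , window) , agree
    where
    ea = element {S} (≤-trans 1≤s (≤-reflexive (sym |S|)))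
    eb = element {S′} (≤-trans 1≤s (≤-reflexive (sym |S′|)))
    module T = Separated.Tight m s 1≤s 2s≤m (S ∘ at) (S′ ∘ at) (periodic S) (cross-excluded {S} {S′} cross) (toℕ (proj₁ ea)) (toℕ (proj₁ eb))
      (trans (cong S (at-toℕ (proj₁ ea))) (proj₂ ea)) (trans (cong S′ (at-toℕ (proj₁ eb))) (proj₂ eb))
      2s<m (trans (sym (card-at S)) |S|) (trans (sym (card-at S′)) |S′|)
    position : ∀ v → ∃ λ d → d < m × at (suc T.e + d) ≡ v
    position v = diffMod v (at (suc T.e)) , proj₁ (diff-spec v (at (suc T.e))) , at-diff (suc T.e) v
    window : ∀ v → S v ≡ In (at (T.e + (m ∸ s))) v
    window v = subst (λ u → S u ≡ In (at (T.e + (m ∸ s))) u) (proj₂ (proj₂ (position v)))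
      (trans (T.g≡ d lt) (sym (window-of T.e d lt)))
      where
      d = proj₁ (position v)
      lt = proj₁ (proj₂ (position v))
    contained : ∀ v → S′ v ≡ true → S v ≡ true
    contained v h′ = decide (S v) refl
      where
      decide : ∀ x → S v ≡ x → S v ≡ true
      decide true  h = h
      decide false h = ⊥-elim (true≢false h′ (subst (λ u → S′ u ≡ false) (proj₂ (proj₂ (position v)))
        (T.f′-out (proj₁ (position v)) (proj₁ (proj₂ (position v))) (trans (cong S (proj₂ (proj₂ (position v)))) h))))
    agree : ∀ v → S v ≡ S′ v
    agree v = sym (bool-ext (contained v) back)
      where
      back : S v ≡ true → S′ v ≡ true
      back h = decide (S′ v) refl
        where
        decide : ∀ x → S′ v ≡ x → S′ v ≡ true
        decide true  h′ = h′
        decide false h′ = ⊥-elim (1+n≰n (≤-trans (≤-reflexive (sym (cong ι h))) (≤-trans (≤-reflexive (sym (∑-squeeze {xs = allFin m} {ι ∘ S′} {ι ∘ S}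
          (λ u → ι-mono (contained u)) (≤-reflexive (trans |S| (sym |S′|))) (∈-allFin v)))) (≤-reflexive (cong ι h′)))))

  -- Replacing a line by bits, and averaging

  q : ℕ
  q = m ∸ s

  s+q≡m : s + q ≡ m
  s+q≡m = m+[n∸m]≡n s≤m

  s≤q : s ≤ q
  s≤q = m+n≤o⇒m≤o∸n s 2s≤m

  card≤m : ∀ S → card-Fin S ≤ m
  card≤m S = ≤-trans (∑-mono (allFin m) (λ a → ι≤1 (S a))) (≤-reflexive (trans (rsum-allFin m (λ _ → 1) (λ _ → 1) (λ _ → refl)) (rsum-one m)))

  -- The line through a point with k elements becomes a subset of {0, 1}, depending on a threshold r.
  bit-of : ℕ → Bool → ℕ → Bool
  bit-of r true  k = r ≤ᵇ k
  bit-of r false k = s + s + 1 ≤ᵇ k + r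

  weight-of : ℕ → ℕ → ℕ
  weight-of r k = s * ι (bit-of r true k) + q * ι (bit-of r false k)

  total : ℕ → ℕ
  total k = rsum s (λ r → weight-of (suc r) k)

  total≡ : ∀ k → total k ≡ s * (s ⊓ k) + q * rsum s (λ r → ι (s + s ≤ᵇ k + r))
  total≡ k = trans (rsum-+ s _ _) (cong₂ _+_ (trans (rsum-*ˡ s s _) (cong (s *_) (count-below s k)))
    (trans (rsum-*ˡ s q _) (cong (q *_) (rsum-cong s (λ r → cong ι (shift r))))))
    where
    step : ∀ c x → (c ≤ᵇ x) ≡ (c + 1 ≤ᵇ suc x)
    step c x = trans (≤ᵇ-suc c x) (cong (_≤ᵇ suc x) (+-comm 1 c))
    shift : ∀ r → bit-of (suc r) false k ≡ (s + s ≤ᵇ k + r)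
    shift r = trans (cong (s + s + 1 ≤ᵇ_) (+-suc k r)) (sym (step (s + s) (k + r)))

  -- The true bit contributes its full s * s from k = s on. Of the further elements, the first s are
  -- worth q each and the rest nothing.
  total-large : ∀ j → total (s + j) ≡ s * s + q * (s ⊓ j)
  total-large j = trans (total≡ (s + j)) (cong₂ (λ x y → s * x + q * y) (m≤n⇒m⊓n≡m (m≤m+n s j))
    (trans (rsum-cong s (λ r → cong ι (trans (cong (s + s ≤ᵇ_) (+-assoc s j r)) (cancel s s (j + r))))) (count-above s j)))
    where
    cancel : ∀ a b c → (a + b ≤ᵇ a + c) ≡ (b ≤ᵇ c)
    cancel zero    b c = refl
    cancel (suc a) b c = trans (sym (≤ᵇ-suc (a + b) (a + c))) (cancel a b c)

  -- Beyond s, the j = k - s further elements are worth q min(s, j), and this is at least s j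
  -- because both s and j are at most q.
  total-≥ : ∀ k → k ≤ m → s * k ≤ total k
  total-≥ k k≤m with s ≤? k
  ... | no ¬h = ≤-trans (≤-trans (≤-reflexive (cong (s *_) (sym (m≥n⇒m⊓n≡n (<⇒≤ (≰⇒> ¬h)))))) (m≤m+n _ _)) (≤-reflexive (sym (total≡ k)))
  ... | yes h = subst (λ k → s * k ≤ total k) (m+[n∸m]≡n h) (≤-trans (≤-reflexive (*-distribˡ-+ s s (k ∸ s)))
    (≤-trans (+-monoʳ-≤ (s * s) (cases (k ∸ s) (∸-monoˡ-≤ s k≤m))) (≤-reflexive (sym (total-large (k ∸ s))))))
    where
    cases : ∀ j → j ≤ q → s * j ≤ q * (s ⊓ j)
    cases j j≤q with ≤-total s j
    ... | inj₁ s≤j = ≤-trans (*-monoʳ-≤ s j≤q) (≤-reflexive (trans (*-comm s q) (cong (q *_) (sym (m≤n⇒m⊓n≡m s≤j)))))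
    ... | inj₂ j≤s = ≤-trans (*-monoˡ-≤ j s≤q) (≤-reflexive (cong (q *_) (sym (m≥n⇒m⊓n≡n j≤s))))

  Strict : Set
  Strict = s + s < m ⊎ (m ≡ 2 × s ≡ 1)

  total-tight : Strict → ∀ k → k ≤ m → total k ≤ s * k → k ≤ s ⊎ k ≡ m
  total-tight (inj₂ (refl , refl)) zero _ _ = inj₁ z≤n
  total-tight (inj₂ (refl , refl)) (suc zero) _ _ = inj₁ ≤-refl
  total-tight (inj₂ (refl , refl)) (suc (suc zero)) _ _ = inj₂ refl
  total-tight (inj₂ (refl , refl)) (suc (suc (suc k))) (s≤s (s≤s ())) _
  total-tight (inj₁ 2s<m) k k≤m e with s ≤? k
  ... | no ¬h = inj₁ (<⇒≤ (≰⇒> ¬h))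
  ... | yes h = cases (k ∸ s) (m+[n∸m]≡n h) (∸-monoˡ-≤ s k≤m)
      (+-cancelˡ-≤ (s * s) _ _ (≤-trans (≤-reflexive (sym (total-large (k ∸ s)))) (≤-trans (subst (λ k → total k ≤ s * k) (sym (m+[n∸m]≡n h)) e) (≤-reflexive (*-distribˡ-+ s s (k ∸ s))))))
    where
    s<q : s < q
    s<q = m+n≤o⇒m≤o∸n (suc s) 2s<m
    cases : ∀ j → s + j ≡ k → j ≤ q → q * (s ⊓ j) ≤ s * j → k ≤ s ⊎ k ≡ m
    cases zero    e _   _ = inj₁ (≤-reflexive (trans (sym e) (+-identityʳ s)))
    cases (suc j) e j≤q le with ≤-total s (suc j)
    ... | inj₁ s≤j = inj₂ (trans (sym e) (trans (cong (s +_) (≤-antisym j≤q (*-cancelˡ-≤ s {{>-nonZero 1≤s}}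
        (≤-trans (≤-reflexive (trans (*-comm s q) (cong (q *_) (sym (m≤n⇒m⊓n≡m s≤j))))) le)))) s+q≡m))
    ... | inj₂ j≤s = ⊥-elim (<⇒≱ (*-monoˡ-< (suc j) s<q) (≤-trans (≤-reflexive (cong (q *_) (sym (m≥n⇒m⊓n≡n j≤s)))) le))

  cross? : ∀ S S′ → (∃ λ a → ∃ λ b → S a ≡ true × S′ b ≡ true × close a b ≡ false) ⊎ Cross S S′
  cross? S S′ = finish (choose (allFin m) (λ a → row a (search (allFin m) (λ b → S a ∧ (S′ b ∧ not (close a b))))))
    where
    Witness : Fin m → Set
    Witness a = ∃ λ b → S a ≡ true × S′ b ≡ true × close a b ≡ false
    row : ∀ a → (∃ λ b → S a ∧ (S′ b ∧ not (close a b)) ≡ true) ⊎ (∀ {b} → b ∈ allFin m → S a ∧ (S′ b ∧ not (close a b)) ≡ false) →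
      Witness a ⊎ (∀ b → S a ≡ true → S′ b ≡ true → close a b ≡ true)
    row a (inj₁ (b , e)) = inj₁ (b , proj₁ (∧-true e) , proj₁ (∧-true (proj₂ (∧-true {S a} e))) , not-true (proj₂ (∧-true {S′ b} (proj₂ (∧-true {S a} e)))))
    row a (inj₂ none)    = inj₂ (λ b x y → not-false (trans (sym (cong₂ (λ u v → u ∧ (v ∧ not (close a b))) x y)) (none (∈-allFin b))))
    finish : (∃ Witness) ⊎ (∀ {a} → a ∈ allFin m → ∀ b → S a ≡ true → S′ b ≡ true → close a b ≡ true) → _
    finish (inj₁ w) = inj₁ w
    finish (inj₂ h) = inj₂ (λ a b → h (∈-allFin a) b)

  module Step {X : Set} (A : X → X → ℕ) (t : ℕ) where

    Agreeing : (Fin m → X → Bool) → Set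
    Agreeing F = ∀ a x a′ x′ → F a x ≡ true → F a′ x′ ≡ true → t ≤ ι (close a a′) + A x x′

    size-at : (Fin m → X → Bool) → X → ℕ
    size-at F x = card-Fin (λ a → F a x)

    compress : ℕ → (Fin m → X → Bool) → Bool → X → Bool
    compress r F c x = bit-of r c (size-at F x)

    bit-size : ∀ r c k → 1 ≤ r → r ≤ s → bit-of r c k ≡ true → r ≤ k
    bit-size r true  k _ _   e = ≤ᵇ-true {r} e
    bit-size r false k _ r≤s e = +-cancelʳ-≤ r r k (≤-trans (≤-trans (+-mono-≤ r≤s r≤s) (m≤m+n (s + s) 1)) (≤ᵇ-true {s + s + 1} e))

    bit-large : ∀ r c c′ k k′ → 1 ≤ r → r ≤ s → c ∧ c′ ≡ false → bit-of r c k ≡ true → bit-of r c′ k′ ≡ true → s + s < k + k′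
    bit-large r false c′ k k′ h h′ _ e e′ = ≤-trans (≤-reflexive (+-comm 1 (s + s))) (≤-trans (≤ᵇ-true {s + s + 1} e) (+-monoʳ-≤ k (bit-size r c′ k′ h h′ e′)))
    bit-large r true false k k′ h h′ _ e e′ = ≤-trans (≤-reflexive (+-comm 1 (s + s))) (≤-trans (≤ᵇ-true {s + s + 1} e′)
      (≤-trans (≤-reflexive (+-comm k′ r)) (+-monoˡ-≤ k′ (≤ᵇ-true {r} e))))

    -- If the two lines are not cross-close, a far pair shows that the remaining coordinates agree t
    -- times. If they are, their sizes add up to at most 2s, whereas bits that are not both 1 would
    -- need more than 2s.
    compress-int : ∀ {F} → Agreeing F → ∀ r → 1 ≤ r → r ≤ s →
      ∀ c x c′ x′ → compress r F c x ≡ true → compress r F c′ x′ ≡ true → t ≤ ι (c ∧ c′) + A x x′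
    compress-int {F} ag r 1≤r r≤s c x c′ x′ e e′ = decide (cross? (λ a → F a x) (λ a → F a x′)) (c ∧ c′) refl
      where
      a = element {λ a → F a x} (≤-trans 1≤r (bit-size r c _ 1≤r r≤s e))
      a′ = element {λ a → F a x′} (≤-trans 1≤r (bit-size r c′ _ 1≤r r≤s e′))
      decide : _ → ∀ b → c ∧ c′ ≡ b → t ≤ ι (c ∧ c′) + A x x′
      decide (inj₁ (u , v , fu , fv , far)) _ _ = ≤-trans (≤-trans (ag u x v x′ fu fv) (≤-reflexive (cong (λ b → ι b + A x x′) far))) (m≤n+m _ (ι (c ∧ c′)))
      decide (inj₂ cr) true  eq = ≤-trans (ag _ x _ x′ (proj₂ a) (proj₂ a′)) (≤-trans (+-monoˡ-≤ (A x x′) (ι≤1 (close (proj₁ a) (proj₁ a′)))) (≤-reflexive (cong (λ b → ι b + A x x′) (sym eq))))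
      decide (inj₂ cr) false eq = ⊥-elim (<⇒≱ (bit-large r c c′ _ _ 1≤r r≤s eq e e′) (cross-bound {λ a → F a x} {λ a → F a x′} cr a a′))

    module Measured (xs : List X) (mem : ∀ x → x ∈ xs) (w : X → ℕ) (w>0 : ∀ x → 1 ≤ w x) where

      valZ : (Fin m → X → Bool) → ℕ
      valZ F = ∑ xs (λ x → size-at F x * w x)

      val : (Bool → X → Bool) → ℕ
      val C = ∑ xs (λ x → (s * ι (C true x) + q * ι (C false x)) * w x)

      rsum-val : ∀ F → rsum s (λ r → val (compress (suc r) F)) ≡ ∑ xs (λ x → total (size-at F x) * w x)
      rsum-val F = trans (sym (∑-rsum xs s _)) (∑-cong xs (λ x → trans (rsum-cong s (λ r → *-comm (weight-of (suc r) (size-at F x)) (w x)))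
        (trans (rsum-*ˡ s (w x) _) (*-comm (w x) _))))

      s*valZ : ∀ F → s * valZ F ≡ ∑ xs (λ x → s * size-at F x * w x)
      s*valZ F = trans (sym (∑-*ˡ xs s _)) (∑-cong xs (λ x → sym (*-assoc s (size-at F x) (w x))))

      pointwise : ∀ F x → s * size-at F x * w x ≤ total (size-at F x) * w x
      pointwise F x = *-monoˡ-≤ (w x) (total-≥ (size-at F x) (card≤m (λ a → F a x)))

      average : ∀ F → s * valZ F ≤ rsum s (λ r → val (compress (suc r) F))
      average F = subst₂ _≤_ (sym (s*valZ F)) (sym (rsum-val F)) (∑-mono xs (pointwise F))

      valZ-bound : ∀ F W → (∀ r → r < s → val (compress (suc r) F) ≤ W) → valZ F ≤ W
      valZ-bound F W h = *-cancelˡ-≤ s {{>-nonZero 1≤s}} (≤-trans (average F) (rsum-bound s _ W h))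

      module Extremal (F : Fin m → X → Bool) (W : ℕ) (h : ∀ r → r < s → val (compress (suc r) F) ≤ W) (vF : valZ F ≡ W) where

        val≡ : ∀ r → r < s → val (compress (suc r) F) ≡ W
        val≡ = rsum-squeeze s _ W h (≤-trans (≤-reflexive (cong (s *_) (sym vF))) (average F))

        sizes-tight : ∀ x → total (size-at F x) ≤ s * size-at F x
        sizes-tight x = *-cancelʳ-≤ _ _ (w x) {{>-nonZero (w>0 x)}} (≤-reflexive (sym (∑-squeeze {xs = xs} (pointwise F) le (mem x))))
          where
          le : ∑ xs (λ x → total (size-at F x) * w x) ≤ ∑ xs (λ x → s * size-at F x * w x)
          le = subst₂ _≤_ (rsum-val F) (trans (cong (s *_) (sym vF)) (s*valZ F)) (rsum-bound s _ W h)

        module _ (st : Strict) where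

          rough : ∀ x → size-at F x ≤ s ⊎ size-at F x ≡ m
          rough x = total-tight st (size-at F x) (card≤m (λ a → F a x)) (sizes-tight x)

          false-bit : ∀ r k → r ≤ s → k ≤ s ⊎ k ≡ m → bit-of r false k ≡ true → k ≡ m
          false-bit r k r≤s (inj₂ e) _ = e
          false-bit r k r≤s (inj₁ h) e = ⊥-elim (<⇒≱ (≤-reflexive (+-comm 1 (s + s))) (≤-trans (≤ᵇ-true {s + s + 1} e) (+-mono-≤ h r≤s)))

          -- The replacements for r = 1 and r = s have the same value, and the second is contained
          -- in the first. So they coincide everywhere, which no size strictly between 0 and s
          -- permits.
          sizes : ∀ x → size-at F x ≡ 0 ⊎ size-at F x ≡ s ⊎ size-at F x ≡ m
          sizes x with rough x
          ... | inj₂ e = inj₂ (inj₂ e)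
          ... | inj₁ k≤s = small (size-at F x) refl
            where
            smaller : ∀ x → (s * ι (compress s F true x) + q * ι (compress s F false x)) * w x ≤ (s * ι (compress 1 F true x) + q * ι (compress 1 F false x)) * w x
            smaller x = *-monoˡ-≤ (w x) (+-mono-≤ (*-monoʳ-≤ s (ι-mono (λ e → true-≤ᵇ {1} (≤-trans 1≤s (≤ᵇ-true {s} e)))))
              (*-monoʳ-≤ q (ι-mono (λ e → true-≤ᵇ (≤-trans (+-monoˡ-≤ 1 2s≤m) (≤-reflexive (cong (_+ 1) (sym (false-bit s (size-at F x) ≤-refl (rough x) e)))))))))
            total-s : val (compress s F) ≡ W
            total-s = subst (λ r → val (compress r F) ≡ W) (m+[n∸m]≡n 1≤s) (val≡ (s ∸ 1) (≤-reflexive (m+[n∸m]≡n 1≤s)))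
            pointwise≡ : s * ι (compress s F true x) + q * ι (compress s F false x) ≡ s * ι (compress 1 F true x) + q * ι (compress 1 F false x)
            pointwise≡ = *-cancelʳ-≡ _ _ (w x) {{>-nonZero (w>0 x)}} (∑-squeeze {xs = xs} smaller (≤-reflexive (trans (val≡ 0 1≤s) (sym total-s))) (mem x))
            small : ∀ k → size-at F x ≡ k → size-at F x ≡ 0 ⊎ size-at F x ≡ s ⊎ size-at F x ≡ m
            small zero    e = inj₁ e
            small (suc k) e = inj₂ (inj₁ (≤-antisym k≤s (reach (s ≤? size-at F x))))
              where
              reach : Dec (s ≤ size-at F x) → s ≤ size-at F x
              reach (yes h) = h
              reach (no ¬h) = ⊥-elim (1+n≰n (≤-trans (≤-trans (*-mono-≤ 1≤s (≤-refl {1})) (≤-trans (≤-reflexive (cong (s *_) (sym (cong ι (true-≤ᵇ {1} (≤-trans (s≤s z≤n) (≤-reflexive (sym e)))))))) (m≤m+n _ _)))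
                (≤-reflexive (trans (sym pointwise≡) (cong₂ _+_ (trans (cong (s *_) (cong ι (false-≤ᵇ {s} (≰⇒> ¬h)))) (*-zeroʳ s))
                  (trans (cong (q *_) (cong ι (false-≤ᵇ {s + s + 1} (≤-trans (s≤s (+-monoˡ-≤ s k≤s)) (≤-reflexive (+-comm 1 (s + s))))))) (*-zeroʳ q)))))))

  1≤q : 1 ≤ q
  1≤q = ≤-trans 1≤s s≤q

  -- Families with bits and letters

  open Weighted s q
  open Positive 1≤s 1≤q
  module ZC = Connectivity close In far-out far-in
  open ZC using (agr; ins; outs; pattern-of; neighbour; Chain; nil; link; IrrChain; FarOff; []; on; off)

  -- Intermediate stage of the replacement: k coordinates are bits already and carry the weights,
  -- while l are still letters and count one each.
  Points : ℕ → ℕ → Set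
  Points k l = V k × Vec (Fin m) l

  points : ∀ k l → List (Points k l)
  points k l = pairs (B k) (allPoints m l)

  ∈-points : ∀ {k l} (z : Points k l) → z ∈ points k l
  ∈-points = ∈-pairs ∈-B (∈-allVecs ∈-allFin)

  meet : ∀ {k l} → Points k l → Points k l → ℕ
  meet (b , x) (b′ , x′) = int b b′ + agr x x′

  mass : ∀ {k l} → Points k l → ℕ
  mass (b , x) = wt b

  FamilyH : ℕ → ℕ → Set
  FamilyH k l = Points k l → Bool

  IntH : ∀ {k l} → FamilyH k l → Set
  IntH F = ∀ z z′ → F z ≡ true → F z′ ≡ true → t ≤ meet z z′

  value : ∀ {k l} → FamilyH k l → ℕ
  value {k} {l} F = ∑ (points k l) (λ z → ι (F z) * mass z)

  expose : ∀ {k l} → FamilyH k (suc l) → Fin m → Points k l → Bool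
  expose F a (b , x) = F (b , a ∷ x)

  absorb : ∀ {k l} → (Bool → Points k l → Bool) → FamilyH (suc k) l
  absorb C (c ∷ b , x) = C c (b , x)

  module At k l = Step {Points k l} meet t
  module AtM k l = At.Measured k l (points k l) ∈-points mass (λ z → wt>0 (proj₁ z))

  value-expose : ∀ {k l} (F : FamilyH k (suc l)) → value F ≡ AtM.valZ k l (expose F)
  value-expose {k} {l} F = trans (∑-pairs (B k) (allPoints m (suc l)) _) (trans (∑-cong (B k) row) (sym (∑-pairs (B k) (allPoints m l) _)))
    where
    row : ∀ b → ∑ (allPoints m (suc l)) (λ x → ι (F (b , x)) * wt b) ≡ ∑ (allPoints m l) (λ x → card-Fin (λ a → F (b , a ∷ x)) * wt b)
    row b = trans (∑-allVecs (allFin m) l _) (trans (∑-swap (allFin m) (allPoints m l) _)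
      (∑-cong (allPoints m l) (λ x → ∑-*ʳ (allFin m) (λ a → ι (F (b , a ∷ x))) (wt b))))

  value-absorb : ∀ {k l} (C : Bool → Points k l → Bool) → value (absorb C) ≡ AtM.val k l C
  value-absorb {k} {l} C = trans (∑-pairs (B (suc k)) (allPoints m l) _) (trans (∑-B k _)
    (trans (sym (∑-+ (B k) _ _)) (trans (∑-cong (B k) row) (sym (∑-pairs (B k) (allPoints m l) _)))))
    where
    ring : ∀ x y u v w → x * (v * w) + y * (u * w) ≡ (u * y + v * x) * w
    ring = solve-∀
    row : ∀ b → ∑ (allPoints m l) (λ x → ι (C false (b , x)) * (q * wt b)) + ∑ (allPoints m l) (λ x → ι (C true (b , x)) * (s * wt b))
      ≡ ∑ (allPoints m l) (λ x → (s * ι (C true (b , x)) + q * ι (C false (b , x))) * wt b)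
    row b = trans (sym (∑-+ (allPoints m l) _ _)) (∑-cong (allPoints m l) (λ x → ring (ι (C false (b , x))) (ι (C true (b , x))) s q (wt b)))

  expose-int : ∀ {k l} {F : FamilyH k (suc l)} → IntH F → At.Agreeing k l (expose F)
  expose-int h a (b , x) a′ (b′ , x′) e e′ = ≤-trans (h _ _ e e′) (≤-reflexive (ring (int b b′) (ι (close a a′)) (agr x x′)))
    where
    ring : ∀ x y z → x + (y + z) ≡ y + (x + z)
    ring = solve-∀

  absorb-int : ∀ {k l} {C : Bool → Points k l → Bool} → (∀ c z c′ z′ → C c z ≡ true → C c′ z′ ≡ true → t ≤ ι (c ∧ c′) + meet z z′) → IntH (absorb C)
  absorb-int h (c ∷ b , x) (c′ ∷ b′ , x′) e e′ = ≤-trans (h c (b , x) c′ (b′ , x′) e e′) (≤-reflexive (sym (+-assoc (ι (c ∧ c′)) (int b b′) (agr x x′))))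

  compressed : ∀ {k l} → ℕ → FamilyH k (suc l) → FamilyH (suc k) l
  compressed {k} {l} r F = absorb (At.compress k l r (expose F))

  compressed-int : ∀ {k l} {F : FamilyH k (suc l)} → IntH F → ∀ r → r < s → IntH (compressed (suc r) F)
  compressed-int {k} {l} {F} h r r<s = absorb-int {C = At.compress k l (suc r) (expose F)}
    (At.compress-int k l (expose-int {F = F} h) (suc r) (s≤s z≤n) r<s)

  value-bits : ∀ {k} (F : FamilyH k 0) → value F ≡ μ (λ b → F (b , []))
  value-bits {k} F = trans (∑-pairs (B k) (allPoints m 0) _) (∑-cong (B k) (λ b → +-identityʳ _))

  value≤ : ∀ l k {W} → (∀ (G : Family (l ⊕ k)) → Int t G → μ G ≤ W) → ∀ (F : FamilyH k l) → IntH F → value F ≤ W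
  value≤ zero    k bound F h = ≤-trans (≤-reflexive (value-bits F))
    (bound (λ b → F (b , [])) (λ v u e e′ → ≤-trans (h (v , []) (u , []) e e′) (≤-reflexive (+-identityʳ _))))
  value≤ (suc l) k {W} bound F h = ≤-trans (≤-reflexive (value-expose F)) (AtM.valZ-bound k l (expose F) W
    (λ r r<s → ≤-trans (≤-reflexive (sym (value-absorb (At.compress k l (suc r) (expose F)))))
      (value≤ l (suc k) bound (compressed (suc r) F) (compressed-int {F = F} h r r<s))))

  In-offset : ∀ y v → In y v ≡ true → ∃ λ j → 1 ≤ j × j ≤ s × at (toℕ y + j) ≡ v
  In-offset y v e = diffMod v y , proj₁ (In⁻ y v e) , proj₂ (In⁻ y v e) ,
    trans (cong (λ z → at (toℕ y + diffMod v z)) (sym (at-toℕ y))) (at-diff (toℕ y) v)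

  near : ∀ i e → e < s → close (at (i + e)) (at i) ≡ true
  near i e e<s = ⇒close _ _ (e , e<s , shift (diff-spec (at (i + e)) (at i)))
    where
    d≡ : diffMod (at (i + e)) (at i) ≡ e
    d≡ = diff-at i e (<-≤-trans e<s s≤m)
    shift : _ × (toℕ (at (i + e)) ≡ toℕ (at i) + diffMod (at (i + e)) (at i) ⊎ toℕ (at (i + e)) + m ≡ toℕ (at i) + diffMod (at (i + e)) (at i)) → _
    shift (_ , inj₁ x) = inj₁ (trans x (cong (toℕ (at i) +_) d≡))
    shift (_ , inj₂ x) = inj₂ (inj₁ (trans x (cong (toℕ (at i) +_) d≡)))

  close-sym′ : ∀ a b → close a b ≡ true → close b a ≡ true
  close-sym′ a b e with close b a in f
  ... | true  = refl
  ... | false = ⊥-elim (true≢false e (close-sym b a f))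

  close-refl : ∀ a → close a a ≡ true
  close-refl a = subst (λ x → close x x ≡ true) (at-toℕ a)
    (subst (λ x → close (at x) (at (toℕ a)) ≡ true) (+-identityʳ (toℕ a)) (near (toℕ a) 0 1≤s))

  within : ∀ (y : Fin m) j k → 1 ≤ j → j ≤ k → k ≤ s → close (at (toℕ y + k)) (at (toℕ y + j)) ≡ true
  within y j k 1≤j j≤k k≤s = subst (λ x → close (at x) (at (toℕ y + j)) ≡ true) (trans (+-assoc (toℕ y) j (k ∸ j)) (cong (toℕ y +_) (m+[n∸m]≡n j≤k)))
      (near (toℕ y + j) (k ∸ j) (≤-trans (∸-monoʳ-< {k} {j} {0} 1≤j j≤k) k≤s))

  In-close : ∀ y v u → In y v ≡ true → In y u ≡ true → close v u ≡ true
  In-close y v u e f with In-offset y v e | In-offset y u f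
  ... | j , 1≤j , j≤s , refl | k , 1≤k , k≤s , refl with ≤-total j k
  ...   | inj₁ j≤k = close-sym′ (at (toℕ y + k)) (at (toℕ y + j)) (within y j k 1≤j j≤k k≤s)
  ...   | inj₂ k≤j = within y k j 1≤k k≤j j≤s

  -- Consecutive letters have the common far letter s steps behind the first.
  module _ (2s<m : s + s < m) where

    chain-at : ∀ i j → Chain (at i) (at (i + j))
    chain-at i zero    = subst (λ x → Chain (at i) (at x)) (sym (+-identityʳ i)) nil
    chain-at i (suc j) = link (at (i + (m ∸ s))) (far′ i) (far″ i)
      (subst (λ x → Chain (at (suc i)) (at x)) (sym (+-suc i j)) (chain-at (suc i) j))
      where
      back : ∀ i e → at (i + (m ∸ s) + (s + e)) ≡ at (i + e)
      back i e = trans (cong at (trans (ring i (m ∸ s) s e) (cong (i + e +_) (m∸n+n≡m s≤m)))) (at-period (i + e))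
        where
        ring : ∀ i x s e → i + x + (s + e) ≡ i + e + (x + s)
        ring = solve-∀
      far′ : ∀ i → close (at i) (at (i + (m ∸ s))) ≡ false
      far′ i = subst (λ x → close x (at (i + (m ∸ s))) ≡ false) (trans (back i 0) (cong at (+-identityʳ i)))
        (far-apart (i + (m ∸ s)) (s + 0) (m≤m+n s 0) (≤-trans (≤-reflexive (cong (_+ s) (+-identityʳ s))) 2s≤m))
      far″ : ∀ i → close (at (suc i)) (at (i + (m ∸ s))) ≡ false
      far″ i = subst (λ x → close x (at (i + (m ∸ s))) ≡ false) (trans (back i 1) (cong at (+-comm i 1)))
        (far-apart (i + (m ∸ s)) (s + 1) (m≤m+n s 1) (≤-trans (≤-reflexive (ring s)) 2s<m))
        where
        ring : ∀ s → s + 1 + s ≡ suc (s + s)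
        ring = solve-∀

    chain : ∀ v u → Chain v u
    chain v u = subst₂ Chain (at-toℕ v) (trans (cong (λ z → at (toℕ v + diffMod u z)) (sym (at-toℕ v))) (at-diff (toℕ v) u)) (chain-at (toℕ v) (diffMod u v))

    irr-chain : ∀ {n} (ρ : V n) z z′ → IrrChain ρ z z′
    irr-chain []          []      []        = []
    irr-chain (true ∷ ρ)  (v ∷ z) (u ∷ z′) = on (irr-chain ρ z z′)
    irr-chain (false ∷ ρ) (v ∷ z) (u ∷ z′) = off (chain v u) (irr-chain ρ z z′)

  no-free : ∀ {n} (ρ : V n) → zeros ρ ≤ 0 → ∀ z z′ → IrrChain ρ z z′
  no-free []         h []      []        = []
  no-free (true ∷ ρ) h (v ∷ z) (u ∷ z′) = on (no-free ρ h z z′)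

  two-letters : m ≡ 2 → ∀ (a b c : Fin m) → a ≢ b → a ≢ c → c ≡ b
  two-letters refl zero       zero       c          ab ac = ⊥-elim (ab refl)
  two-letters refl (suc zero) (suc zero) c          ab ac = ⊥-elim (ab refl)
  two-letters refl zero       (suc zero) zero       ab ac = ⊥-elim (ac refl)
  two-letters refl zero       (suc zero) (suc zero) ab ac = refl
  two-letters refl (suc zero) zero       zero       ab ac = refl
  two-letters refl (suc zero) zero       (suc zero) ab ac = ⊥-elim (ac refl)

  -- The single free letter is either right already or is made right by one far step, since there
  -- are only two letters.
  one-free : m ≡ 2 → ∀ {n} (ρ : V n) → zeros ρ ≤ 1 → ∀ z z′ → IrrChain ρ z z′ ⊎ (∀ z″ → FarOff ρ z z″ → IrrChain ρ z″ z′)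
  one-free m≡2 []          h []      []       = inj₁ []
  one-free m≡2 (true ∷ ρ)  h (v ∷ z) (u ∷ z′) with one-free m≡2 ρ h z z′
  ... | inj₁ c = inj₁ (on c)
  ... | inj₂ f = inj₂ (λ { (w ∷ z″) (on fo) → on (f z″ fo) })
  one-free m≡2 (false ∷ ρ) h (v ∷ z) (u ∷ z′) with v ≟ᶠ u
  ... | yes refl = inj₁ (off nil (no-free ρ (s≤s⁻¹ h) z z′))
  ... | no v≢u   = inj₂ (λ { (w ∷ z″) (off far fo) → off (subst (Chain w) (two-letters m≡2 v u w v≢u (λ { refl → true≢false (close-refl v) far })) nil) (no-free ρ (s≤s⁻¹ h) z″ z′) })

  card-zero : ∀ {S} → card-Fin S ≡ 0 → ∀ a → S a ≡ false
  card-zero {S} e a with S a in h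
  ... | false = refl
  ... | true  = ⊥-elim (1+n≰n (≤-trans (≤-reflexive (sym (cong ι h))) (≤-trans (∑-term (ι ∘ S) (∈-allFin a)) (≤-reflexive e))))

  card-full : ∀ {S} → card-Fin S ≡ m → ∀ a → S a ≡ true
  card-full {S} e a with S a in h
  ... | true  = refl
  ... | false = ⊥-elim (1+n≰n (≤-trans (≤-reflexive (sym (∑-squeeze {xs = allFin m} {ι ∘ S} {λ _ → 1} (λ u → ι≤1 (S u))
      (≤-reflexive (trans (trans (rsum-allFin m (λ _ → 1) (λ _ → 1) (λ _ → refl)) (rsum-one m)) (sym e))) (∈-allFin a)))) (≤-reflexive (cong ι h))))

  close-≡ : s ≡ 1 → ∀ a b → close a b ≡ true → a ≡ b
  close-≡ refl a b e with close⇒ a b e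
  ... | zero , _ , inj₁ x               = toℕ-injective (trans x (+-identityʳ _))
  ... | zero , _ , inj₂ (inj₁ x)        = ⊥-elim (<⇒≱ (toℕ<n b) (≤-trans (m≤n+m m (toℕ a)) (≤-reflexive (trans x (+-identityʳ _)))))
  ... | zero , _ , inj₂ (inj₂ (inj₁ x)) = toℕ-injective (sym (trans x (+-identityʳ _)))
  ... | zero , _ , inj₂ (inj₂ (inj₂ x)) = ⊥-elim (<⇒≱ (toℕ<n a) (≤-trans (m≤n+m m (toℕ b)) (≤-reflexive (trans x (+-identityʳ _)))))
  ... | suc k , s≤s () , _

  module _ (s≡1 : s ≡ 1) (a : Fin m) where

    before : ℕ
    before = toℕ a + (m ∸ 1)

    at-before : at (before + 1) ≡ a
    at-before = trans (cong at (trans (+-assoc (toℕ a) (m ∸ 1) 1) (cong (toℕ a +_) (m∸n+n≡m 0<m)))) (trans (at-period (toℕ a)) (at-toℕ a))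

    In-singleton : ∀ v → In (at before) v ≡ true → v ≡ a
    In-singleton v e = trans (sym (at-diff before v)) (trans (cong (λ d → at (before + d)) d≡1) at-before)
      where
      d≡1 : diffMod v (at before) ≡ 1
      d≡1 = ≤-antisym (≤-trans (proj₂ (In⁻ (at before) v e)) (≤-reflexive s≡1)) (proj₁ (In⁻ (at before) v e))

    In-own : In (at before) a ≡ true
    In-own = subst (λ x → In (at before) x ≡ true) at-before (In-inside before 1 ≤-refl 1≤s)

  -- For s = 1 closeness is equality, so cross-close sets of size one are the same singleton, and a
  -- singleton is a window.
  cross-window′ : Strict → ∀ {S S′} → Cross S S′ → card-Fin S ≡ s → card-Fin S′ ≡ s → (∃ λ y → ∀ v → S v ≡ In y v) × (∀ v → S v ≡ S′ v)
  cross-window′ (inj₁ h) {S} {S′} = cross-window h {S} {S′}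
  cross-window′ (inj₂ (_ , s≡1)) {S} {S′} cross |S| |S′| = (at (before s≡1 a) , window) , same
    where
    a b : Fin m
    a = proj₁ (element {S} (≤-trans 1≤s (≤-reflexive (sym |S|))))
    b = proj₁ (element {S′} (≤-trans 1≤s (≤-reflexive (sym |S′|))))
    Sa : S a ≡ true
    Sa = proj₂ (element {S} (≤-trans 1≤s (≤-reflexive (sym |S|))))
    S′b : S′ b ≡ true
    S′b = proj₂ (element {S′} (≤-trans 1≤s (≤-reflexive (sym |S′|))))
    a≡b : a ≡ b
    a≡b = close-≡ s≡1 a b (cross a b Sa S′b)
    only : ∀ v → S v ≡ true → v ≡ a
    only v h = trans (close-≡ s≡1 v b (cross v b h S′b)) (sym a≡b)
    only′ : ∀ v → S′ v ≡ true → v ≡ a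
    only′ v h = sym (close-≡ s≡1 a v (cross a v Sa h))
    window : ∀ v → S v ≡ In (at (before s≡1 a)) v
    window v = bool-ext (λ h → subst (λ x → In (at (before s≡1 a)) x ≡ true) (sym (only v h)) (In-own s≡1 a))
      (λ h → subst (λ x → S x ≡ true) (sym (In-singleton s≡1 a v h)) Sa)
    same : ∀ v → S v ≡ S′ v
    same v = bool-ext (λ h → subst (λ x → S′ x ≡ true) (trans (sym a≡b) (sym (only v h))) S′b)
      (λ h → subst (λ x → S x ≡ true) (sym (only′ v h)) Sa)

  -- Structure of extremal mixed families

  Regular : Set
  Regular = s + s < m ⊎ (m ≡ 2 × s ≡ 1 × 2 ≤ t)

  origin : Fin m
  origin = at 0

  -- Bits become the letters 0 and 1 with window base 0, so that connectivity over one alphabet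
  -- covers mixed points.
  letter : Bool → Fin m
  letter true  = at 1
  letter false = at 0

  In-letter : ∀ b → In origin (letter b) ≡ b
  In-letter true  = In-inside 0 1 ≤-refl 1≤s
  In-letter false = In-at 0 0 0<m

  encode : ∀ {k l} → Points k l → Vec (Fin m) (k + l)
  encode ([] , x)    = x
  encode (b ∷ v , x) = letter b ∷ encode (v , x)

  decode : ∀ k {l} → Vec (Fin m) (k + l) → Points k l
  decode zero    z       = [] , z
  decode (suc k) (a ∷ z) = In origin a ∷ proj₁ (decode k z) , proj₂ (decode k z)

  decode-encode : ∀ {k l} (z : Points k l) → decode k (encode z) ≡ z
  decode-encode ([] , x)    = refl
  decode-encode (b ∷ v , x) = cong₂ (λ c z → c ∷ proj₁ z , proj₂ z) (In-letter b) (decode-encode (v , x))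

  origins : ∀ k {l} → Vec (Fin m) l → Vec (Fin m) (k + l)
  origins zero    y = y
  origins (suc k) y = origin ∷ origins k y

  hits : ∀ {k l} → V k → V l → Vec (Fin m) l → Points k l → ℕ
  hits R₁ R₂ y (b , x) = int b R₁ + ins R₂ y x

  ins-decode : ∀ k {l} (R₁ : V k) (R₂ : V l) y z → ins (R₁ ⧺ R₂) (origins k y) z ≡ hits R₁ R₂ y (decode k z)
  ins-decode zero    []       R₂ y z       = refl
  ins-decode (suc k) (r ∷ R₁) R₂ y (a ∷ z) = trans (cong (ι (In origin a ∧ r) +_) (ins-decode k R₁ R₂ y z)) (sym (+-assoc (ι (In origin a ∧ r)) _ _))

  agr-decode : ∀ k {l} (z z′ : Vec (Fin m) (k + l)) → meet (decode k z) (decode k z′) ≤ agr z z′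
  agr-decode zero    z       z′        = ≤-refl
  agr-decode (suc k) (a ∷ z) (a′ ∷ z′) = ≤-trans (≤-reflexive (+-assoc (ι (In origin a ∧ In origin a′)) _ _)) (+-mono-≤
    (ι-mono (λ e → In-close origin a a′ (proj₁ (∧-true e)) (proj₂ (∧-true {In origin a} e)))) (agr-decode k z z′))

  -- For m = 2 the connectivity argument needs that at most one coordinate is ignored.
  Form : ∀ {k l} → FamilyH k l → Set
  Form {k} {l} F = ∃ λ (R₁ : V k) → ∃ λ (R₂ : V l) → ∃ λ r → ∃ λ (y : Vec (Fin m) l) →
    size R₁ + size R₂ ≡ t + (r + r) × (2 ≤ t ⊎ r ≡ 0) × (s + s < m ⊎ (m ≡ 2 × zeros R₁ + zeros R₂ ≤ 1)) ×
    (∀ z → F z ≡ (t + r ≤ᵇ hits R₁ R₂ y z))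

  -- `R₁` and `R₂` form the threshold set without the exposed coordinate. Hence the level in
  -- question is t + r - 1 out of t + 2r - 1 window coordinates, as `Connectivity.Constant`
  -- requires.
  module MiddleLines {k l : ℕ} (regular : Regular) (F : Fin m → Points k l → Bool) (agreeing : At.Agreeing k l F)
    (R₁ : V k) (R₂ : V l) (r : ℕ) (y : Vec (Fin m) l) (R≡ : suc (size R₁ + size R₂) ≡ t + (r + r)) (large : 2 ≤ t ⊎ r ≡ 0)
    (few-free′ : s + s < m ⊎ (m ≡ 2 × zeros R₁ + zeros R₂ ≤ 1))
    (card-mid : ∀ z → suc (hits R₁ R₂ y z) ≡ t + r → card-Fin (λ a → F a z) ≡ s) where

    strict : s + s < m ⊎ (m ≡ 2 × s ≡ 1)
    strict = weaken regular
      where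
      weaken : Regular → s + s < m ⊎ (m ≡ 2 × s ≡ 1)
      weaken (inj₁ h)           = inj₁ h
      weaken (inj₂ (h , h′ , _)) = inj₂ (h , h′)

    j : ℕ
    j = t + r ∸ 1

    j≡ : suc j ≡ t + r
    j≡ = m+[n∸m]≡n (≤-trans 1≤t (m≤m+n t r))

    ρ : V (k + l)
    ρ = R₁ ⧺ R₂

    ys : Vec (Fin m) (k + l)
    ys = origins k y

    ρ≡ : size ρ ≡ j + r
    ρ≡ = trans (size-⧺ R₁ R₂) (suc-injective (trans R≡ (trans (sym (+-assoc t r r)) (cong (_+ r) (sym j≡)))))

    room : suc r ≤ j ⊎ size ρ ≡ 0
    room with room-for-swap 1≤t j≡ large
    ... | inj₁ h = inj₁ h
    ... | inj₂ h = inj₂ (trans ρ≡ h)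

    mid : ∀ z → ins ρ ys z ≡ j → suc (hits R₁ R₂ y (decode k z)) ≡ t + r
    mid z e = trans (cong suc (trans (sym (ins-decode k R₁ R₂ y z)) e)) j≡

    mid⁻ : ∀ z → suc (hits R₁ R₂ y z) ≡ t + r → ins ρ ys (encode z) ≡ j
    mid⁻ z e = trans (ins-decode k R₁ R₂ y (encode z)) (trans (cong (hits R₁ R₂ y) (decode-encode z)) (suc-injective (trans e (sym j≡))))

    line : Vec (Fin m) (k + l) → Fin m → Bool
    line z a = F a (decode k z)

    cross : ∀ z z′ → agr z z′ < t → Cross (line z) (line z′)
    cross z z′ lt a a′ e e′ with close a a′ in c
    ... | true  = refl
    ... | false = ⊥-elim (<⇒≱ (≤-<-trans (agr-decode k z z′) lt)
      (≤-trans (agreeing a (decode k z) a′ (decode k z′) e e′) (≤-reflexive (cong (λ b → ι b + meet (decode k z) (decode k z′)) c))))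

    windows : ∀ z z′ → ins ρ ys z ≡ j → ins ρ ys z′ ≡ j → agr z z′ < t → (∃ λ y₀ → ∀ a → line z a ≡ In y₀ a) × (∀ a → line z a ≡ line z′ a)
    windows z z′ e e′ lt = cross-window′ strict {line z} {line z′} (cross z z′ lt) (card-mid _ (mid z e)) (card-mid _ (mid z′ e′))

    module K a = ZC.Constant ρ ys t j r j≡ ρ≡ room (λ z → line z a) (λ z z′ e e′ lt → proj₂ (windows z z′ e e′ lt) a)

    constant : ∀ z z′ → ins ρ ys z ≡ j → ins ρ ys z′ ≡ j → ∀ a → line z a ≡ line z′ a
    constant z z′ e e′ a = decide few-free′
      where
      decide : s + s < m ⊎ (m ≡ 2 × zeros R₁ + zeros R₂ ≤ 1) → line z a ≡ line z′ a
      decide (inj₁ 2s<m) = K.lab-chain a z z′ e e′ (irr-chain 2s<m ρ z z′)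
      decide (inj₂ (m≡2 , zs)) = by (one-free m≡2 ρ (≤-trans (≤-reflexive (zeros-⧺ R₁ R₂)) zs) z z′)
        where
        by : IrrChain ρ z z′ ⊎ (∀ z″ → FarOff ρ z z″ → IrrChain ρ z″ z′) → line z a ≡ line z′ a
        by (inj₁ c) = K.lab-chain a z z′ e e′ c
        by (inj₂ f) = K.lab-detour a z z′ e e′ f

    window-from : ∀ z₀ → ins ρ ys z₀ ≡ j → ∃ λ y₀ → ∀ a → line z₀ a ≡ In y₀ a
    window-from z₀ i₀ = proj₁ (windows z₀ (proj₁ next) i₀ (proj₁ (proj₂ next))
      (K.few origin (subst (λ x → agr z₀ (proj₁ next) + x ≤ j) (K.outs≡ origin i₀) (proj₁ (proj₂ (proj₂ next))))))
      where
      next : ∃ λ z′ → ins ρ ys z′ ≡ j × agr z₀ z′ + outs ρ ys z₀ ≤ j × FarOff ρ z₀ z′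
      next = neighbour ρ ys z₀ j (≤-trans (≤-reflexive (K.outs≡ origin i₀)) (K.r≤k origin)) (K.k≤ρ origin)

    isMid : Points k l → Bool
    isMid z = suc (hits R₁ R₂ y z) ≡ᵇ t + r

    WindowAt : Fin m → Set
    WindowAt y₀ = ∀ z → suc (hits R₁ R₂ y z) ≡ t + r → ∀ a → F a z ≡ In y₀ a

    from-mid : ∀ z₀ → isMid z₀ ≡ true → ∃ WindowAt
    from-mid z₀ e₀ = proj₁ w , λ z e a → trans (cong (F a) (sym (decode-encode z)))
        (trans (constant (encode z) (encode z₀) (mid⁻ z e) i₀ a) (proj₂ w a))
      where
      i₀ : ins ρ ys (encode z₀) ≡ j
      i₀ = mid⁻ z₀ (≡ᵇ-true e₀)
      w : ∃ λ y₀ → ∀ a → line (encode z₀) a ≡ In y₀ a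
      w = window-from (encode z₀) i₀

    common-window : ∃ WindowAt
    common-window = decide (search (points k l) isMid)
      where
      decide : (∃ λ z → isMid z ≡ true) ⊎ (∀ {z} → z ∈ points k l → isMid z ≡ false) → ∃ WindowAt
      decide (inj₁ (z₀ , e₀)) = from-mid z₀ e₀
      decide (inj₂ none)      = origin , λ z e → ⊥-elim (true≢false (trans (cong (_≡ᵇ t + r) e) (true-≡ᵇ (t + r))) (none (∈-points z)))

  -- Only the replacement with r = 1 is followed. Equality in the average makes it extremal again,
  -- and its two bits already tell empty lines, lines of size s and full lines apart.
  threshold-form : ∀ l k {W} → Regular → (∀ (G : Family (l ⊕ k)) → Int t G → μ G ≤ W) → 1 ≤ W →
    ∀ (F : FamilyH k l) → IntH F → value F ≡ W → Form F
  threshold-form zero k {W} regular bound 1≤W F h v = bits (Bits.Characterisation.characterise s q t 1≤t 1≤s s≤q weights k G G-opt (nonempty (search (B k) G)))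
    where
    G : Family k
    G b = F (b , [])
    μG : μ G ≡ W
    μG = trans (sym (value-bits F)) v
    G-opt : Opt t G
    G-opt = (λ v u e e′ → ≤-trans (h (v , []) (u , []) e e′) (≤-reflexive (+-identityʳ _))) , λ H i → ≤-trans (bound H i) (≤-reflexive (sym μG))
    nonempty : (∃ λ v → G v ≡ true) ⊎ (∀ {v} → v ∈ B k → G v ≡ false) → ∃ λ v → G v ≡ true
    nonempty (inj₁ x)    = x
    nonempty (inj₂ none) = ⊥-elim (1+n≰n (≤-trans 1≤W (≤-reflexive (trans (sym μG) (μ-zero {k} {G} (λ u → none (∈-B u)))))))
    weights : s < q ⊎ (s ≡ 1 × q ≡ 1 × 2 ≤ t)
    weights = decide regular
      where
      decide : Regular → s < q ⊎ (s ≡ 1 × q ≡ 1 × 2 ≤ t)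
      decide (inj₁ 2s<m) = inj₁ (m+n≤o⇒m≤o∸n (suc s) 2s<m)
      decide (inj₂ (m≡2 , s≡1 , 2≤t)) = inj₂ (s≡1 , cong₂ _∸_ m≡2 s≡1 , 2≤t)
    bits : Threshold t G → Form F
    bits (R , r , R≡ , large , val) = R , [] , r , [] , trans (+-identityʳ _) R≡ , large , free regular ,
      λ { (b , []) → trans (val b) (cong (t + r ≤ᵇ_) (sym (+-identityʳ _))) }
      where
      free : Regular → s + s < m ⊎ (m ≡ 2 × zeros R + 0 ≤ 1)
      free (inj₁ h) = inj₁ h
      free (inj₂ (m≡2 , s≡1 , 2≤t)) = inj₂ (m≡2 , ≤-trans (≤-reflexive (+-identityʳ _)) (few-free s≡1 (cong₂ _∸_ m≡2 s≡1) 2≤t G G-opt R r R≡ val))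
  threshold-form (suc l) k {W} regular bound 1≤W F h v = uncompress (threshold-form l (suc k) regular bound 1≤W C C-int C-value)
    where
    bounds : ∀ r → r < s → AtM.val k l (At.compress k l (suc r) (expose F)) ≤ W
    bounds r r<s = ≤-trans (≤-reflexive (sym (value-absorb (At.compress k l (suc r) (expose F)))))
      (value≤ l (suc k) bound (compressed (suc r) F) (compressed-int {F = F} h r r<s))
    module X = AtM.Extremal k l (expose F) W bounds (trans (sym (value-expose F)) v)
    C : FamilyH (suc k) l
    C = compressed 1 F
    C-int : IntH C
    C-int = compressed-int {F = F} h 0 1≤s
    C-value : value C ≡ W
    C-value = trans (value-absorb (At.compress k l 1 (expose F))) (X.val≡ 0 1≤s)
    strict : s + s < m ⊎ (m ≡ 2 × s ≡ 1)
    strict = weaken regular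
      where
      weaken : Regular → s + s < m ⊎ (m ≡ 2 × s ≡ 1)
      weaken (inj₁ h)            = inj₁ h
      weaken (inj₂ (h , h′ , _)) = inj₂ (h , h′)
    lineSize : Points k l → ℕ
    lineSize z = At.size-at k l (expose F) z
    lineSizes : ∀ z → lineSize z ≡ 0 ⊎ lineSize z ≡ s ⊎ lineSize z ≡ m
    lineSizes = X.sizes strict
    top : ∀ z → bit-of 1 false (lineSize z) ≡ true → lineSize z ≡ m
    top z e = X.false-bit strict 1 (lineSize z) 1≤s (X.rough strict z) e
    top⁻ : ∀ z → lineSize z ≡ m → bit-of 1 false (lineSize z) ≡ true
    top⁻ z e = true-≤ᵇ (+-monoˡ-≤ 1 (≤-trans 2s≤m (≤-reflexive (sym e))))
    bottom : ∀ z → bit-of 1 true (lineSize z) ≡ false → lineSize z ≡ 0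
    bottom z e = n≤0⇒n≡0 (s≤s⁻¹ (≤ᵇ-false {1} e))
    uncompress : Form C → Form F
    uncompress (ρ ∷ R₁ , R₂ , r , y , R≡ , large , free , val) = cases ρ R≡ free (λ c b x → val (c ∷ b , x))
      where
      Val : Bool → Set
      Val ρ = ∀ c b x → bit-of 1 c (lineSize (b , x)) ≡ (t + r ≤ᵇ ι (c ∧ ρ) + int b R₁ + ins R₂ y x)
      cases : ∀ ρ → size (ρ ∷ R₁) + size R₂ ≡ t + (r + r) → s + s < m ⊎ (m ≡ 2 × zeros (ρ ∷ R₁) + zeros R₂ ≤ 1) → Val ρ → Form F
      -- An ignored coordinate has equal bits for 0 and 1, so each line is empty or full.
      cases false R≡ free val = R₁ , false ∷ R₂ , r , origin ∷ y , R≡ , large , move-zero free , value′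
        where
        move-zero : s + s < m ⊎ (m ≡ 2 × suc (zeros R₁) + zeros R₂ ≤ 1) → s + s < m ⊎ (m ≡ 2 × zeros R₁ + suc (zeros R₂) ≤ 1)
        move-zero (inj₁ h)       = inj₁ h
        move-zero (inj₂ (h , z)) = inj₂ (h , ≤-trans (≤-reflexive (+-suc (zeros R₁) (zeros R₂))) z)
        constant : ∀ b x a → F (b , a ∷ x) ≡ (t + r ≤ᵇ int b R₁ + ins R₂ y x)
        constant b x a = decide (t + r ≤ᵇ int b R₁ + ins R₂ y x) refl
          where
          decide : ∀ e → (t + r ≤ᵇ int b R₁ + ins R₂ y x) ≡ e → F (b , a ∷ x) ≡ (t + r ≤ᵇ int b R₁ + ins R₂ y x)
          decide true  e = trans (card-full {λ a → F (b , a ∷ x)} (top (b , x) (trans (val false b x) e)) a) (sym e)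
          decide false e = trans (card-zero {λ a → F (b , a ∷ x)} (bottom (b , x) (trans (val true b x) e)) a) (sym e)
        value′ : ∀ z → F z ≡ (t + r ≤ᵇ hits R₁ (false ∷ R₂) (origin ∷ y) z)
        value′ (b , a ∷ x) = trans (constant b x a) (cong (λ i → t + r ≤ᵇ int b R₁ + (ι i + ins R₂ y x)) (sym (Bool.∧-zeroʳ (In origin a))))
      cases true R≡ free val = R₁ , true ∷ R₂ , r , proj₁ cw ∷ y , trans (+-suc (size R₁) (size R₂)) R≡ , large , free , value′
        where
        -- One hit below the threshold the true bit is set and the false bit is not, which excludes
        -- the empty and the full line.
        mid-card : ∀ z → suc (hits R₁ R₂ y z) ≡ t + r → lineSize z ≡ s
        mid-card (b , x) e = decide (lineSizes (b , x))
          where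
          decide : lineSize (b , x) ≡ 0 ⊎ lineSize (b , x) ≡ s ⊎ lineSize (b , x) ≡ m → lineSize (b , x) ≡ s
          decide (inj₂ (inj₁ c)) = c
          decide (inj₁ c) = ⊥-elim (true≢false (trans (val true b x) (true-≤ᵇ (≤-reflexive (sym e)))) (cong (1 ≤ᵇ_) c))
          decide (inj₂ (inj₂ c)) = ⊥-elim (true≢false (top⁻ (b , x) c) (trans (val false b x) (false-≤ᵇ {t + r} (≤-reflexive e))))
        cw : ∃ λ y₀ → ∀ z → suc (hits R₁ R₂ y z) ≡ t + r → ∀ a → expose F a z ≡ In y₀ a
        cw = MiddleLines.common-window regular (expose F) (expose-int {F = F} h) R₁ R₂ r y R≡ large free mid-card
        inside : ∀ b x a → F (b , a ∷ x) ≡ (t + r ≤ᵇ ι (In (proj₁ cw) a) + (int b R₁ + ins R₂ y x))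
        inside b x a = decide (suc (int b R₁ + ins R₂ y x) ≟ t + r) (t + r ≤? int b R₁ + ins R₂ y x)
          where
          H : ℕ
          H = int b R₁ + ins R₂ y x
          decide : Dec (suc H ≡ t + r) → Dec (t + r ≤ H) → F (b , a ∷ x) ≡ (t + r ≤ᵇ ι (In (proj₁ cw) a) + H)
          decide (yes e) _ = trans (proj₂ cw (b , x) e a) (by-bit (In (proj₁ cw) a))
            where
            by-bit : ∀ i → i ≡ (t + r ≤ᵇ ι i + H)
            by-bit true  = sym (true-≤ᵇ (≤-reflexive (sym e)))
            by-bit false = sym (false-≤ᵇ {t + r} (≤-reflexive e))
          decide (no _) (yes le) = trans (card-full {λ a → F (b , a ∷ x)} (top (b , x) (trans (val false b x) (true-≤ᵇ le))) a) (sym (true-≤ᵇ (≤-trans le (m≤n+m H (ι (In (proj₁ cw) a))))))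
          decide (no ne) (no ¬le) = trans (card-zero {λ a → F (b , a ∷ x)} (bottom (b , x) (trans (val true b x) (false-≤ᵇ {t + r} far))) a)
              (sym (false-≤ᵇ {t + r} (≤-trans (s≤s (+-monoˡ-≤ H (ι≤1 (In (proj₁ cw) a)))) far)))
            where
            far : suc (suc H) ≤ t + r
            far = ≤∧≢⇒< (≰⇒> ¬le) ne
        value′ : ∀ z → F z ≡ (t + r ≤ᵇ hits R₁ (true ∷ R₂) (proj₁ cw ∷ y) z)
        value′ (b , a ∷ x) = trans (inside b x a) (cong (t + r ≤ᵇ_) (trans (cong (λ i → ι i + (int b R₁ + ins R₂ y x)) (sym (Bool.∧-identityʳ (In (proj₁ cw) a))))
          (ring (ι (In (proj₁ cw) a ∧ true)) (int b R₁) (ins R₂ y x))))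
          where
          ring : ∀ x y z → x + (y + z) ≡ y + (x + z)
          ring = solve-∀

  -- Preimages under σ

  σ≡pattern : ∀ {n} (y x : Vec (Fin m) n) → σ s y x ≡ pattern-of y x
  σ≡pattern []      []      = refl
  σ≡pattern (b ∷ y) (a ∷ x) = cong (In b a ∷_) (σ≡pattern y x)

  closeness : ∀ {n} → Vec (Fin m) n → Vec (Fin m) n → V n
  closeness []      []      = []
  closeness (a ∷ x) (b ∷ y) = close a b ∷ closeness x y

  agr≡ : ∀ {n} (x y : Vec (Fin m) n) → agr x y ≡ size (closeness x y)
  agr≡ []      []      = refl
  agr≡ (a ∷ x) (b ∷ y) = cong (ι (close a b) +_) (agr≡ x y)

  lookup-closeness : ∀ {n} (x y : Vec (Fin m) n) i → lookup (closeness x y) i ≡ close (lookup x i) (lookup y i)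
  lookup-closeness (a ∷ x) (b ∷ y) zero    = refl
  lookup-closeness (a ∷ x) (b ∷ y) (suc i) = lookup-closeness x y i

  agree⇒ : ∀ {n} (x y : Vec (Fin m) n) → AgreeUpTo t s x y → t ≤ agr x y
  agree⇒ x y (f , inj , c) = ≤-trans (injective⇒≤ {f = g} g-injective) (≤-reflexive (sym (agr≡ x y)))
    where
    hit : ∀ j → lookup (closeness x y) (f j) ≡ true
    hit j = trans (lookup-closeness x y (f j)) (⇒close _ _ (c j))
    g : Fin t → Fin (size (closeness x y))
    g j = rank (closeness x y) (f j) (hit j)
    g-injective : Injective _≡_ _≡_ g
    g-injective {i} {j} e = inj (rank-injective (closeness x y) (f i) (f j) (hit i) (hit j) e)

  ⇒agree : ∀ {n} (x y : Vec (Fin m) n) → t ≤ agr x y → AgreeUpTo t s x y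
  ⇒agree x y h = (λ j → true-positions v (inject≤ j h′)) ,
    (λ {i} {j} e → inject≤-injective h′ h′ i j (true-positions-injective v e)) ,
    (λ j → close⇒ _ _ (trans (sym (lookup-closeness x y _)) (true-positions-true v (inject≤ j h′))))
    where
    v = closeness x y
    h′ : t ≤ size v
    h′ = ≤-trans h (≤-reflexive (agr≡ x y))

  card-window : ∀ y → card-Fin (In y) ≡ s
  card-window y = trans (card-at (In y)) (trans (sym (Periodic.card-shift m {In y ∘ at} (λ i → cong (In y) (at-period i)) (toℕ y)))
    (trans (restrict m (λ d d<m → cong ι (trans (cong (λ z → In z (at (toℕ y + d))) (sym (at-toℕ y))) (In-at (toℕ y) d d<m)))) (numbers m s<m)))
    where
    s<m : s < m
    s<m = <-≤-trans (m<m+n s 1≤s) 2s≤m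
    restrict : ∀ n {f g : ℕ → ℕ} → (∀ d → d < n → f d ≡ g d) → rsum n f ≡ rsum n g
    restrict zero    h = refl
    restrict (suc n) h = cong₂ _+_ (h 0 (s≤s z≤n)) (restrict n (λ d l → h (suc d) (s≤s l)))
    numbers : ∀ n → s < n → rsum n (λ d → ι ((1 ≤ᵇ d) ∧ (d ≤ᵇ s))) ≡ s
    numbers (suc n) (s≤s h) = trans (count-below n s) (m≥n⇒m⊓n≡n h)

  ∑-window : ∀ y (f : Bool → ℕ) → ∑ (allFin m) (λ a → f (In y a)) ≡ q * f false + s * f true
  ∑-window y f = trans (∑-cong (allFin m) (λ a → split (In y a))) (trans (∑-+ (allFin m) _ _)
    (cong₂ _+_ (trans (∑-*ʳ (allFin m) (λ a → ι (not (In y a))) (f false)) (cong (_* f false) outside))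
      (trans (∑-*ʳ (allFin m) (λ a → ι (In y a)) (f true)) (cong (_* f true) (card-window y)))))
    where
    split : ∀ b → f b ≡ ι (not b) * f false + ι b * f true
    split true  = sym (+-identityʳ (f true))
    split false = sym (trans (+-identityʳ _) (+-identityʳ (f false)))
    one : ∀ b → ι (not b) + ι b ≡ 1
    one true  = refl
    one false = refl
    outside : ∑ (allFin m) (λ a → ι (not (In y a))) ≡ q
    outside = +-cancelʳ-≡ s _ q (trans (cong (∑ (allFin m) (λ a → ι (not (In y a))) +_) (sym (card-window y)))
      (trans (sym (∑-+ (allFin m) _ _)) (trans (∑-cong (allFin m) (λ a → one (In y a)))
        (trans (rsum-allFin m (λ _ → 1) (λ _ → 1) (λ _ → refl)) (trans (rsum-one m) (trans (sym s+q≡m) (+-comm s q)))))))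

  -- In each coordinate s letters lie in the window and m - s outside, which are the weights of a
  -- one and of a zero.
  pullback-count : ∀ {n} (y : Vec (Fin m) n) (G : Family n) → ∑ (allPoints m n) (λ x → ι (G (pattern-of y x))) ≡ μ G
  pullback-count []      G = trans (+-identityʳ _) (sym (trans (+-identityʳ _) (*-identityʳ _)))
  pullback-count {suc n} (b ∷ y) G = trans (∑-allVecs (allFin m) n _)
    (trans (∑-cong (allFin m) (λ a → pullback-count y (λ v → G (In b a ∷ v)))) (trans (∑-window b (λ c → μ (λ v → G (c ∷ v)))) (sym (μ-split G))))

  pattern-agr : ∀ {n} (y x x′ : Vec (Fin m) n) → int (pattern-of y x) (pattern-of y x′) ≤ agr x x′
  pattern-agr []      []      []        = z≤n
  pattern-agr (b ∷ y) (a ∷ x) (a′ ∷ x′) = +-mono-≤ (ι-mono (λ e → In-close b a a′ (proj₁ (∧-true e)) (proj₂ (∧-true {In b a} e)))) (pattern-agr y x x′)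

  module _ (n : ℕ) where

    hybrid : FamilyZ m n → FamilyH 0 n
    hybrid F (_ , x) = F x

    hybrid-int : ∀ {F} → IsAgreeing t s F → IntH (hybrid F)
    hybrid-int h ([] , x) ([] , x′) e e′ = agree⇒ x x′ (h x x′ e e′)

    hybrid-value : ∀ F → value (hybrid F) ≡ count F (allPoints m n)
    hybrid-value F = trans (∑-pairs ([] ∷ []) (allPoints m n) _) (trans (+-identityʳ _)
      (trans (∑-cong (allPoints m n) (λ x → *-identityʳ (ι (F x)))) (sym (count≡∑ F (allPoints m n)))))

    extend : ∀ {W} → (∀ (G : Family n) → Int t G → μ G ≤ W) → ∀ (G : Family (n ⊕ 0)) → Int t G → μ G ≤ W
    extend {W} h = subst (λ k → ∀ (G : Family k) → Int t G → μ G ≤ W) (sym (trans (⊕-identity n 0) (+-identityʳ n))) h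

    from-intersecting : ∀ {G : Family n} → IsIntersecting t G → Int t G
    from-intersecting h v u e e′ = ≤-trans (h v u e e′) (≤-reflexive (∣∩∣≡int v u))

    to-intersecting : ∀ {G : Family n} → Int t G → IsIntersecting t G
    to-intersecting h v u e e′ = ≤-trans (h v u e e′) (≤-reflexive (sym (∣∩∣≡int v u)))

    pullback-value : ∀ (y : Vec (Fin m) n) G (F : FamilyZ m n) → (∀ x → F x ≡ G (pattern-of y x)) → count F (allPoints m n) ≡ μ G
    pullback-value y G F e = trans (count≡∑ F (allPoints m n)) (trans (∑-cong (allPoints m n) (λ x → cong ι (e x))) (pullback-count y G))

    agreeing-bound : ∀ {G : Family n} → Opt t G → ∀ F → IsAgreeing t s F → count F (allPoints m n) ≤ μ G
    agreeing-bound o F h = ≤-trans (≤-reflexive (sym (hybrid-value F))) (value≤ n 0 (extend (proj₂ o)) (hybrid F) (hybrid-int h))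

    pullback-agreeing : ∀ (y : Vec (Fin m) n) {G} → Int t G → IsAgreeing t s (λ x → G (pattern-of y x))
    pullback-agreeing y h x x′ e e′ = ⇒agree x x′ (≤-trans (h _ _ e e′) (pattern-agr y x x′))

    extremal : ∀ {G : Family n} → Regular → Opt t G → ∀ F → IsAgreeing t s F → count F (allPoints m n) ≡ μ G →
      ∃ λ (y : Vec (Fin m) n) → ∃ λ (H : Family n) → (∀ x → F x ≡ H (pattern-of y x)) × Int t H
    extremal {G} regular o F h e = cases (μ G) refl
      where
      cases : ∀ W → μ G ≡ W → _
      -- If the maximum is zero, F is empty and any base point serves; the threshold form is used
      -- for positive maxima.
      cases zero e′ = Vec.replicate n origin , (λ _ → false) , empty , λ _ _ ()
        where
        empty : ∀ x → F x ≡ false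
        empty x with F x in f
        ... | false = refl
        ... | true  = ⊥-elim (1+n≰n (≤-trans (≤-reflexive (sym (cong ι f))) (≤-trans (∑-term (ι ∘ F) (∈-allVecs ∈-allFin x))
          (≤-reflexive (trans (sym (count≡∑ F (allPoints m n))) (trans e e′))))))
      cases (suc W) e′ with threshold-form n 0 regular (extend (λ H i → ≤-trans (proj₂ o H i) (≤-reflexive e′))) (s≤s z≤n)
        (hybrid F) (hybrid-int h) (trans (hybrid-value F) (trans e e′))
      ... | [] , R , r , y , R≡ , _ , _ , val = y , (λ A → t + r ≤ᵇ int A R) , (λ x → val ([] , x)) , threshold-int R R≡

  -- Return to rational measures

  Optimal : ℚ → ℕ → Set
  Optimal p n = ∀ (v : ℚ) → IsMaxIntersecting n t p v → (F : FamilyZ m n) → IsAgreeing t s F → μZ m n F ≡ v →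
    Σ (Vec (Fin m) n) λ y → Σ (FamilyP n) λ G → IsPreimage s y F G × IsIntersecting t G × μp n p G ≡ v

  module _ (n : ℕ) where

    open import Data.Integer using (+_)
    open Fractions

    private
      instance
        m^n : NonZero (m ^ n)
        m^n = m^n≢0 m n

    μp-fraction : ∀ (G : Family n) → μp n (+ s / m) G ≡ + μ G / (m ^ n)
    μp-fraction = Measure.μp≡ s m s≤m

    G : Family n
    G = proj₁ (optimum s q n t)

    G-opt : Opt t G
    G-opt = proj₂ (optimum s q n t)

    -- Turning all letters into bits bounds every agreeing family by a heaviest intersecting one,
    -- and the preimage of the latter for any base point attains the bound.
    common-maximum : Σ ℚ λ v → IsMaxAgreeing m n t s v × IsMaxIntersecting n t (+ s / m) v
    common-maximum = + μ G / (m ^ n) ,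
      (((λ x → G (pattern-of y₀ x)) , pullback-agreeing n y₀ (proj₁ G-opt) , cong (λ k → + k / (m ^ n)) (pullback-value n y₀ G _ (λ _ → refl))) ,
        (λ F h → /-mono (count F (allPoints m n)) (μ G) (m ^ n) (agreeing-bound n G-opt F h))) ,
      ((G , to-intersecting n (proj₁ G-opt) , μp-fraction G) ,
        (λ H h → subst (λ x → x ≤ℚ + μ G / (m ^ n)) (sym (μp-fraction H)) (/-mono (μ H) (μ G) (m ^ n) (proj₂ G-opt H (from-intersecting n h)))))
      where
      y₀ : Vec (Fin m) n
      y₀ = Vec.replicate n origin

    -- Any family `K` attaining the given maximum is optimal in the integer sense. The measure of
    -- the family that is found equals that of F, because taking preimages preserves measure.
    optimal-preimage : Regular → Optimal (+ s / m) n
    optimal-preimage regular v ((K , K-int , K-value) , K-max) F F-agr F-value =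
      finish (extremal n {K} regular K-opt F F-agr (/-injective (count F (allPoints m n)) (μ K) (m ^ n) (trans F-value (trans (sym K-value) (μp-fraction K)))))
      where
      K-opt : Opt t K
      K-opt = from-intersecting n K-int , λ H i → /-cancel (μ H) (μ K) (m ^ n)
        (subst₂ _≤ℚ_ (μp-fraction H) (trans (sym K-value) (μp-fraction K)) (K-max H (to-intersecting n i)))
      finish : (∃ λ (y : Vec (Fin m) n) → ∃ λ (H : Family n) → (∀ x → F x ≡ H (pattern-of y x)) × Int t H) →
        Σ (Vec (Fin m) n) λ y → Σ (FamilyP n) λ G → IsPreimage s y F G × IsIntersecting t G × μp n (+ s / m) G ≡ v
      finish (y , H , e , i) = y , H , (λ x → trans (e x) (cong H (sym (σ≡pattern y x)))) , to-intersecting n i ,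
        trans (μp-fraction H) (trans (cong (λ k → + k / (m ^ n)) (sym (pullback-value n y H F e))) F-value)

open import Data.Integer using (+_)

theorem5p3 : (n m t s : ℕ) .{{_ : NonZero m}} → 1 ≤ n → 1 ≤ m → 1 ≤ t → 1 ≤ s → 2 * s ≤ m →
    (Σ ℚ λ v → IsMaxAgreeing m n t s v × IsMaxIntersecting n t ((+ s) / m) v)
    × ((2 * s < m ⊎ (m ≡ 2 × s ≡ 1 × 1 < t)) →
    (v : ℚ) → IsMaxIntersecting n t ((+ s) / m) v →
    (F : FamilyZ m n) → IsAgreeing t s F → μZ m n F ≡ v →
    Σ (Vec (Fin m) n) λ y → Σ (FamilyP n) λ G →
    IsPreimage s y F G × IsIntersecting t G × μp n ((+ s) / m) G ≡ v)
theorem5p3 n m t s _ _ 1≤t 1≤s 2s≤m =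
  Cyclic.common-maximum m s t 1≤s 2s≤m′ 1≤t n , λ strict → Cyclic.optimal-preimage m s t 1≤s 2s≤m′ 1≤t n (regular strict)
  where
  twice : s + s ≡ 2 * s
  twice = cong (λ k → s + k) (sym (+-identityʳ s))
  2s≤m′ : s + s ≤ m
  2s≤m′ = ≤-trans (≤-reflexive twice) 2s≤m
  regular : 2 * s < m ⊎ (m ≡ 2 × s ≡ 1 × 1 < t) → Cyclic.Regular m s t 1≤s 2s≤m′ 1≤t
  regular (inj₁ h) = inj₁ (≤-trans (≤-reflexive (cong suc twice)) h)
  regular (inj₂ h) = inj₂ h
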